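{- For any integers $a,b\geq 0$ and for any prime $p>2t+1$ with $t=a+b+1$, the following two congruences hold: $$H_{p-1}^q(\{2\}^a,3,\{2\}^b)+H_{p-1}^q(\{2\}^b,3,\{2\}^a)\equiv(-1)^{t-1}\binom{p+t}{2t+1}\frac{(1-q)^{2t+1}}{p(t+1)}\pmod{[p]_q},$$ $$S_{p-1}^q(\{2\}^a,3,\{2\}^b)+S_{p-1}^q(\{2\}^b,3,\{2\}^a)\equiv-(1-q)^{2t+1}\sum_{i=0}^t\left(t\binom{t-1}{i}+(t-1)\binom{t}{i}\right)(-1)^{i}K_{2t-i}(p)\pmod{[p]_q}.$$
   Context: Here $q$ is an indeterminate and $[n]_q=\frac{1-q^n}{1-q}=1+q+\cdots+q^{n-1}$. For positive integers $s_1,\dots,s_l$, $$H_n^q(s_1,\ldots,s_l)=\sum_{1\le k_1<\cdots<k_l\le n}\prod_{i=1}^l\frac{q^{(s_i-1)k_i}}{[k_i]_q^{s_i}},\qquad S_n^q(s_1,\ldots,s_l)=\sum_{1\le k_1\le\cdots\le k_l\le n}\prod_{i=1}^l\frac{q^{(s_i-1)k_i}}{[k_i]_q^{s_i}}.$$ $\{s\}^t$ denotes $t\ge0$ consecutive copies of $s$. The rational numbers $K_n(p)$ ($n\ge0$) are defined by the expansion about $z=1$ $$\frac{p(z-1)}{z^p-1}=\sum_{n=0}^{\infty}(-1)^{n-1}K_n(p)(z-1)^n$$ (so $K_0(p)=-1$, $K_1(p)=-\frac{p-1}{2}$, $K_2(p)=-\frac{p^2-1}{12}$). For a prime $p$ and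 rational functions $A,B$ in $q$, $A\equiv B\pmod{[p]_q}$ means $A-B=f/g$ with $f,g$ polynomials in $q$ with integer coefficients, $g$ coprime to $[p]_q$ in $\mathbb{Q}[q]$, and $[p]_q\mid f$ ($[p]_q$ is the $p$th cyclotomic polynomial, irreducible over $\mathbb{Q}$). -}

module Defs where

open import Algebra.Bundles.Raw using (RawRing)
import Algebra.Definitions.RawSemiring as RawSemiringDefs
open import Data.Fin.Base using (toℕ)
open import Data.Integer.Base as ℤ using (ℤ)
open import Data.List.Base using (List; []; _∷_; map; replicate)
open import Data.Nat.Base using (ℕ; zero; suc; pred; _+_; _*_; _∸_; NonZero)
open import Data.Product.Base using (_×_; ∃₂; Σ-syntax)
open import Data.Rational.Base as ℚ using (ℚ; 0ℚ; 1ℚ)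
import Data.Rational.Properties as ℚ
open import Data.Sum.Base using (_⊎_; inj₁; inj₂; [_,_]′)
open import Function.Base using (_∘_)
open import Level using (0ℓ)
open import Relation.Binary.PropositionalEquality
open import Relation.Nullary.Decidable.Core using (yes; no)
open import Relation.Nullary.Negation.Core using (¬_; contradiction)

module Sum (R : RawRing 0ℓ 0ℓ) where
  open RawRing R using (Carrier; rawSemiring)
  open RawSemiringDefs rawSemiring using (sum)

  -- f 0 + f 1 + ⋯ + f (n - 1)
  ∑< : (n : ℕ) → (ℕ → Carrier) → Carrier
  ∑< n f = sum {n} (f ∘ toℕ)

-- A polynomial in one indeterminate is its list of coefficients, constant term
-- first. Trailing zeros are allowed, so equality is coefficientwise.

module Polynomial (R : RawRing 0ℓ 0ℓ) where
  private module R = RawRing R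

  Poly : Set
  Poly = List R.Carrier

  coeff : Poly → ℕ → R.Carrier
  coeff []      _       = R.0#
  coeff (a ∷ _) zero    = a
  coeff (_ ∷ f) (suc n) = coeff f n

  infix  4 _≈_ _≉_
  infixl 6 _⊕_
  infixl 7 _⊛_

  _≈_ _≉_ : Poly → Poly → Set
  f ≈ g = ∀ n → coeff f n R.≈ coeff g n
  f ≉ g = ¬ f ≈ g

  _⊕_ : Poly → Poly → Poly
  []      ⊕ g       = g
  (a ∷ f) ⊕ []      = a ∷ f
  (a ∷ f) ⊕ (b ∷ g) = (a R.+ b) ∷ (f ⊕ g)

  _⊛_ : Poly → Poly → Poly
  []      ⊛ g = []
  (a ∷ f) ⊛ g = map (a R.*_) g ⊕ (R.0# ∷ f ⊛ g)

  rawRing : RawRing 0ℓ 0ℓ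
  rawRing = record
    { Carrier = Poly
    ; _≈_     = _≈_
    ; _+_     = _⊕_
    ; _*_     = _⊛_
    ; -_      = map R.-_
    ; 0#      = []
    ; 1#      = R.1# ∷ []
    }

  open RawSemiringDefs (RawRing.rawSemiring rawRing) public
    using (_∣_; Coprime; _^_)

  var : Poly
  var = R.0# ∷ R.1# ∷ []

  -- [ n ]q = 1 + q + ⋯ + q^(n-1)
  [_]q : ℕ → Poly
  [ n ]q = replicate n R.1#

module ℤ[q] = Polynomial ℤ.+-*-rawRing
module ℚ[q] = Polynomial ℚ.+-*-rawRing

ℤ[q]→ℚ[q] : ℤ[q].Poly → ℚ[q].Poly
ℤ[q]→ℚ[q] = map (ℚ._/ 1)

------------------------------------------------------------------------
-- ℚ[q] has no zero divisors

open ℚ[q] using (Poly; coeff; _≈_; _≉_; _⊕_; _⊛_)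

coeff-⊕ : ∀ f g n → coeff (f ⊕ g) n ≡ coeff f n ℚ.+ coeff g n
coeff-⊕ []      g       n       = sym (ℚ.+-identityˡ _)
coeff-⊕ (a ∷ f) []      n       = sym (ℚ.+-identityʳ _)
coeff-⊕ (a ∷ f) (b ∷ g) zero    = refl
coeff-⊕ (a ∷ f) (b ∷ g) (suc n) = coeff-⊕ f g n

coeff-map : ∀ a g n → coeff (map (a ℚ.*_) g) n ≡ a ℚ.* coeff g n
coeff-map a []      n       = sym (ℚ.*-zeroʳ a)
coeff-map a (b ∷ g) zero    = refl
coeff-map a (b ∷ g) (suc n) = coeff-map a g n

coeff-∷⊛ : ∀ a f g n → coeff ((a ∷ f) ⊛ g) n ≡ a ℚ.* coeff g n ℚ.+ coeff (0ℚ ∷ f ⊛ g) n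
coeff-∷⊛ a f g n = trans (coeff-⊕ (map (a ℚ.*_) g) _ n) (cong (ℚ._+ coeff (0ℚ ∷ f ⊛ g) n) (coeff-map a g n))

coeff-0∷⊛ : ∀ f g n → coeff ((0ℚ ∷ f) ⊛ g) n ≡ coeff (0ℚ ∷ f ⊛ g) n
coeff-0∷⊛ f g n = trans (coeff-∷⊛ 0ℚ f g n)
  (trans (cong (ℚ._+ coeff (0ℚ ∷ f ⊛ g) n) (ℚ.*-zeroˡ (coeff g n))) (ℚ.+-identityˡ _))

coeff-⊛0∷ : ∀ f g n → coeff (f ⊛ (0ℚ ∷ g)) n ≡ coeff (0ℚ ∷ f ⊛ g) n
coeff-⊛0∷ []      g zero    = refl
coeff-⊛0∷ []      g (suc n) = refl
coeff-⊛0∷ (a ∷ f) g zero    = trans (ℚ.+-identityʳ _) (ℚ.*-zeroʳ a)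
coeff-⊛0∷ (a ∷ f) g (suc n) = trans (coeff-∷⊛ a f (0ℚ ∷ g) (suc n))
  (trans (cong (a ℚ.* coeff g n ℚ.+_) (coeff-⊛0∷ f g n)) (sym (coeff-∷⊛ a f g n)))

a*b≡0⇒b≡0 : ∀ {a b} → a ≢ 0ℚ → a ℚ.* b ≡ 0ℚ → b ≡ 0ℚ
a*b≡0⇒b≡0 {a} {b} a≢0 ab≡0 = begin
  b                      ≡⟨ ℚ.*-identityˡ b ⟨
  1ℚ ℚ.* b               ≡⟨ cong (ℚ._* b) (ℚ.*-inverseˡ a) ⟨
  (ℚ.1/ a) ℚ.* a ℚ.* b   ≡⟨ ℚ.*-assoc (ℚ.1/ a) a b ⟩
  (ℚ.1/ a) ℚ.* (a ℚ.* b) ≡⟨ cong ((ℚ.1/ a) ℚ.*_) ab≡0 ⟩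
  (ℚ.1/ a) ℚ.* 0ℚ        ≡⟨ ℚ.*-zeroʳ (ℚ.1/ a) ⟩
  0ℚ                     ∎
  where
  open ≡-Reasoning
  instance _ = ℚ.≢-nonZero a≢0

∷-≈[] : ∀ f → f ≈ [] → 0ℚ ∷ f ≈ []
∷-≈[] f f≈[] zero    = refl
∷-≈[] f f≈[] (suc n) = f≈[] n

a∷f⊛g≈[]⇒g≈[] : ∀ a f g → a ≢ 0ℚ → (a ∷ f) ⊛ g ≈ [] → g ≈ []
a∷f⊛g≈[]⇒g≈[] a f []      a≢0 fg≈[] n = refl
a∷f⊛g≈[]⇒g≈[] a f (b ∷ g) a≢0 fg≈[]
  with refl ← a*b≡0⇒b≡0 {a} {b} a≢0 (trans (sym (ℚ.+-identityʳ _)) (fg≈[] 0)) =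
  ∷-≈[] g (a∷f⊛g≈[]⇒g≈[] a f g a≢0
    (λ n → trans (sym (coeff-⊛0∷ (a ∷ f) g (suc n))) (fg≈[] (suc n))))

f⊛g≈[]⇒f≈[]⊎g≈[] : ∀ f g → f ⊛ g ≈ [] → f ≈ [] ⊎ g ≈ []
f⊛g≈[]⇒f≈[]⊎g≈[] []      g fg≈[] = inj₁ (λ _ → refl)
f⊛g≈[]⇒f≈[]⊎g≈[] (a ∷ f) g fg≈[] with a ℚ.≟ 0ℚ
... | no a≢0   = inj₂ (a∷f⊛g≈[]⇒g≈[] a f g a≢0 fg≈[])
... | yes refl = [ inj₁ ∘ ∷-≈[] f , inj₂ ]′ (f⊛g≈[]⇒f≈[]⊎g≈[] f g
    (λ n → trans (sym (coeff-0∷⊛ f g (suc n))) (fg≈[] (suc n))))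

⊛-≉[] : ∀ f g → f ≉ [] → g ≉ [] → f ⊛ g ≉ []
⊛-≉[] f g f≉[] g≉[] fg≈[] = [ f≉[] , g≉[] ]′ (f⊛g≈[]⇒f≈[]⊎g≈[] f g fg≈[])

1≉[] : 1ℚ ∷ [] ≉ []
1≉[] 1≈[] with () ← 1≈[] 0

[k]≉[] : ∀ k .{{_ : NonZero k}} → ℚ[q].[ k ]q ≉ []
[k]≉[] (suc k) [k]≈[] with () ← [k]≈[] 0

------------------------------------------------------------------------
-- The field ℚ(q)

record ℚ⟨q⟩ : Set where
  constructor frac
  field
    num   : Poly
    den   : Poly
    den≉0 : den ≉ []

open ℚ⟨q⟩

infix 4 _≃_

_≃_ : ℚ⟨q⟩ → ℚ⟨q⟩ → Set
A ≃ B = num A ⊛ den B ≈ num B ⊛ den A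

poly : Poly → ℚ⟨q⟩
poly f = frac f (1ℚ ∷ []) 1≉[]

const : ℚ → ℚ⟨q⟩
const c = poly (c ∷ [])

ℚ⟨q⟩-rawRing : RawRing 0ℓ 0ℓ
ℚ⟨q⟩-rawRing = record
  { Carrier = ℚ⟨q⟩
  ; _≈_     = _≃_
  ; _+_     = λ A B → frac (num A ⊛ den B ⊕ num B ⊛ den A) (den A ⊛ den B)
                          (⊛-≉[] (den A) (den B) (den≉0 A) (den≉0 B))
  ; _*_     = λ A B → frac (num A ⊛ num B) (den A ⊛ den B)
                          (⊛-≉[] (den A) (den B) (den≉0 A) (den≉0 B))
  ; -_      = λ A → frac (map ℚ.-_ (num A)) (den A) (den≉0 A)
  ; 0#      = poly []
  ; 1#      = const 1ℚ
  }

open RawRing ℚ⟨q⟩-rawRing public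
  using () renaming (_+_ to infixl 6 _+ᶠ_; _*_ to infixl 7 _*ᶠ_; -_ to infix 8 -ᶠ_; 0# to 0ᶠ; 1# to 1ᶠ)
open RawSemiringDefs (RawRing.rawSemiring ℚ⟨q⟩-rawRing) public
  using () renaming (_^_ to infixr 9 _^ᶠ_)
open Sum ℚ⟨q⟩-rawRing public using () renaming (∑< to ∑ᶠ<)
open Sum ℚ.+-*-rawRing public using () renaming (∑< to ∑ℚ<)

infixl 6 _-ᶠ_
_-ᶠ_ : ℚ⟨q⟩ → ℚ⟨q⟩ → ℚ⟨q⟩
A -ᶠ B = A +ᶠ -ᶠ B

q : ℚ⟨q⟩
q = poly ℚ[q].var

1/[_]q : (k : ℕ) .{{_ : NonZero k}} → ℚ⟨q⟩
1/[ k ]q = frac (1ℚ ∷ []) ℚ[q].[ k ]q ([k]≉[] k)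

-- Divisibility of f is taken in ℤ[q]; as [ p ]q is monic this agrees with
-- divisibility in ℚ[q].

infix 4 _≡_mod[_]q

_≡_mod[_]q : ℚ⟨q⟩ → ℚ⟨q⟩ → ℕ → Set
A ≡ B mod[ p ]q =
  ∃₂ λ (f g : ℤ[q].Poly) →
    Σ[ g≉0 ∈ ℤ[q]→ℚ[q] g ≉ [] ]
      ( A -ᶠ B ≃ frac (ℤ[q]→ℚ[q] f) (ℤ[q]→ℚ[q] g) g≉0
      × ℚ[q].Coprime (ℤ[q]→ℚ[q] g) ℚ[q].[ p ]q
      × ℤ[q].[ p ]q ℤ[q].∣ f )

------------------------------------------------------------------------
-- Multiple q-harmonic (star) sums

-- q^((s - 1) k) / [ k ]q ^ s, for s ≥ 1
term : ℕ → (k : ℕ) .{{_ : NonZero k}} → ℚ⟨q⟩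
term s k = q ^ᶠ (pred s * k) *ᶠ 1/[ k ]q ^ᶠ s

-- The sum of f k over m < k ≤ n, with k = 1 + m + i.
∑ : (m n : ℕ) → ((k : ℕ) .{{_ : NonZero k}} → ℚ⟨q⟩) → ℚ⟨q⟩
∑ m n f = ∑ᶠ< (n ∸ m) λ i → f (suc (m + i))

-- The sum over m < k₁ < ⋯ < kₗ ≤ n.
H-above : (m n : ℕ) → List ℕ → ℚ⟨q⟩
H-above m n []       = 1ᶠ
H-above m n (s ∷ ss) = ∑ m n λ k → term s k *ᶠ H-above k n ss

-- The sum over m < k₁ ≤ ⋯ ≤ kₗ ≤ n; the constraint k₁ ≤ k₂ is pred k₁ < k₂.
S-above : (m n : ℕ) → List ℕ → ℚ⟨q⟩
S-above m n []       = 1ᶠ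
S-above m n (s ∷ ss) = ∑ m n λ k → term s k *ᶠ S-above (pred k) n ss

-- The entries of the exponent list are meant to be positive.
H S : ℕ → List ℕ → ℚ⟨q⟩
H = H-above 0
S = S-above 0

------------------------------------------------------------------------
-- The numbers Kₙ(p)

-- Coefficient of xᵐ in the product of the power series Σ aₙ xⁿ and Σ bₙ xⁿ.
convolve : (ℕ → ℚ) → (ℕ → ℚ) → ℕ → ℚ
convolve a b m = ∑ℚ< (suc m) λ i → a i ℚ.* b (m ∸ i)

-- With x = z - 1 as the indeterminate, K satisfies
--   p x = (z ^ p - 1) · Σ (-1)^(n-1) K n xⁿ.
-- For p ≥ 1 exactly one K does: z ^ p - 1 is x times a series with constant
-- term p. The sign is written (-1)^(n+1), which also makes sense at n = 0.
IsK : ℕ → (ℕ → ℚ) → Set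
IsK p K = ∀ m →
  coeff (((ℤ.+ p ℚ./ 1) ∷ []) ⊛ x) m
    ≡ convolve (coeff (z ℚ[q].^ p ⊕ (ℚ.- 1ℚ ∷ []))) (λ n → sign (suc n) ℚ.* K n) m
  where
  x z : Poly
  x = ℚ[q].var
  z = (1ℚ ∷ []) ⊕ x
  sign : ℕ → ℚ
  sign n = (ℤ.-1ℤ ℤ.^ n) ℚ./ 1

{-# OPTIONS --safe #-}

-- Reduce modulo [ p ]q, so that q becomes a primitive p-th root of unity ζ and u k = ζ^k / (1 - ζ^k)²
-- makes sense for 0 < k < p. Under k ↦ p - k the number u k is invariant, while the reflected factors of
-- weight 3 add up to - (1 - q) times a factor of weight 2; reversing the sums, each of the two symmetric
-- sums is - (1 - q)^(2t+1) times the elementary (resp. complete) symmetric function of degree t of the u k.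
--
-- With z = 1 + w and X = z - 2 + 1/z = w²/z one has z - u k w² = (1 - ζ^k z) (z - ζ^k) / (1 - ζ^k)², whence
--   p² X ∏ (1 - u k X) = z^p - 2 + z^-p.
-- Expanding the right side in powers of X gives the elementary symmetric functions. For the complete ones it
-- is enough that the claimed values convolve with the elementary ones to 1. These values are coefficients of
-- series in F = p w / (z^p - 1), the generating function of the K n, and after multiplication by p w the
-- convolution becomes a combination of the series z^t, z^(t+1), y^m, y^(m+1), where y = 1/z and m = p - t - 1,
-- whose relevant coefficient is zero.

module Submission where

import Algebra.Construct.Pointwise as Pointwise
open import Algebra.Bundles using (CommutativeRing)
open import Algebra.Definitions.RawMagma using (_,_)
open import Algebra.Morphism.Structures using (IsRingHomomorphism; IsRingMonomorphism)
import Algebra.Morphism.RingMonomorphism as RingMonomorphism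
open import Data.Integer.Base as ℤ using (ℤ; +_; -[1+_]; -1ℤ)
import Data.Integer.Properties as ℤ
open import Data.List.Base using (List; []; _∷_; _∷ʳ_; _++_; map; replicate; reverse; length)
open import Data.List.Membership.Propositional using (_∈_)
open import Data.List.Properties using (unfold-reverse; reverse-++; ∷ʳ-++; map-++; map-∘; map-replicate)
open import Data.List.Relation.Binary.Pointwise using (replicate⁺; ++⁺)
open import Data.List.Relation.Binary.Pointwise.Base as PW using (Pointwise; []; _∷_)
open import Data.List.Relation.Unary.Any using (here; there)
open import Data.Nat.Base as ℕ using (ℕ; zero; suc; _<_; _≤_; _∸_; z≤n; s≤s; z<s; s<s; NonZero)
open import Data.Nat.Combinatorics using (_C_; nCn≡1; nC1≡n; k>n⇒nCk≡0; nCk≡nC[n∸k]; nCk+nC[k+1]≡[n+1]C[k+1])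
open import Data.Nat.Coprimality using (prime⇒coprime; coprime-Bézout)
open import Data.Nat.GCD using (module Bézout)
open import Data.Nat.Primality using (Prime; prime⇒nonZero)
import Data.Nat.Properties as ℕ
import Data.Nat.Tactic.RingSolver as ℕ
open import Data.Product.Base using (∃; ∃₂; _×_; _,_; proj₁; proj₂)
open import Data.Rational.Base as ℚ using (ℚ; mkℚ; 0ℚ; 1ℚ; _/_)
import Data.Rational.Properties as ℚ
open import Data.Rational.Unnormalised.Base as ℚᵘ using (mkℚᵘ; *≡*)
import Data.Rational.Unnormalised.Properties as ℚᵘ
open import Data.Sign.Base as Sign using (Sign)
open import Function.Base using (_∘_; _⟨_⟩_)
open import Level using (0ℓ)
open import Relation.Binary.PropositionalEquality as ≡ using (_≡_)
open import Relation.Nullary.Decidable.Core using (yes; no)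
open import Relation.Nullary.Negation.Core using (contradiction)
open import Defs

-- No field with a root of unity is built. The computation runs over any commutative ring with an
-- element ζ, ζ^p = 1, and prescribed inverses `v j` of 1 - ζ^j for 0 < j < p; only at the end is
-- this ring ℚ[q] modulo `[ p ]q`. Nothing excludes zero divisors, so a factor is cancelled only by
-- an exhibited inverse or, among power series, by a shift of coefficients.
--
-- The complete functions are the harder half. The claimed value of degree j is a coefficient of
-- w^(2j) in a series that itself depends on j, so the values have no evident generating series in
-- X. Convolution with the elementary functions ε i repairs this, because X^i z^i = w^(2i): the
-- product of ε i and the j-th value is, with t = i + j, a coefficient of w^(2t) in a series where
-- j, apart from t, occurs only linearly. Writing j = (t + 1) - (i + 1), the sum over i needs just ∑
-- ε i X^i and ∑ (i + 1) ε i X^i. The second is as explicit as the first, since p (i + 1) ε i is the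
-- single binomial coefficient C(p + i, 2i + 1), the same that appears in the first congruence.

-- Ring solving with integer coefficients

module IntegerCoefficients (R : CommutativeRing 0ℓ 0ℓ) where
  open CommutativeRing R
  open import Algebra.Properties.Ring ring
  open import Algebra.Properties.AbelianGroup +-abelianGroup using (⁻¹-∙-comm)
  open import Algebra.Properties.Semiring.Mult.TCOptimised semiring renaming (_×_ to _·_)
  open import Algebra.Solver.Ring.AlmostCommutativeRing
  import Data.Maybe.Base as Maybe
  open import Relation.Nullary.Decidable.Core using (dec⇒maybe)
  open import Relation.Binary.Reasoning.Setoid setoid

  -- With the optimised multiple the literals 1 and 2 reduce to `1#` and `1# + 1#`, so solver
  -- equations fit goals that are stated with these.
  ⟦_⟧ : ℤ → Carrier
  ⟦ + n ⟧      = n · 1#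
  ⟦ -[1+ n ] ⟧ = - (suc n · 1#)

  ⟦-_⟧ : ∀ i → ⟦ ℤ.- i ⟧ ≈ - ⟦ i ⟧
  ⟦- + zero ⟧   = sym -0#≈0#
  ⟦- + suc n ⟧  = refl
  ⟦- -[1+ n ] ⟧ = sym (-‿involutive _)

  ⟦⊖⟧ : ∀ m n → ⟦ m ℤ.⊖ n ⟧ ≈ m · 1# - n · 1#
  ⟦⊖⟧ m       zero    = sym (trans (+-congˡ -0#≈0#) (+-identityʳ _))
  ⟦⊖⟧ zero    (suc n) = sym (+-identityˡ _)
  ⟦⊖⟧ (suc m) (suc n) = begin
    ⟦ suc m ℤ.⊖ suc n ⟧                  ≡⟨ ≡.cong ⟦_⟧ (ℤ.[1+m]⊖[1+n]≡m⊖n m n) ⟩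
    ⟦ m ℤ.⊖ n ⟧                          ≈⟨ ⟦⊖⟧ m n ⟩
    m · 1# - n · 1#                      ≈⟨ +-congʳ (+-identityʳ _) ⟨
    m · 1# + 0# - n · 1#                 ≈⟨ +-congʳ (+-congˡ (-‿inverseʳ 1#)) ⟨
    m · 1# + (1# - 1#) - n · 1#          ≈⟨ +-congʳ (+-assoc _ _ _) ⟨
    m · 1# + 1# - 1# - n · 1#            ≈⟨ +-assoc _ _ _ ⟩
    m · 1# + 1# + (- 1# - n · 1#)        ≈⟨ +-cong (+-comm _ _) (⁻¹-∙-comm _ _) ⟩
    1# + m · 1# - (1# + n · 1#)          ≈⟨ +-cong (1+× m 1#) (-‿cong (1+× n 1#)) ⟨
    suc m · 1# - suc n · 1#              ∎

  ⟦+⟧ : ∀ i j → ⟦ i ℤ.+ j ⟧ ≈ ⟦ i ⟧ + ⟦ j ⟧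
  ⟦+⟧ (+ m)    (+ n)    = ×-homo-+ 1# m n
  ⟦+⟧ (+ m)    -[1+ n ] = ⟦⊖⟧ m (suc n)
  ⟦+⟧ -[1+ m ] (+ n)    = trans (⟦⊖⟧ n (suc m)) (+-comm _ _)
  ⟦+⟧ -[1+ m ] -[1+ n ] = begin
    - (suc (suc (m ℕ.+ n)) · 1#)            ≡⟨ ≡.cong (λ k → - (suc k · 1#)) (≡.sym (ℕₚ.+-suc m n)) ⟩
    - ((suc m ℕ.+ suc n) · 1#)              ≈⟨ -‿cong (×-homo-+ 1# (suc m) (suc n)) ⟩
    - (suc m · 1# + suc n · 1#)             ≈⟨ ⁻¹-∙-comm _ _ ⟨
    - (suc m · 1#) - suc n · 1#             ∎
    where import Data.Nat.Properties as ℕₚ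

  ⟦*⟧ : ∀ i j → ⟦ i ℤ.* j ⟧ ≈ ⟦ i ⟧ * ⟦ j ⟧
  ⟦*⟧ (+ m)    (+ n)    = trans (reflexive (≡.cong ⟦_⟧ (ℤ.+◃n≡+n (m ℕ.* n)))) (×1-homo-* m n)
  ⟦*⟧ (+ m)    -[1+ n ] = begin
    ⟦ Sign.- ℤ.◃ m ℕ.* suc n ⟧  ≡⟨ ≡.cong ⟦_⟧ (ℤ.-◃n≡-n (m ℕ.* suc n)) ⟩
    ⟦ ℤ.- + (m ℕ.* suc n) ⟧     ≈⟨ ⟦- + (m ℕ.* suc n) ⟧ ⟩
    - ((m ℕ.* suc n) · 1#)      ≈⟨ -‿cong (×1-homo-* m (suc n)) ⟩
    - (m · 1# * suc n · 1#)     ≈⟨ -‿distribʳ-* _ _ ⟩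
    m · 1# * - (suc n · 1#)     ∎
  ⟦*⟧ -[1+ m ] (+ n)    = begin
    ⟦ Sign.- ℤ.◃ suc m ℕ.* n ⟧  ≡⟨ ≡.cong ⟦_⟧ (ℤ.-◃n≡-n (suc m ℕ.* n)) ⟩
    ⟦ ℤ.- + (suc m ℕ.* n) ⟧     ≈⟨ ⟦- + (suc m ℕ.* n) ⟧ ⟩
    - ((suc m ℕ.* n) · 1#)      ≈⟨ -‿cong (×1-homo-* (suc m) n) ⟩
    - (suc m · 1# * n · 1#)     ≈⟨ -‿distribˡ-* _ _ ⟩
    - (suc m · 1#) * n · 1#     ∎
  ⟦*⟧ -[1+ m ] -[1+ n ] = begin
    (suc m ℕ.* suc n) · 1#             ≈⟨ ×1-homo-* (suc m) (suc n) ⟩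
    suc m · 1# * suc n · 1#            ≈⟨ -‿involutive _ ⟨
    - - (suc m · 1# * suc n · 1#)      ≈⟨ -‿cong (-‿distribˡ-* _ _) ⟩
    - (- (suc m · 1#) * suc n · 1#)    ≈⟨ -‿distribʳ-* _ _ ⟩
    - (suc m · 1#) * - (suc n · 1#)    ∎

  morphism : CommutativeRing.rawRing ℤ.+-*-commutativeRing
               -Raw-AlmostCommutative⟶ fromCommutativeRing R
  morphism = record
    { ⟦_⟧ = ⟦_⟧ ; +-homo = ⟦+⟧ ; *-homo = ⟦*⟧ ; -‿homo = ⟦-_⟧ ; 0-homo = refl ; 1-homo = refl }

  _coeff≟_ : ∀ i j → Maybe.Maybe (⟦ i ⟧ ≈ ⟦ j ⟧)
  i coeff≟ j = Maybe.map (reflexive ∘ ≡.cong ⟦_⟧) (dec⇒maybe (i ℤ.≟ j))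

-- Finite sums and natural multiples in a commutative ring

module Arithmetic (R : CommutativeRing 0ℓ 0ℓ) where
  open CommutativeRing R public
  open import Algebra.Properties.Ring ring public
    using (-‿distribˡ-*; -‿distribʳ-*; -0#≈0#; -‿involutive; x∙y⁻¹≈ε⇒x≈y; x≈y⇒x∙y⁻¹≈ε; +-cancelʳ)
  open import Algebra.Properties.CommutativeSemiring.Exp commutativeSemiring public
    using (_^_; ^-congˡ; ^-homo-*; ^-assocʳ; ^-distrib-*)
  open import Algebra.Properties.Semiring.Mult semiring using (×-homo-+; ×1-homo-*) renaming (_×_ to _·_)
  open import Algebra.Solver.Ring.AlmostCommutativeRing using (fromCommutativeRing)
  open import Algebra.Solver.Ring
    (CommutativeRing.rawRing ℤ.+-*-commutativeRing) (fromCommutativeRing R)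
    (IntegerCoefficients.morphism R) (IntegerCoefficients._coeff≟_ R) public
    using (solve; con; _:=_; _:+_; _:*_; _:-_; :-_; _:^_)
  open Sum rawRing public using (∑<)
  open import Relation.Binary.Reasoning.Setoid setoid

  -- Here the plain multiple is taken, for which `cast (suc n)` unfolds to `1# + cast n`; inductions
  -- on n rely on this.
  cast : ℕ → Carrier
  cast n = n · 1#

  cast-+ : ∀ m n → cast (m ℕ.+ n) ≈ cast m + cast n
  cast-+ = ×-homo-+ 1#

  cast-* : ∀ m n → cast (m ℕ.* n) ≈ cast m * cast n
  cast-* = ×1-homo-*

  cast-cong : ∀ {m n} → m ≡ n → cast m ≈ cast n
  cast-cong = reflexive ∘ ≡.cong cast

  1^n≈1 : ∀ n → 1# ^ n ≈ 1#
  1^n≈1 zero    = refl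
  1^n≈1 (suc n) = trans (*-identityˡ _) (1^n≈1 n)

  ∑-cong : ∀ n {f g} → (∀ i → i < n → f i ≈ g i) → ∑< n f ≈ ∑< n g
  ∑-cong zero    f≈g = refl
  ∑-cong (suc n) f≈g = +-cong (f≈g 0 z<s) (∑-cong n (λ i i<n → f≈g (suc i) (s<s i<n)))

  ∑-zero : ∀ n {f} → (∀ i → i < n → f i ≈ 0#) → ∑< n f ≈ 0#
  ∑-zero zero    f≈0 = refl
  ∑-zero (suc n) f≈0 =
    trans (+-cong (f≈0 0 z<s) (∑-zero n (λ i i<n → f≈0 (suc i) (s<s i<n)))) (+-identityˡ 0#)

  ∑-+ : ∀ n f g → ∑< n (λ i → f i + g i) ≈ ∑< n f + ∑< n g
  ∑-+ zero    f g = sym (+-identityˡ 0#)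
  ∑-+ (suc n) f g = trans (+-congˡ (∑-+ n (f ∘ suc) (g ∘ suc)))
    (solve 4 (λ a b c d → (a :+ b) :+ (c :+ d) := (a :+ c) :+ (b :+ d)) refl _ _ _ _)

  ∑-*ˡ : ∀ n c f → ∑< n (λ i → c * f i) ≈ c * ∑< n f
  ∑-*ˡ zero    c f = sym (zeroʳ c)
  ∑-*ˡ (suc n) c f = trans (+-congˡ (∑-*ˡ n c (f ∘ suc))) (sym (distribˡ c _ _))

  ∑-last : ∀ n f → ∑< (suc n) f ≈ ∑< n f + f n
  ∑-last zero    f = +-comm _ _
  ∑-last (suc n) f = trans (+-congˡ (∑-last n (f ∘ suc))) (sym (+-assoc _ _ _))

  ∑-truncate : ∀ {m n f} → m ≤ n → (∀ i → m ≤ i → f i ≈ 0#) → ∑< n f ≈ ∑< m f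
  ∑-truncate {n = n} z≤n       f≈0 = ∑-zero n (λ i _ → f≈0 i z≤n)
  ∑-truncate         (s≤s m≤n) f≈0 = +-congˡ (∑-truncate m≤n (λ i m≤i → f≈0 (suc i) (s≤s m≤i)))

  *-cancelˡ-unit : ∀ {u v x y} → u * v ≈ 1# → u * x ≈ u * y → x ≈ y
  *-cancelˡ-unit {u} {v} {x} {y} uv≈1 ux≈uy = begin
    x            ≈⟨ lemma x ⟩
    v * (u * x)  ≈⟨ *-congˡ ux≈uy ⟩
    v * (u * y)  ≈⟨ lemma y ⟨
    y            ∎
    where
    lemma : ∀ t → t ≈ v * (u * t)
    lemma t = begin
      t            ≈⟨ *-identityˡ t ⟨
      1# * t       ≈⟨ *-congʳ uv≈1 ⟨
      u * v * t    ≈⟨ solve 3 (λ u v t → u :* v :* t := v :* (u :* t)) refl u v t ⟩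
      v * (u * t)  ∎

nC0≡1 : ∀ n → n C 0 ≡ 1
nC0≡1 n = ≡.trans (nCk≡nC[n∸k] {0} {n} z≤n) (nCn≡1 n)

-- Formal power series in w

module PowerSeries (R : CommutativeRing 0ℓ 0ℓ) where
  open Arithmetic R
  open import Relation.Binary.Reasoning.Setoid setoid

  Series : Set
  Series = ℕ → Carrier

  infix 4 _≋_
  _≋_ : Series → Series → Set
  f ≋ g = ∀ n → f n ≈ g n

  infixl 7 _⊗_
  -- Recursion on the degree, splitting off the constant term of the left factor, replaces the usual
  -- finite sum. The ring laws then follow by induction on the degree, with `f ∘ suc` in place of
  -- `f`.
  _⊗_ : Series → Series → Series
  (f ⊗ g) zero    = f 0 * g 0
  (f ⊗ g) (suc n) = f 0 * g (suc n) + (f ∘ suc ⊗ g) n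

  κ : Carrier → Series
  κ a zero    = a
  κ a (suc n) = 0#

  -- The bounded form serves where an inverse series is known only in low degrees.
  ⊗-cong-≤ : ∀ n {f f′ g g′} → (∀ i → i ≤ n → f i ≈ f′ i) → (∀ i → i ≤ n → g i ≈ g′ i) →
             (f ⊗ g) n ≈ (f′ ⊗ g′) n
  ⊗-cong-≤ zero    f≈f′ g≈g′ = *-cong (f≈f′ 0 z≤n) (g≈g′ 0 z≤n)
  ⊗-cong-≤ (suc n) f≈f′ g≈g′ = +-cong (*-cong (f≈f′ 0 z≤n) (g≈g′ (suc n) ℕ.≤-refl))
    (⊗-cong-≤ n (λ i i≤n → f≈f′ (suc i) (s≤s i≤n)) (λ i i≤n → g≈g′ i (ℕ.m≤n⇒m≤1+n i≤n)))

  ⊗-cong : ∀ {f f′ g g′} → f ≋ f′ → g ≋ g′ → f ⊗ g ≋ f′ ⊗ g′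
  ⊗-cong f≋f′ g≋g′ n = ⊗-cong-≤ n (λ i _ → f≋f′ i) (λ i _ → g≋g′ i)

  ⊗-zeroˡ : ∀ {f} g → (∀ n → f n ≈ 0#) → ∀ n → (f ⊗ g) n ≈ 0#
  ⊗-zeroˡ g f≈0 zero    = trans (*-congʳ (f≈0 0)) (zeroˡ _)
  ⊗-zeroˡ g f≈0 (suc n) =
    trans (+-cong (trans (*-congʳ (f≈0 0)) (zeroˡ _)) (⊗-zeroˡ g (f≈0 ∘ suc) n)) (+-identityˡ 0#)

  ⊗-distribʳ : ∀ h f g n → ((λ i → f i + g i) ⊗ h) n ≈ (f ⊗ h) n + (g ⊗ h) n
  ⊗-distribʳ h f g zero    = distribʳ _ _ _
  ⊗-distribʳ h f g (suc n) = trans (+-congˡ (⊗-distribʳ h (f ∘ suc) (g ∘ suc) n))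
    (solve 5 (λ a b c d e → (a :+ b) :* c :+ (d :+ e) := (a :* c :+ d) :+ (b :* c :+ e)) refl _ _ _ _ _)

  ⊗-scaleˡ : ∀ a f g n → ((λ i → a * f i) ⊗ g) n ≈ a * (f ⊗ g) n
  ⊗-scaleˡ a f g zero    = *-assoc _ _ _
  ⊗-scaleˡ a f g (suc n) = trans (+-congˡ (⊗-scaleˡ a (f ∘ suc) g n))
    (solve 4 (λ a b c d → a :* b :* c :+ a :* d := a :* (b :* c :+ d)) refl _ _ _ _)

  κ⊗ : ∀ a f n → (κ a ⊗ f) n ≈ a * f n
  κ⊗ a f zero    = refl
  κ⊗ a f (suc n) = trans (+-congˡ (⊗-zeroˡ f (λ _ → refl) n)) (+-identityʳ _)

  -- The mirror image of the defining recursion; commutativity compares the two.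
  ⊗-tailʳ : ∀ f g n → (f ⊗ g) (suc n) ≈ (f ⊗ g ∘ suc) n + f (suc n) * g 0
  ⊗-tailʳ f g zero    = refl
  ⊗-tailʳ f g (suc n) = trans (+-congˡ (⊗-tailʳ (f ∘ suc) g n)) (sym (+-assoc _ _ _))

  ⊗-comm : ∀ f g → f ⊗ g ≋ g ⊗ f
  ⊗-comm f g zero    = *-comm _ _
  ⊗-comm f g (suc n) = trans (+-cong (*-comm _ _) (⊗-comm (f ∘ suc) g n))
    (trans (+-comm _ _) (sym (⊗-tailʳ g f n)))

  ⊗-assoc : ∀ f g h → (f ⊗ g) ⊗ h ≋ f ⊗ (g ⊗ h)
  ⊗-assoc f g h zero    = *-assoc _ _ _
  ⊗-assoc f g h (suc n) = begin
    f 0 * g 0 * h (suc n) + ((λ i → f 0 * g (suc i) + (f ∘ suc ⊗ g) i) ⊗ h) n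
      ≈⟨ +-congˡ (⊗-distribʳ h (λ i → f 0 * g (suc i)) (f ∘ suc ⊗ g) n) ⟩
    f 0 * g 0 * h (suc n) + (((λ i → f 0 * g (suc i)) ⊗ h) n + ((f ∘ suc ⊗ g) ⊗ h) n)
      ≈⟨ +-congˡ (+-cong (⊗-scaleˡ (f 0) (g ∘ suc) h n) (⊗-assoc (f ∘ suc) g h n)) ⟩
    f 0 * g 0 * h (suc n) + (f 0 * (g ∘ suc ⊗ h) n + (f ∘ suc ⊗ (g ⊗ h)) n)
      ≈⟨ solve 5 (λ a b c d e → a :* b :* c :+ (a :* d :+ e) := a :* (b :* c :+ d) :+ e) refl _ _ _ _ _ ⟩
    f 0 * (g 0 * h (suc n) + (g ∘ suc ⊗ h) n) + (f ∘ suc ⊗ (g ⊗ h)) n ∎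

  commutativeRing : CommutativeRing 0ℓ 0ℓ
  commutativeRing = record
    { Carrier = Series
    ; _≈_     = _≋_
    ; _+_     = λ f g n → f n + g n
    ; _*_     = _⊗_
    ; -_      = λ f n → - f n
    ; 0#      = λ _ → 0#
    ; 1#      = κ 1#
    ; isCommutativeRing = record
      { isRing = record
        { +-isAbelianGroup = Pointwise.isAbelianGroup ℕ +-isAbelianGroup
        ; *-cong     = ⊗-cong
        ; *-assoc    = ⊗-assoc
        ; *-identity = ⊗-identityˡ , λ f n → trans (⊗-comm f (κ 1#) n) (⊗-identityˡ f n)
        ; distrib    = (λ f g h n → trans (⊗-comm f _ n) (trans (⊗-distribʳ f g h n)
                         (+-cong (⊗-comm g f n) (⊗-comm h f n)))) , ⊗-distribʳ
        }
      ; *-comm = ⊗-comm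
      }
    }
    where
    ⊗-identityˡ : ∀ f → κ 1# ⊗ f ≋ f
    ⊗-identityˡ f n = trans (κ⊗ 1# f n) (*-identityˡ (f n))

  module S = Arithmetic commutativeRing

  ⊗-∑ : ∀ f g n → (f ⊗ g) n ≈ ∑< (suc n) (λ i → f i * g (n ∸ i))
  ⊗-∑ f g zero    = sym (+-identityʳ _)
  ⊗-∑ f g (suc n) = +-congˡ (⊗-∑ (f ∘ suc) g n)

  ⊗-∑-supported : ∀ N f g n → N ≤ suc n → (∀ i → N ≤ i → f i ≈ 0#) →
                  (f ⊗ g) n ≈ ∑< N (λ i → f i * g (n ∸ i))
  ⊗-∑-supported zero    f g n       _         f≈0 = ⊗-zeroˡ g (λ i → f≈0 i z≤n) n
  ⊗-∑-supported (suc N) f g zero    (s≤s z≤n) f≈0 = sym (+-identityʳ _)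
  ⊗-∑-supported (suc N) f g (suc n) (s≤s N≤n) f≈0 =
    +-congˡ (⊗-∑-supported N (f ∘ suc) g n N≤n (λ i → f≈0 (suc i) ∘ s≤s))

  ∑-coefficient : ∀ N (f : ℕ → Series) n → S.∑< N f n ≈ ∑< N (λ i → f i n)
  ∑-coefficient zero    f n = refl
  ∑-coefficient (suc N) f n = +-congˡ (∑-coefficient N (f ∘ suc) n)

  κ-cong : ∀ {a b} → a ≈ b → κ a ≋ κ b
  κ-cong a≈b zero    = a≈b
  κ-cong a≈b (suc n) = refl

  κ-+ : ∀ a b → κ (a + b) ≋ κ a S.+ κ b
  κ-+ a b zero    = refl
  κ-+ a b (suc n) = sym (+-identityˡ 0#)

  κ-* : ∀ a b → κ (a * b) ≋ κ a S.* κ b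
  κ-* a b zero    = refl
  κ-* a b (suc n) = sym (trans (κ⊗ a (κ b) (suc n)) (zeroʳ a))

  κ-neg : ∀ a → κ (- a) ≋ S.- κ a
  κ-neg a zero    = refl
  κ-neg a (suc n) = sym -0#≈0#

  κ-0 : κ 0# ≋ S.0#
  κ-0 zero    = refl
  κ-0 (suc n) = refl

  κ-^ : ∀ a n → κ (a ^ n) ≋ κ a S.^ n
  κ-^ a zero    = S.refl
  κ-^ a (suc n) = S.trans (κ-* a (a ^ n)) (S.*-congˡ {κ a} (κ-^ a n))

  κ-cast : ∀ n → κ (cast n) ≋ S.cast n
  κ-cast zero    = κ-0
  κ-cast (suc n) = S.trans (κ-+ 1# (cast n)) (S.+-congˡ {κ 1#} (κ-cast n))

  -- `w` is the indeterminate, and `y`, with coefficients (-1)^n, is the geometric series of 1 / (1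
  -- + w). Hence `X` is a genuine series, of order 2 in `w`.
  w z y X : Series
  w zero    = 0#
  w (suc n) = κ 1# n
  z = S.1# S.+ w
  y zero    = 1#
  y (suc n) = - y n
  X = w S.* w S.* y

  w⊗-suc : ∀ f n → (w ⊗ f) (suc n) ≈ f n
  w⊗-suc f n = begin
    0# * f (suc n) + (κ 1# ⊗ f) n  ≈⟨ +-cong (zeroˡ _) (κ⊗ 1# f n) ⟩
    0# + 1# * f n                  ≈⟨ solve 1 (λ a → con (+ 0) :+ con (+ 1) :* a := a) refl _ ⟩
    f n                            ∎

  w-cancel : ∀ {f g} → w ⊗ f ≋ w ⊗ g → f ≋ g
  w-cancel {f} {g} wf≋wg n = trans (sym (w⊗-suc f n)) (trans (wf≋wg (suc n)) (w⊗-suc g n))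

  z⊗-suc : ∀ f n → (z ⊗ f) (suc n) ≈ f (suc n) + f n
  z⊗-suc f n = begin
    (z ⊗ f) (suc n)                       ≈⟨ S.distribʳ f S.1# w (suc n) ⟩
    (S.1# ⊗ f) (suc n) + (w ⊗ f) (suc n)  ≈⟨ +-cong (S.*-identityˡ f (suc n)) (w⊗-suc f n) ⟩
    f (suc n) + f n                       ∎

  z⊗y : z ⊗ y ≋ S.1#
  z⊗y zero    = trans (*-identityʳ _) (+-identityʳ 1#)
  z⊗y (suc n) = trans (z⊗-suc y n) (-‿inverseˡ (y n))

  X≋z+y-2 : X S.+ (S.1# S.+ S.1#) ≋ z S.+ y
  X≋z+y-2 = S.trans
    -- From w² - 1 = (1 + w) (w - 1) one gets w² y = (z y) (w - 1) + y, which exposes the factor z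
    -- y.
    (S.solve 2 (λ w y → w S.:* w S.:* y S.:+ S.con (+ 2)
       S.:= ((S.con (+ 1) S.:+ w) S.:* y) S.:* (w S.:- S.con (+ 1)) S.:+ y S.:+ S.con (+ 2)) S.refl w y)
    (S.trans (S.+-congʳ {S.1# S.+ S.1#} (S.+-congʳ {y} (S.*-congʳ {w S.- S.1#} z⊗y)))
      (S.solve 2 (λ w y → S.con (+ 1) S.:* (w S.:- S.con (+ 1)) S.:+ y S.:+ S.con (+ 2)
         S.:= (S.con (+ 1) S.:+ w) S.:+ y) S.refl w y))

  zX≋w² : z ⊗ X ≋ w ⊗ w
  zX≋w² = S.trans (S.solve 3 (λ z w y → z S.:* (w S.:* w S.:* y) S.:= (z S.:* y) S.:* (w S.:* w)) S.refl z w y)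
    (S.trans (S.*-congʳ {w S.* w} z⊗y) (S.*-identityˡ (w S.* w)))

  X-cancel : ∀ {f g} → X ⊗ f ≋ X ⊗ g → f ≋ g
  X-cancel {f} {g} Xf≋Xg = w-cancel (w-cancel (S.trans (S.sym (lemma f)) (S.trans (S.*-congˡ {z} Xf≋Xg) (lemma g))))
    where
    lemma : ∀ h → z ⊗ (X ⊗ h) ≋ w ⊗ (w ⊗ h)
    lemma h = S.trans (S.sym (S.*-assoc z X h)) (S.trans (S.*-congʳ {h} zX≋w²) (S.*-assoc w w h))

  -- X is cancellable with vanishing constant coefficient, so the coefficients can be read off one at a time.
  X-expansion-unique : ∀ N (a b : ℕ → Carrier) → S.∑< N (λ j → κ (a j) S.* X S.^ j) ≋ S.∑< N (λ j → κ (b j) S.* X S.^ j) →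
                       ∀ j → j < N → a j ≈ b j
  X-expansion-unique (suc N) a b a≋b = λ
    { zero    _         → a₀≈b₀
    ; (suc j) (s<s j<N) → X-expansion-unique N (a ∘ suc) (b ∘ suc) tails j j<N
    }
    where
    T : (ℕ → Carrier) → Series
    T c = S.∑< N (λ j → κ (c (suc j)) S.* X S.^ j)
    expand : ∀ c → S.∑< (suc N) (λ j → κ (c j) S.* X S.^ j) ≋ κ (c 0) S.+ X ⊗ T c
    expand c = S.+-cong (S.*-identityʳ (κ (c 0)))
      (S.trans (S.∑-cong N (λ j _ → S.solve 3 (λ c x xj → c S.:* (x S.:* xj) S.:= x S.:* (c S.:* xj))
                                     S.refl (κ (c (suc j))) X (X S.^ j)))
               (S.∑-*ˡ N X (λ j → κ (c (suc j)) S.* X S.^ j)))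
    ab : κ (a 0) S.+ X ⊗ T a ≋ κ (b 0) S.+ X ⊗ T b
    ab = S.trans (S.sym (expand a)) (S.trans a≋b (expand b))
    constant : ∀ c → (κ (c 0) S.+ X ⊗ T c) 0 ≈ c 0
    constant c = trans (+-congˡ (trans (*-congʳ (trans (*-congʳ (zeroˡ _)) (zeroˡ _))) (zeroˡ _))) (+-identityʳ _)
    a₀≈b₀ : a 0 ≈ b 0
    a₀≈b₀ = trans (sym (constant a)) (trans (ab 0) (constant b))
    tails : T a ≋ T b
    tails = X-cancel λ
      { zero    → trans (*-congʳ X₀≈0) (trans (zeroˡ _) (sym (trans (*-congʳ X₀≈0) (zeroˡ _))))
      ; (suc n) → trans (sym (+-identityˡ _)) (trans (ab (suc n)) (+-identityˡ _))
      }
      where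
      X₀≈0 : X 0 ≈ 0#
      X₀≈0 = trans (*-congʳ (zeroˡ _)) (zeroˡ _)

  z^k-coefficient : ∀ k n → (z S.^ k) n ≈ cast (k C n)
  z^k-coefficient zero    zero    = sym (+-identityʳ 1#)
  z^k-coefficient zero    (suc n) = cast-cong (≡.sym (k>n⇒nCk≡0 {0} {suc n} z<s))
  z^k-coefficient (suc k) zero    = begin
    (1# + 0#) * (z S.^ k) 0  ≈⟨ *-cong (+-identityʳ 1#) (z^k-coefficient k 0) ⟩
    1# * cast (k C 0)        ≈⟨ *-identityˡ _ ⟩
    cast (k C 0)             ≈⟨ cast-cong (≡.trans (nC0≡1 k) (≡.sym (nC0≡1 (suc k)))) ⟩
    cast (suc k C 0)         ∎
  z^k-coefficient (suc k) (suc n) = begin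
    (z ⊗ z S.^ k) (suc n)                ≈⟨ z⊗-suc (z S.^ k) n ⟩
    (z S.^ k) (suc n) + (z S.^ k) n      ≈⟨ +-cong (z^k-coefficient k (suc n)) (z^k-coefficient k n) ⟩
    cast (k C suc n) + cast (k C n)      ≈⟨ +-comm _ _ ⟩
    cast (k C n) + cast (k C suc n)      ≈⟨ cast-+ (k C n) (k C suc n) ⟨
    cast (k C n ℕ.+ k C suc n)           ≈⟨ cast-cong (nCk+nC[k+1]≡[n+1]C[k+1] k n) ⟩
    cast (suc k C suc n)                 ∎

  w^k-shift : ∀ k f n → (w S.^ k ⊗ f) (k ℕ.+ n) ≈ f n
  w^k-shift zero    f n = S.*-identityˡ f n
  w^k-shift (suc k) f n = trans (S.*-assoc w (w S.^ k) f (suc (k ℕ.+ n)))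
    (trans (w⊗-suc (w S.^ k ⊗ f) (k ℕ.+ n)) (w^k-shift k f n))

  w^k-low : ∀ k f n → n < k → (w S.^ k ⊗ f) n ≈ 0#
  w^k-low (suc k) f zero    _         = trans (*-congʳ (zeroˡ _)) (zeroˡ _)
  w^k-low (suc k) f (suc n) (s<s n<k) = trans (S.*-assoc w (w S.^ k) f (suc n))
    (trans (w⊗-suc (w S.^ k ⊗ f) n) (w^k-low k f n n<k))

  X^i≋w^2i⊗y^i : ∀ i → X S.^ i ≋ w S.^ (i ℕ.+ i) ⊗ y S.^ i
  X^i≋w^2i⊗y^i i = S.trans (S.^-distrib-* (w S.* w) y i)
    (S.*-congʳ {y S.^ i} (S.trans (S.^-distrib-* w w i) (S.sym (S.^-homo-* w i i))))

  -- Trades a power of `X` for a pure shift of coefficients at the price of a power of `z`; the star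
  -- convolution depends on it.
  X^i⊗z^i≋w^2i : ∀ i → X S.^ i ⊗ z S.^ i ≋ w S.^ (i ℕ.+ i)
  X^i⊗z^i≋w^2i i = S.trans (S.sym (S.^-distrib-* X z i))
    (S.trans (S.^-congˡ i (S.trans (S.*-comm X z) zX≋w²))
      (S.trans (S.^-distrib-* w w i) (S.sym (S.^-homo-* w i i))))

  X^i-low : ∀ i f n → n < i ℕ.+ i → (X S.^ i ⊗ f) n ≈ 0#
  X^i-low i f n n<2i = trans (S.*-congʳ {f} (X^i≋w^2i⊗y^i i) n)
    (trans (S.*-assoc (w S.^ (i ℕ.+ i)) (y S.^ i) f n) (w^k-low (i ℕ.+ i) (y S.^ i ⊗ f) n n<2i))

  -- Pascal's rule for negative exponents, read off from z y^(m+1) = y^m.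
  y^m-pascal : ∀ m n → (y S.^ m) (suc n) ≈ (y S.^ suc m) (suc n) + (y S.^ suc m) n
  y^m-pascal m n = trans (S.sym lemma (suc n)) (z⊗-suc (y S.^ suc m) n)
    where
    lemma : z ⊗ (y ⊗ y S.^ m) ≋ y S.^ m
    lemma = S.trans (S.sym (S.*-assoc z y (y S.^ m)))
      (S.trans (S.*-congʳ {y S.^ m} z⊗y) (S.*-identityˡ (y S.^ m)))

  -- Both relations come from θ y^m = - m w y^(m+1), θ being w times the derivative.
  y^m-θ : ∀ m n → cast (suc n) * (y S.^ m) (suc n) ≈ - (cast m * (y S.^ suc m) n)
  y^m-θ′ : ∀ m n → (cast m + cast n) * (y S.^ m) n ≈ cast m * (y S.^ suc m) n

  y^m-θ zero    n = trans (zeroʳ _) (sym (trans (-‿cong (zeroˡ _)) -0#≈0#))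
  -- The two relations call each other: this one lowers m or passes on the same pair, the other one
  -- lowers n.
  y^m-θ (suc m) n = begin
    N * b                     ≈⟨ solve 3 (λ N b d → N :* b := N :* (b :+ d) :- N :* d) refl N b d ⟩
    N * (b + d) - N * d       ≈⟨ +-congʳ (*-congˡ (y^m-pascal m n)) ⟨
    N * (y S.^ m) (suc n) - N * d
                              ≈⟨ +-congʳ (y^m-θ m n) ⟩
    - (M * d) - (1# + n′) * d ≈⟨ solve 3 (λ M n′ d → :- (M :* d) :- (con (+ 1) :+ n′) :* d
                                                  := :- ((con (+ 1) :+ M :+ n′) :* d)) refl M n′ d ⟩
    - ((1# + M + n′) * d)     ≈⟨ -‿cong (y^m-θ′ (suc m) n) ⟩
    - (cast (suc m) * (y S.^ suc (suc m)) n) ∎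
    where
    N = cast (suc n)
    M = cast m
    n′ = cast n
    b = (y S.^ suc m) (suc n)
    d = (y S.^ suc m) n

  y^m-θ′ m zero    = begin
    (cast m + 0#) * (y S.^ m) 0   ≈⟨ *-cong (+-identityʳ _) (sym (*-identityˡ _)) ⟩
    cast m * (1# * (y S.^ m) 0)   ∎
  y^m-θ′ m (suc n) = begin
    (M + N) * a                   ≈⟨ distribʳ a M N ⟩
    M * a + N * a                 ≈⟨ +-cong (*-congˡ (y^m-pascal m n)) (y^m-θ m n) ⟩
    M * (b + d) - M * d           ≈⟨ solve 3 (λ M b d → M :* (b :+ d) :- M :* d := M :* b) refl M b d ⟩
    M * b                         ∎
    where
    N = cast (suc n)
    M = cast m
    a = (y S.^ m) (suc n)
    b = (y S.^ suc m) (suc n)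
    d = (y S.^ suc m) n

-- Constant lists, intervals and their reversal

replicate-∷ʳ : ∀ {A : Set} n (x : A) → replicate n x ∷ʳ x ≡ x ∷ replicate n x
replicate-∷ʳ zero    x = ≡.refl
replicate-∷ʳ (suc n) x = ≡.cong (x ∷_) (replicate-∷ʳ n x)

reverse-replicate : ∀ {A : Set} n (x : A) → reverse (replicate n x) ≡ replicate n x
reverse-replicate zero    x = ≡.refl
reverse-replicate (suc n) x = ≡.trans (unfold-reverse x (replicate n x))
  (≡.trans (≡.cong (_∷ʳ x) (reverse-replicate n x)) (replicate-∷ʳ n x))

range : ℕ → ℕ → List ℕ
range m zero    = []
range m (suc l) = m ∷ range (suc m) l

map-suc-range : ∀ m l → map suc (range m l) ≡ range (suc m) l
map-suc-range m zero    = ≡.refl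
map-suc-range m (suc l) = ≡.cong (suc m ∷_) (map-suc-range (suc m) l)

range-∷ʳ : ∀ m l → range m (suc l) ≡ range m l ∷ʳ (m ℕ.+ l)
range-∷ʳ m zero    = ≡.cong (_∷ []) (≡.sym (ℕ.+-identityʳ m))
range-∷ʳ m (suc l) = ≡.cong (m ∷_) (≡.trans (range-∷ʳ (suc m) l)
  (≡.cong (range (suc m) l ∷ʳ_) (≡.sym (ℕ.+-suc m l))))

length-range : ∀ m l → length (range m l) ≡ l
length-range m zero    = ≡.refl
length-range m (suc l) = ≡.cong suc (length-range (suc m) l)

∈-range : ∀ m l {k} → k ∈ range m l → m ≤ k × k < m ℕ.+ l
∈-range m (suc l) (here ≡.refl) = ℕ.≤-refl , ℕ.m<m+n m z<s
∈-range m (suc l) {k} (there k∈) with m<k , k<m+l ← ∈-range (suc m) l k∈ =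
  ℕ.<⇒≤ m<k , ≡.subst (k <_) (≡.sym (ℕ.+-suc m l)) k<m+l

reverse-range : ∀ n → reverse (range 1 n) ≡ map (suc n ∸_) (range 1 n)
reverse-range zero    = ≡.refl
reverse-range (suc n) = begin
  reverse (range 1 (suc n))                         ≡⟨ ≡.cong reverse (range-∷ʳ 1 n) ⟩
  reverse (range 1 n ∷ʳ suc n)                      ≡⟨ reverse-++ (range 1 n) (suc n ∷ []) ⟩
  suc n ∷ reverse (range 1 n)                       ≡⟨ ≡.cong (suc n ∷_) (reverse-range n) ⟩
  suc n ∷ map (suc n ∸_) (range 1 n)                ≡⟨ ≡.cong (suc n ∷_) (map-∘ (range 1 n)) ⟩
  suc n ∷ map (suc (suc n) ∸_) (map suc (range 1 n)) ≡⟨ ≡.cong (λ xs → suc n ∷ map (suc (suc n) ∸_) xs) (map-suc-range 1 n) ⟩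
  map (suc (suc n) ∸_) (range 1 (suc n))            ∎
  where open ≡.≡-Reasoning

-- Multiple sums and products over lists of positions

module MultipleSums (R : CommutativeRing 0ℓ 0ℓ) where
  open Arithmetic R
  open import Relation.Binary.Reasoning.Setoid setoid

  -- Sums of f₁ x₁ ⋯ fₗ xₗ over the (weakly, for M≤) increasing positions x₁, …, xₗ of a list.
  M< M≤ : {I : Set} → List (I → Carrier) → List I → Carrier
  M< []       xs       = 1#
  M< (f ∷ fs) []       = 0#
  M< (f ∷ fs) (x ∷ xs) = f x * M< fs xs + M< (f ∷ fs) xs
  M≤ []       xs       = 1#
  M≤ (f ∷ fs) []       = 0#
  M≤ (f ∷ fs) (x ∷ xs) = f x * M≤ fs (x ∷ xs) + M≤ (f ∷ fs) xs

  ∏ : {I : Set} → (I → Carrier) → List I → Carrier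
  ∏ f []       = 1#
  ∏ f (x ∷ xs) = f x * ∏ f xs

  module _ {I : Set} where
    _≗[_]_ : (I → Carrier) → List I → (I → Carrier) → Set
    f ≗[ xs ] g = ∀ x → x ∈ xs → f x ≈ g x

    M<-cong : ∀ {fs gs} xs → Pointwise (_≗[ xs ]_) fs gs → M< fs xs ≈ M< gs xs
    M<-cong xs       []            = refl
    M<-cong []       (f≗g ∷ fs≗gs) = refl
    M<-cong (x ∷ xs) (f≗g ∷ fs≗gs) = +-cong
      (*-cong (f≗g x (here ≡.refl)) (M<-cong xs (PW.map (λ f≗g x → f≗g x ∘ there) fs≗gs)))
      (M<-cong xs (PW.map (λ f≗g x → f≗g x ∘ there) (f≗g ∷ fs≗gs)))

    M≤-cong : ∀ {fs gs} xs → Pointwise (_≗[ xs ]_) fs gs → M≤ fs xs ≈ M≤ gs xs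
    M≤-cong xs       []            = refl
    M≤-cong []       (f≗g ∷ fs≗gs) = refl
    M≤-cong (x ∷ xs) (f≗g ∷ fs≗gs) = +-cong
      (*-cong (f≗g x (here ≡.refl)) (M≤-cong (x ∷ xs) fs≗gs))
      (M≤-cong xs (PW.map (λ f≗g x → f≗g x ∘ there) (f≗g ∷ fs≗gs)))

    M<-∷ʳ-[] : ∀ fs (f : I → Carrier) → M< (fs ∷ʳ f) [] ≈ 0#
    M<-∷ʳ-[] []      f = refl
    M<-∷ʳ-[] (_ ∷ _) f = refl

    M≤-∷ʳ-[] : ∀ fs (f : I → Carrier) → M≤ (fs ∷ʳ f) [] ≈ 0#
    M≤-∷ʳ-[] []      f = refl
    M≤-∷ʳ-[] (_ ∷ _) f = refl

    -- The recursion from the right end, dual to the defining one from the left; invariance under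
    -- reversal compares the two.
    M<-∷ʳ : ∀ fs (f : I → Carrier) xs x →
            M< (fs ∷ʳ f) (xs ∷ʳ x) ≈ M< fs xs * f x + M< (fs ∷ʳ f) xs
    M<-∷ʳ []       f []        x = +-congʳ (*-comm _ _)
    M<-∷ʳ []       f (x′ ∷ xs) x = trans (+-congˡ (M<-∷ʳ [] f xs x))
      (solve 4 (λ o a b c → a :* o :+ (o :* b :+ c) := o :* b :+ (a :* o :+ c)) refl 1# _ _ _)
    M<-∷ʳ (g ∷ gs) f []        x = trans (+-congʳ (*-congˡ (M<-∷ʳ-[] gs f)))
      (+-congʳ (trans (zeroʳ _) (sym (zeroˡ _))))
    M<-∷ʳ (g ∷ gs) f (x′ ∷ xs) x = trans
      (+-cong (*-congˡ (M<-∷ʳ gs f xs x)) (M<-∷ʳ (g ∷ gs) f xs x))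
      (solve 6 (λ a b c d e h → a :* (b :* c :+ d) :+ (e :* c :+ h) := (a :* b :+ e) :* c :+ (a :* d :+ h))
        refl _ _ _ _ _ _)

    M≤-∷ʳ : ∀ fs (f : I → Carrier) xs x →
            M≤ (fs ∷ʳ f) (xs ∷ʳ x) ≈ M≤ fs (xs ∷ʳ x) * f x + M≤ (fs ∷ʳ f) xs
    M≤-∷ʳ []       f []        x = +-congʳ (*-comm _ _)
    M≤-∷ʳ []       f (x′ ∷ xs) x = trans (+-congˡ (M≤-∷ʳ [] f xs x))
      (solve 4 (λ o a b c → a :* o :+ (o :* b :+ c) := o :* b :+ (a :* o :+ c)) refl 1# _ _ _)
    M≤-∷ʳ (g ∷ gs) f []        x = trans
      (+-congʳ (*-congˡ (trans (M≤-∷ʳ gs f [] x) (+-congˡ (M≤-∷ʳ-[] gs f)))))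
      (solve 3 (λ a b c → a :* (b :* c :+ con (+ 0)) :+ con (+ 0) := (a :* b :+ con (+ 0)) :* c :+ con (+ 0)) refl _ _ _)
    M≤-∷ʳ (g ∷ gs) f (x′ ∷ xs) x = trans
      (+-cong (*-congˡ (M≤-∷ʳ gs f (x′ ∷ xs) x)) (M≤-∷ʳ (g ∷ gs) f xs x))
      (solve 6 (λ a b c d e h → a :* (b :* c :+ d) :+ (e :* c :+ h) := (a :* b :+ e) :* c :+ (a :* d :+ h))
        refl _ _ _ _ _ _)

    M<-reverse : ∀ (fs : List (I → Carrier)) xs → M< (reverse fs) (reverse xs) ≈ M< fs xs
    M<-reverse []       xs       = refl
    M<-reverse (f ∷ fs) []       = trans (reflexive (≡.cong (λ gs → M< gs []) (unfold-reverse f fs)))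
      (M<-∷ʳ-[] (reverse fs) f)
    M<-reverse (f ∷ fs) (x ∷ xs) = begin
      M< (reverse (f ∷ fs)) (reverse (x ∷ xs))
        ≡⟨ ≡.cong₂ M< (unfold-reverse f fs) (unfold-reverse x xs) ⟩
      M< (reverse fs ∷ʳ f) (reverse xs ∷ʳ x)
        ≈⟨ M<-∷ʳ (reverse fs) f (reverse xs) x ⟩
      M< (reverse fs) (reverse xs) * f x + M< (reverse fs ∷ʳ f) (reverse xs)
        ≡⟨ ≡.cong (λ gs → M< (reverse fs) (reverse xs) * f x + M< gs (reverse xs)) (unfold-reverse f fs) ⟨
      M< (reverse fs) (reverse xs) * f x + M< (reverse (f ∷ fs)) (reverse xs)
        ≈⟨ +-cong (trans (*-comm _ _) (*-congˡ (M<-reverse fs xs))) (M<-reverse (f ∷ fs) xs) ⟩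
      f x * M< fs xs + M< (f ∷ fs) xs ∎

    M≤-reverse : ∀ (fs : List (I → Carrier)) xs → M≤ (reverse fs) (reverse xs) ≈ M≤ fs xs
    M≤-reverse []       xs       = refl
    M≤-reverse (f ∷ fs) []       = trans (reflexive (≡.cong (λ gs → M≤ gs []) (unfold-reverse f fs)))
      (M≤-∷ʳ-[] (reverse fs) f)
    M≤-reverse (f ∷ fs) (x ∷ xs) = begin
      M≤ (reverse (f ∷ fs)) (reverse (x ∷ xs))
        ≡⟨ ≡.cong₂ M≤ (unfold-reverse f fs) (unfold-reverse x xs) ⟩
      M≤ (reverse fs ∷ʳ f) (reverse xs ∷ʳ x)
        ≈⟨ M≤-∷ʳ (reverse fs) f (reverse xs) x ⟩
      M≤ (reverse fs) (reverse xs ∷ʳ x) * f x + M≤ (reverse fs ∷ʳ f) (reverse xs)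
        ≡⟨ ≡.cong₂ (λ ys gs → M≤ (reverse fs) ys * f x + M≤ gs (reverse xs))
             (unfold-reverse x xs) (unfold-reverse f fs) ⟨
      M≤ (reverse fs) (reverse (x ∷ xs)) * f x + M≤ (reverse (f ∷ fs)) (reverse xs)
        ≈⟨ +-cong (trans (*-comm _ _) (*-congˡ (M≤-reverse fs (x ∷ xs)))) (M≤-reverse (f ∷ fs) xs) ⟩
      f x * M≤ fs (x ∷ xs) + M≤ (f ∷ fs) xs ∎

    -- Multilinearity in one slot; it merges the two symmetric sums once one of them has been
    -- reflected.
    M<-additive : ∀ fs (g h : I → Carrier) gs xs →
      M< (fs ++ g ∷ gs) xs + M< (fs ++ h ∷ gs) xs ≈ M< (fs ++ (λ x → g x + h x) ∷ gs) xs
    M<-additive []       g h gs []       = +-identityʳ 0#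
    M<-additive []       g h gs (x ∷ xs) = trans
      (solve 5 (λ a b c d e → (a :* b :+ c) :+ (d :* b :+ e) := (a :+ d) :* b :+ (c :+ e)) refl _ _ _ _ _)
      (+-congˡ (M<-additive [] g h gs xs))
    M<-additive (f ∷ fs) g h gs []       = +-identityʳ 0#
    M<-additive (f ∷ fs) g h gs (x ∷ xs) = trans
      (solve 5 (λ a b c d e → (a :* b :+ c) :+ (a :* d :+ e) := a :* (b :+ d) :+ (c :+ e)) refl _ _ _ _ _)
      (+-cong (*-congˡ (M<-additive fs g h gs xs)) (M<-additive (f ∷ fs) g h gs xs))

    M≤-additive : ∀ fs (g h : I → Carrier) gs xs →
      M≤ (fs ++ g ∷ gs) xs + M≤ (fs ++ h ∷ gs) xs ≈ M≤ (fs ++ (λ x → g x + h x) ∷ gs) xs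
    M≤-additive []       g h gs []       = +-identityʳ 0#
    M≤-additive []       g h gs (x ∷ xs) = trans
      (solve 5 (λ a b c d e → (a :* b :+ c) :+ (d :* b :+ e) := (a :+ d) :* b :+ (c :+ e)) refl _ _ _ _ _)
      (+-congˡ (M≤-additive [] g h gs xs))
    M≤-additive (f ∷ fs) g h gs []       = +-identityʳ 0#
    M≤-additive (f ∷ fs) g h gs (x ∷ xs) = trans
      (solve 5 (λ a b c d e → (a :* b :+ c) :+ (a :* d :+ e) := a :* (b :+ d) :+ (c :+ e)) refl _ _ _ _ _)
      (+-cong (*-congˡ (M≤-additive fs g h gs (x ∷ xs))) (M≤-additive (f ∷ fs) g h gs xs))

    M<-scale : ∀ fs c (g : I → Carrier) gs xs →
      M< (fs ++ (λ x → c * g x) ∷ gs) xs ≈ c * M< (fs ++ g ∷ gs) xs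
    M<-scale []       c g gs []       = sym (zeroʳ c)
    M<-scale []       c g gs (x ∷ xs) = trans (+-congˡ (M<-scale [] c g gs xs))
      (solve 4 (λ a b d e → a :* b :* d :+ a :* e := a :* (b :* d :+ e)) refl _ _ _ _)
    M<-scale (f ∷ fs) c g gs []       = sym (zeroʳ c)
    M<-scale (f ∷ fs) c g gs (x ∷ xs) = trans
      (+-cong (*-congˡ (M<-scale fs c g gs xs)) (M<-scale (f ∷ fs) c g gs xs))
      (solve 4 (λ a b d e → b :* (a :* d) :+ a :* e := a :* (b :* d :+ e)) refl _ _ _ _)

    M≤-scale : ∀ fs c (g : I → Carrier) gs xs →
      M≤ (fs ++ (λ x → c * g x) ∷ gs) xs ≈ c * M≤ (fs ++ g ∷ gs) xs
    M≤-scale []       c g gs []       = sym (zeroʳ c)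
    M≤-scale []       c g gs (x ∷ xs) = trans (+-congˡ (M≤-scale [] c g gs xs))
      (solve 4 (λ a b d e → a :* b :* d :+ a :* e := a :* (b :* d :+ e)) refl _ _ _ _)
    M≤-scale (f ∷ fs) c g gs []       = sym (zeroʳ c)
    M≤-scale (f ∷ fs) c g gs (x ∷ xs) = trans
      (+-cong (*-congˡ (M≤-scale fs c g gs (x ∷ xs))) (M≤-scale (f ∷ fs) c g gs xs))
      (solve 4 (λ a b d e → b :* (a :* d) :+ a :* e := a :* (b :* d :+ e)) refl _ _ _ _)

    M<-homogeneous : ∀ n c (f : I → Carrier) xs →
      M< (replicate n (λ x → c * f x)) xs ≈ c ^ n * M< (replicate n f) xs
    M<-homogeneous zero    c f xs       = sym (*-identityʳ 1#)
    M<-homogeneous (suc n) c f []       = sym (zeroʳ _)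
    M<-homogeneous (suc n) c f (x ∷ xs) = trans
      (+-cong (*-congˡ (M<-homogeneous n c f xs)) (M<-homogeneous (suc n) c f xs))
      (solve 5 (λ c f cn a b → c :* f :* (cn :* a) :+ c :* cn :* b := c :* cn :* (f :* a :+ b)) refl _ _ _ _ _)

    M≤-homogeneous : ∀ n c (f : I → Carrier) xs →
      M≤ (replicate n (λ x → c * f x)) xs ≈ c ^ n * M≤ (replicate n f) xs
    M≤-homogeneous zero    c f xs       = sym (*-identityʳ 1#)
    M≤-homogeneous (suc n) c f []       = sym (zeroʳ _)
    M≤-homogeneous (suc n) c f (x ∷ xs) = trans
      (+-cong (*-congˡ (M≤-homogeneous n c f (x ∷ xs))) (M≤-homogeneous (suc n) c f xs))
      (solve 5 (λ c f cn a b → c :* f :* (cn :* a) :+ c :* cn :* b := c :* cn :* (f :* a :+ b)) refl _ _ _ _ _)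

    -- Any bound `N` beyond the length will do, because a strict sum with more factors than
    -- positions is zero. The induction expands the tail with both `suc N` and `N`.
    ∏-expansion : ∀ N (g : I → Carrier) t xs → length xs < N →
      ∏ (λ x → 1# + g x * t) xs ≈ ∑< N (λ j → M< (replicate j g) xs * t ^ j)
    ∏-expansion (suc N) g t []       _         = sym (trans
      (+-cong (*-identityʳ 1#) (∑-zero N (λ j _ → zeroˡ (t ^ suc j)))) (+-identityʳ 1#))
    ∏-expansion (suc N) g t (x ∷ xs) (s<s l<N) = begin
      (1# + g x * t) * P
        ≈⟨ solve 3 (λ a t P → (con (+ 1) :+ a :* t) :* P := P :+ a :* t :* P) refl (g x) t P ⟩
      P + g x * t * P
        ≈⟨ +-cong (∏-expansion (suc N) g t xs (ℕ.m<n⇒m<1+n l<N)) (*-congˡ (∏-expansion N g t xs l<N)) ⟩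
      (1# * 1# + ∑< N (λ j → m (suc j) * t ^ suc j)) + g x * t * ∑< N (λ j → m j * t ^ j)
        ≈⟨ trans (+-congˡ (sym (∑-*ˡ N (g x * t) (λ j → m j * t ^ j)))) (+-assoc _ _ _) ⟩
      1# * 1# + (∑< N (λ j → m (suc j) * t ^ suc j) + ∑< N (λ j → g x * t * (m j * t ^ j)))
        ≈⟨ +-congˡ (∑-+ N (λ j → m (suc j) * t ^ suc j) (λ j → g x * t * (m j * t ^ j))) ⟨
      1# * 1# + ∑< N (λ j → m (suc j) * t ^ suc j + g x * t * (m j * t ^ j))
        ≈⟨ +-congˡ (∑-cong N (λ j _ → solve 5
             (λ a b c t tj → b :* (t :* tj) :+ a :* t :* (c :* tj) := (a :* c :+ b) :* (t :* tj))
             refl (g x) (m (suc j)) (m j) t (t ^ j))) ⟩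
      1# * 1# + ∑< N (λ j → (g x * m j + m (suc j)) * t ^ suc j) ∎
      where
      P = ∏ (λ x → 1# + g x * t) xs
      m : ℕ → Carrier
      m j = M< (replicate j g) xs

    -- All factors being equal, taking one off the back or off the front leaves the same list, so
    -- splitting off the last position gives the recursion for the first.
    M<-rotate : ∀ n (f : I → Carrier) x xs → M< (replicate n f) (xs ∷ʳ x) ≈ M< (replicate n f) (x ∷ xs)
    M<-rotate zero    f x xs = refl
    M<-rotate (suc n) f x xs = begin
      M< (replicate (suc n) f) (xs ∷ʳ x)
        ≡⟨ ≡.cong (λ fs → M< fs (xs ∷ʳ x)) (replicate-∷ʳ n f) ⟨
      M< (replicate n f ∷ʳ f) (xs ∷ʳ x)
        ≈⟨ M<-∷ʳ (replicate n f) f xs x ⟩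
      M< (replicate n f) xs * f x + M< (replicate n f ∷ʳ f) xs
        ≈⟨ +-cong (*-comm _ _) (reflexive (≡.cong (λ fs → M< fs xs) (replicate-∷ʳ n f))) ⟩
      f x * M< (replicate n f) xs + M< (replicate (suc n) f) xs ∎

    ∏-cong : ∀ {f g} xs → f ≗[ xs ] g → ∏ f xs ≈ ∏ g xs
    ∏-cong []       f≗g = refl
    ∏-cong (x ∷ xs) f≗g = *-cong (f≗g x (here ≡.refl)) (∏-cong xs (λ x → f≗g x ∘ there))

    ∏-const : ∀ c (xs : List I) → ∏ (λ _ → c) xs ≈ c ^ length xs
    ∏-const c []       = refl
    ∏-const c (x ∷ xs) = *-congˡ (∏-const c xs)

    ∏-* : ∀ (f g : I → Carrier) xs → ∏ (λ x → f x * g x) xs ≈ ∏ f xs * ∏ g xs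
    ∏-* f g []       = sym (*-identityʳ 1#)
    ∏-* f g (x ∷ xs) = trans (*-congˡ (∏-* f g xs))
      (solve 4 (λ a b c d → a :* b :* (c :* d) := a :* c :* (b :* d)) refl _ _ _ _)

    ∏-∷ʳ : ∀ (f : I → Carrier) xs x → ∏ f (xs ∷ʳ x) ≈ f x * ∏ f xs
    ∏-∷ʳ f []        x = refl
    ∏-∷ʳ f (x′ ∷ xs) x = trans (*-congˡ (∏-∷ʳ f xs x))
      (solve 3 (λ a b c → a :* (b :* c) := b :* (a :* c)) refl _ _ _)

    ∏-reverse : ∀ (f : I → Carrier) xs → ∏ f (reverse xs) ≈ ∏ f xs
    ∏-reverse f []       = refl
    ∏-reverse f (x ∷ xs) = trans (reflexive (≡.cong (∏ f) (unfold-reverse x xs)))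
      (trans (∏-∷ʳ f (reverse xs) x) (*-congˡ (∏-reverse f xs)))

  module _ {I J : Set} (φ : J → I) where
    M<-map : ∀ fs xs → M< fs (map φ xs) ≈ M< (map (_∘ φ) fs) xs
    M<-map []       xs       = refl
    M<-map (f ∷ fs) []       = refl
    M<-map (f ∷ fs) (x ∷ xs) = +-cong (*-congˡ (M<-map fs xs)) (M<-map (f ∷ fs) xs)

    M≤-map : ∀ fs xs → M≤ fs (map φ xs) ≈ M≤ (map (_∘ φ) fs) xs
    M≤-map []       xs       = refl
    M≤-map (f ∷ fs) []       = refl
    M≤-map (f ∷ fs) (x ∷ xs) = +-cong (*-congˡ (M≤-map fs (x ∷ xs))) (M≤-map (f ∷ fs) xs)

    ∏-map : ∀ f xs → ∏ f (map φ xs) ≈ ∏ (f ∘ φ) xs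
    ∏-map f []       = refl
    ∏-map f (x ∷ xs) = *-congˡ (∏-map f xs)

-- The product of 1 - ζ^k t over all p-th roots of unity

module RootsOfUnity (R : CommutativeRing 0ℓ 0ℓ) where
  open Arithmetic R
  open MultipleSums R
  open import Relation.Binary.Reasoning.Setoid setoid

  module _ (p′ : ℕ) (ζ : Carrier) (v : ℕ → Carrier)
    (ζ^p≈1 : ζ ^ suc p′ ≈ 1#)
    (v-inverse : ∀ j → 0 < j → j < suc p′ → (1# - ζ ^ j) * v j ≈ 1#)
    where

    private
      p = suc p′
      g : ℕ → Carrier
      g k = - ζ ^ k
      e : ℕ → Carrier
      e j = M< (replicate j g) (range 0 p)

      -- Multiplication by ζ permutes the roots 1, ζ, …, ζ^(p-1) cyclically.
      e-rotate : ∀ j → ζ ^ j * e j ≈ e j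
      e-rotate j = begin
        ζ ^ j * e j
          ≈⟨ M<-homogeneous j ζ g (range 0 p) ⟨
        M< (replicate j (λ k → ζ * g k)) (range 0 p)
          ≈⟨ M<-cong (range 0 p) (replicate⁺ (λ k _ → sym (-‿distribʳ-* ζ (ζ ^ k))) j) ⟩
        M< (replicate j (g ∘ suc)) (range 0 p)
          ≡⟨ ≡.cong (λ fs → M< fs (range 0 p)) (map-replicate (_∘ suc) j g) ⟨
        M< (map (_∘ suc) (replicate j g)) (range 0 p)
          ≈⟨ M<-map suc (replicate j g) (range 0 p) ⟨
        M< (replicate j g) (map suc (range 0 p))
          ≡⟨ ≡.cong (M< (replicate j g)) (≡.trans (map-suc-range 0 p) (range-∷ʳ 1 p′)) ⟩
        M< (replicate j g) (range 1 p′ ∷ʳ p)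
          ≈⟨ M<-rotate j g p (range 1 p′) ⟩
        M< (replicate j g) (p ∷ range 1 p′)
          ≈⟨ first j ⟩
        e j ∎
        where
        -- Position p may stand for position 0 because ζ^p = 1 = ζ^0; this closes the cycle.
        first : ∀ j → M< (replicate j g) (p ∷ range 1 p′) ≈ e j
        first zero    = refl
        first (suc j) = +-congʳ (*-congʳ (-‿cong ζ^p≈1))

      -- Homogeneity and cyclic symmetry give (1 - ζ^j) e j = 0, and 1 - ζ^j is a unit.
      e-middle : ∀ j → 0 < j → j < p → e j ≈ 0#
      e-middle j 0<j j<p = *-cancelˡ-unit (v-inverse j 0<j j<p) (begin
        (1# - ζ ^ j) * e j  ≈⟨ solve 2 (λ a b → (con (+ 1) :- a) :* b := b :- a :* b) refl (ζ ^ j) (e j) ⟩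
        e j - ζ ^ j * e j   ≈⟨ x≈y⇒x∙y⁻¹≈ε (sym (e-rotate j)) ⟩
        0#                  ≈⟨ zeroʳ _ ⟨
        (1# - ζ ^ j) * 0#   ∎)

      expansion : ∀ t → ∏ (λ k → 1# + g k * t) (range 0 p) ≈ 1# + e p * t ^ p
      expansion t = begin
        ∏ (λ k → 1# + g k * t) (range 0 p)
          ≈⟨ ∏-expansion (suc p) g t (range 0 p) (ℕ.≤-reflexive (≡.cong suc (length-range 0 p))) ⟩
        ∑< (suc p) (λ j → e j * t ^ j)
          ≈⟨ ∑-last p (λ j → e j * t ^ j) ⟩
        1# * 1# + ∑< p′ (λ j → e (suc j) * t ^ suc j) + e p * t ^ p
          ≈⟨ +-congʳ (+-cong (*-identityʳ 1#)
               (∑-zero p′ (λ j j<p′ → trans (*-congʳ (e-middle (suc j) z<s (s<s j<p′))) (zeroˡ (t ^ suc j))))) ⟩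
        1# + 0# + e p * t ^ p
          ≈⟨ +-congʳ (+-identityʳ 1#) ⟩
        1# + e p * t ^ p ∎

    ∏[1-ζ^k*t] : ∀ t → ∏ (λ k → 1# - ζ ^ k * t) (range 0 p) ≈ 1# - t ^ p
    ∏[1-ζ^k*t] t = begin
      ∏ (λ k → 1# - ζ ^ k * t) (range 0 p)   ≈⟨ ∏-cong (range 0 p) (λ k _ → +-congˡ (-‿distribˡ-* (ζ ^ k) t)) ⟩
      ∏ (λ k → 1# + g k * t) (range 0 p)     ≈⟨ expansion t ⟩
      1# + e p * t ^ p                       ≈⟨ +-congˡ (*-congʳ eₚ≈-1) ⟩
      1# + - 1# * t ^ p                      ≈⟨ solve 1 (λ a → con (+ 1) :+ :- con (+ 1) :* a := con (+ 1) :- a) refl (t ^ p) ⟩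
      1# - t ^ p                             ∎
      where
      -- At t = 1 the factor with exponent 0 vanishes, so 1 + e p = 0.
      eₚ≈-1 : e p ≈ - 1#
      eₚ≈-1 = begin
        e p                       ≈⟨ solve 1 (λ a → a := :- con (+ 1) :+ (con (+ 1) :+ a :* con (+ 1))) refl (e p) ⟩
        - 1# + (1# + e p * 1#)    ≈⟨ +-congˡ (+-congˡ (*-congˡ (1^n≈1 p))) ⟨
        - 1# + (1# + e p * 1# ^ p) ≈⟨ +-congˡ (expansion 1#) ⟨
        - 1# + (1# + - 1# * 1#) * ∏ (λ k → 1# + g k * 1#) (range 1 p′)
                                  ≈⟨ solve 1 (λ a → :- con (+ 1) :+ (con (+ 1) :+ :- con (+ 1) :* con (+ 1)) :* a
                                                := :- con (+ 1)) refl _ ⟩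
        - 1#                      ∎

-- Binomial coefficients of the expansion in X

C-absorption : ∀ n k → suc k ℕ.* (suc n C suc k) ≡ suc n ℕ.* (n C k)
C-absorption zero    zero    = ≡.refl
C-absorption zero    (suc k) = ≡.trans (≡.cong (suc (suc k) ℕ.*_) (k>n⇒nCk≡0 {1} {suc (suc k)} (s<s z<s)))
  (≡.trans (ℕ.*-zeroʳ k) (≡.sym (≡.cong (1 ℕ.*_) (k>n⇒nCk≡0 {0} {suc k} z<s))))
C-absorption (suc n) zero    = begin
  1 ℕ.* (suc (suc n) C 1)          ≡⟨ ≡.cong (1 ℕ.*_) (nCk+nC[k+1]≡[n+1]C[k+1] (suc n) 0) ⟨
  1 ℕ.* (suc n C 0 ℕ.+ suc n C 1)  ≡⟨ ℕ.*-distribˡ-+ 1 (suc n C 0) (suc n C 1) ⟩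
  1 ℕ.* (suc n C 0) ℕ.+ 1 ℕ.* (suc n C 1)
    ≡⟨ ≡.cong₂ ℕ._+_ (≡.trans (ℕ.*-identityˡ _) (nC0≡1 (suc n))) (C-absorption n 0) ⟩
  1 ℕ.+ suc n ℕ.* (n C 0)          ≡⟨ ≡.cong (λ c → 1 ℕ.+ suc n ℕ.* c) (nC0≡1 n) ⟩
  1 ℕ.+ suc n ℕ.* 1                ≡⟨⟩
  suc (suc n) ℕ.* 1                ≡⟨ ≡.cong (suc (suc n) ℕ.*_) (nC0≡1 (suc n)) ⟨
  suc (suc n) ℕ.* (suc n C 0)      ∎
  where open ≡.≡-Reasoning
C-absorption (suc n) (suc k) = begin
  suc (suc k) ℕ.* (suc (suc n) C suc (suc k))
    ≡⟨ ≡.cong (suc (suc k) ℕ.*_) (nCk+nC[k+1]≡[n+1]C[k+1] (suc n) (suc k)) ⟨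
  suc (suc k) ℕ.* (a ℕ.+ suc n C suc (suc k))
    ≡⟨ ≡.trans (ℕ.*-distribˡ-+ (suc (suc k)) a _) (ℕ.+-assoc a (suc k ℕ.* a) _) ⟩
  a ℕ.+ (suc k ℕ.* a ℕ.+ suc (suc k) ℕ.* (suc n C suc (suc k)))
    ≡⟨ ≡.cong (a ℕ.+_) (≡.cong₂ ℕ._+_ (C-absorption n k) (C-absorption n (suc k))) ⟩
  a ℕ.+ (suc n ℕ.* (n C k) ℕ.+ suc n ℕ.* (n C suc k))
    ≡⟨ ≡.cong (a ℕ.+_) (ℕ.*-distribˡ-+ (suc n) (n C k) (n C suc k)) ⟨
  a ℕ.+ suc n ℕ.* (n C k ℕ.+ n C suc k)
    ≡⟨ ≡.cong (λ c → a ℕ.+ suc n ℕ.* c) (nCk+nC[k+1]≡[n+1]C[k+1] n k) ⟩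
  suc (suc n) ℕ.* a ∎
  where
  open ≡.≡-Reasoning
  a = suc n C suc k

-- The coefficient of X^(j+1) in z^(n+1) + z^-(n+1), where X = z - 2 + 1/z.
cosine-coefficient : ℕ → ℕ → ℕ
cosine-coefficient n j = (suc n ℕ.+ suc j) C (suc j ℕ.+ suc j) ℕ.+ (n ℕ.+ suc j) C (suc j ℕ.+ suc j)

-- With M = n + 1 + j, A = C(M, 2j + 1) and B = C(M, 2j + 2) the cosine coefficient is A + 2B.
-- Adding (j + 1) A to the left side makes it (2j + 2) (A + B), and absorption turns this into (M +
-- 1) A = (j + 1) A + (n + 1) A.
cosine-coefficient-absorption : ∀ n j →
  suc j ℕ.* cosine-coefficient n j ≡ suc n ℕ.* ((suc n ℕ.+ j) C suc (j ℕ.+ j))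
cosine-coefficient-absorption n j = ℕ.+-cancelˡ-≡ (suc j ℕ.* A) _ _ (begin
  suc j ℕ.* A ℕ.+ suc j ℕ.* cosine-coefficient n j
    ≡⟨ ≡.cong (λ c → suc j ℕ.* A ℕ.+ suc j ℕ.* c) (≡.cong₂ ℕ._+_ upper lower) ⟩
  suc j ℕ.* A ℕ.+ suc j ℕ.* ((A ℕ.+ B) ℕ.+ B)
    ≡⟨ twice j A B ⟩
  suc (suc (j ℕ.+ j)) ℕ.* (A ℕ.+ B)
    ≡⟨ ≡.cong (suc (suc (j ℕ.+ j)) ℕ.*_) (nCk+nC[k+1]≡[n+1]C[k+1] M (suc (j ℕ.+ j))) ⟩
  suc (suc (j ℕ.+ j)) ℕ.* (suc M C suc (suc (j ℕ.+ j)))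
    ≡⟨ C-absorption M (suc (j ℕ.+ j)) ⟩
  suc M ℕ.* A
    ≡⟨ split n j A ⟩
  suc j ℕ.* A ℕ.+ suc n ℕ.* A ∎)
  where
  open ≡.≡-Reasoning
  M = suc n ℕ.+ j
  A = M C suc (j ℕ.+ j)
  B = M C suc (suc (j ℕ.+ j))
  upper : (suc n ℕ.+ suc j) C (suc j ℕ.+ suc j) ≡ A ℕ.+ B
  upper = ≡.trans (≡.cong₂ _C_ (ℕ.+-suc (suc n) j) (≡.cong suc (ℕ.+-suc j j)))
    (≡.sym (nCk+nC[k+1]≡[n+1]C[k+1] M (suc (j ℕ.+ j))))
  lower : (n ℕ.+ suc j) C (suc j ℕ.+ suc j) ≡ B
  lower = ≡.cong₂ _C_ (ℕ.+-suc n j) (≡.cong suc (ℕ.+-suc j j))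
  twice : ∀ j a b → suc j ℕ.* a ℕ.+ suc j ℕ.* ((a ℕ.+ b) ℕ.+ b) ≡ suc (suc (j ℕ.+ j)) ℕ.* (a ℕ.+ b)
  twice = ℕ.solve-∀
  split : ∀ n j a → suc (suc n ℕ.+ j) ℕ.* a ≡ suc j ℕ.* a ℕ.+ suc n ℕ.* a
  split = ℕ.solve-∀

-- Polynomials of Chebyshev type in X = z - 2 + 1/z

module BinomialSums (R : CommutativeRing 0ℓ 0ℓ) where
  open Arithmetic R
  open import Relation.Binary.Reasoning.Setoid setoid

  module _ (z y X : Carrier) (zy≈1 : z * y ≈ 1#) (X+2≈z+y : X + (1# + 1#) ≈ z + y) where
    -- The Morgan-Voyce polynomials: `U` at n stands for (z^n - y^n) / (z - y), and `B` is the
    -- difference of two consecutive `U`. `N` is only the number of terms written down, and stops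
    -- mattering once it exceeds the degree.
    U B : ℕ → ℕ → Carrier
    U N n = ∑< N (λ j → cast ((n ℕ.+ j) C suc (j ℕ.+ j)) * X ^ j)
    B N n = ∑< N (λ j → cast ((n ℕ.+ j) C (j ℕ.+ j)) * X ^ j)

    private
      X≈ : X ≈ z + y - (1# + 1#)
      X≈ = trans (solve 1 (λ x → x := x :+ con (+ 2) :- con (+ 2)) refl X) (+-congʳ X+2≈z+y)

      sum-+ : ∀ N (f g h : ℕ → ℕ) → (∀ j → f j ≡ g j ℕ.+ h j) →
              ∑< N (λ j → cast (f j) * X ^ j) ≈ ∑< N (λ j → cast (g j) * X ^ j) + ∑< N (λ j → cast (h j) * X ^ j)
      sum-+ N f g h f≡g+h = trans
        (∑-cong N (λ j _ → trans (*-congʳ (trans (cast-cong (f≡g+h j)) (cast-+ (g j) (h j)))) (distribʳ (X ^ j) _ _)))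
        (∑-+ N (λ j → cast (g j) * X ^ j) (λ j → cast (h j) * X ^ j))

      sum-shift : ∀ N (f : ℕ → ℕ) →
                  ∑< (suc N) (λ j → cast (f j) * X ^ j) ≈ cast (f 0) + X * ∑< N (λ j → cast (f (suc j)) * X ^ j)
      sum-shift N f = +-cong (*-identityʳ _) (trans
        (∑-cong N (λ j _ → solve 3 (λ c x xj → c :* (x :* xj) := x :* (c :* xj)) refl (cast (f (suc j))) X (X ^ j)))
        (∑-*ˡ N X (λ j → cast (f (suc j)) * X ^ j)))

    -- Needed because `B-suc`, by taking out a factor X, yields `U` with one term fewer.
    U-last : ∀ N n → n ≤ N → U (suc N) n ≈ U N n
    U-last N n n≤N = begin
      U (suc N) n                                          ≈⟨ ∑-last N (λ j → cast ((n ℕ.+ j) C suc (j ℕ.+ j)) * X ^ j) ⟩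
      U N n + cast ((n ℕ.+ N) C suc (N ℕ.+ N)) * X ^ N
        ≈⟨ +-congˡ (*-congʳ (cast-cong (k>n⇒nCk≡0 {n ℕ.+ N} {suc (N ℕ.+ N)} (s≤s (ℕ.+-monoˡ-≤ N n≤N))))) ⟩
      U N n + 0# * X ^ N                                   ≈⟨ solve 2 (λ a b → a :+ con (+ 0) :* b := a) refl _ _ ⟩
      U N n                                                ∎

    U-suc : ∀ N n → U N (suc n) ≈ B N n + U N n
    U-suc N n = sum-+ N _ (λ j → (n ℕ.+ j) C (j ℕ.+ j)) (λ j → (n ℕ.+ j) C suc (j ℕ.+ j))
      (λ j → ≡.sym (nCk+nC[k+1]≡[n+1]C[k+1] (n ℕ.+ j) (j ℕ.+ j)))

    B-suc : ∀ N n → B (suc N) (suc n) ≈ B (suc N) n + X * U N (suc n)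
    B-suc N n = begin
      B (suc N) (suc n)
        ≈⟨ sum-shift N (λ j → (suc n ℕ.+ j) C (j ℕ.+ j)) ⟩
      cast ((suc n ℕ.+ 0) C 0) + X * ∑< N (λ j → cast ((suc n ℕ.+ suc j) C (suc j ℕ.+ suc j)) * X ^ j)
        ≈⟨ +-cong (cast-cong (≡.trans (nC0≡1 (suc n ℕ.+ 0)) (≡.sym (nC0≡1 (n ℕ.+ 0)))))
             (*-congˡ (sum-+ N _ (λ j → (n ℕ.+ suc j) C (suc j ℕ.+ suc j)) (λ j → (suc n ℕ.+ j) C suc (j ℕ.+ j)) pascal)) ⟩
      cast ((n ℕ.+ 0) C 0) + X * (∑< N (λ j → cast ((n ℕ.+ suc j) C (suc j ℕ.+ suc j)) * X ^ j) + U N (suc n))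
        ≈⟨ trans (+-congˡ (distribˡ X _ _)) (sym (+-assoc _ _ _)) ⟩
      cast ((n ℕ.+ 0) C 0) + X * ∑< N (λ j → cast ((n ℕ.+ suc j) C (suc j ℕ.+ suc j)) * X ^ j) + X * U N (suc n)
        ≈⟨ +-congʳ (sum-shift N (λ j → (n ℕ.+ j) C (j ℕ.+ j))) ⟨
      B (suc N) n + X * U N (suc n) ∎
      where
      pascal : ∀ j → (suc n ℕ.+ suc j) C (suc j ℕ.+ suc j)
                   ≡ (n ℕ.+ suc j) C (suc j ℕ.+ suc j) ℕ.+ (suc n ℕ.+ j) C suc (j ℕ.+ j)
      pascal j = ≡.trans (≡.sym (nCk+nC[k+1]≡[n+1]C[k+1] (n ℕ.+ suc j) (j ℕ.+ suc j)))
        (≡.trans (ℕ.+-comm _ ((n ℕ.+ suc j) C (suc j ℕ.+ suc j)))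
          (≡.cong ((n ℕ.+ suc j) C (suc j ℕ.+ suc j) ℕ.+_) (≡.cong₂ _C_ (ℕ.+-suc n j) (ℕ.+-suc j j))))

    U-0 : ∀ N → U N 0 ≈ 0#
    U-0 N = ∑-zero N (λ j _ → trans (*-congʳ (cast-cong (k>n⇒nCk≡0 {j} (s≤s (ℕ.m≤m+n j j))))) (zeroˡ (X ^ j)))

    -- `U-suc` and `B-suc` form a linear recurrence with eigenvalues z and y. The combination B - (z
    -- - 1) U is multiplied by y in each step and starts at 1.
    B≈ : ∀ N n → n ≤ N → B (suc N) n ≈ (z - 1#) * U (suc N) n + y ^ n
    B≈ N zero    _   = begin
      B (suc N) 0                   ≈⟨ +-cong (trans (*-identityʳ _) (+-identityʳ 1#))
                                         (∑-zero N (λ j _ → trans (*-congʳ (cast-cong (k>n⇒nCk≡0 {suc j}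
                                           (s≤s (ℕ.m≤n+m (suc j) j))))) (zeroˡ (X ^ suc j)))) ⟩
      1# + 0#                       ≈⟨ solve 1 (λ z → con (+ 1) :+ con (+ 0)
                                         := (z :- con (+ 1)) :* con (+ 0) :+ con (+ 1)) refl z ⟩
      (z - 1#) * 0# + 1#            ≈⟨ +-congʳ (*-congˡ (U-0 (suc N))) ⟨
      (z - 1#) * U (suc N) 0 + 1#   ∎
    B≈ N (suc n) n<N = begin
      B (suc N) (suc n)
        ≈⟨ B-suc N n ⟩
      B (suc N) n + X * U N (suc n)
        ≈⟨ +-cong (B≈ N n (ℕ.<⇒≤ n<N)) (*-cong X≈ (trans (sym (U-last N (suc n) n<N))
             (trans (U-suc (suc N) n) (+-congʳ (B≈ N n (ℕ.<⇒≤ n<N)))))) ⟩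
      ((z - 1#) * u + Y) + (z + y - (1# + 1#)) * (((z - 1#) * u + Y) + u)
        ≈⟨ solve 4 (λ z y u Y → ((z :- con (+ 1)) :* u :+ Y) :+ (z :+ y :- con (+ 2)) :* (((z :- con (+ 1)) :* u :+ Y) :+ u)
                 := (z :- con (+ 1)) :* ((z :- con (+ 1)) :* u :+ Y :+ u) :+ y :* Y :+ u :* (z :* y :- con (+ 1))) refl z y u Y ⟩
      (z - 1#) * ((z - 1#) * u + Y + u) + y * Y + u * (z * y - 1#)
        ≈⟨ +-cong (+-congʳ (*-congˡ (+-congʳ (sym (B≈ N n (ℕ.<⇒≤ n<N)))))) (*-congˡ (x≈y⇒x∙y⁻¹≈ε zy≈1)) ⟩
      (z - 1#) * (B (suc N) n + u) + y * Y + u * 0#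
        ≈⟨ +-cong (+-congʳ (*-congˡ (sym (U-suc (suc N) n)))) (zeroʳ u) ⟩
      (z - 1#) * U (suc N) (suc n) + y * Y + 0#
        ≈⟨ +-identityʳ _ ⟩
      (z - 1#) * U (suc N) (suc n) + y ^ suc n ∎
      where
      u = U (suc N) n
      Y = y ^ n

    U-suc≈ : ∀ N n → n ≤ N → U (suc N) (suc n) ≈ z * U (suc N) n + y ^ n
    U-suc≈ N n n≤N = trans (U-suc (suc N) n) (trans (+-congʳ (B≈ N n n≤N))
      (solve 3 (λ z u Y → (z :- con (+ 1)) :* u :+ Y :+ u := z :* u :+ Y) refl z _ _))

    -- The factor z - y stays on the left: for power series it is a multiple of w and has no
    -- inverse.
    [z-y]U≈ : ∀ N n → n ≤ suc N → (z - y) * U (suc N) n ≈ z ^ n - y ^ n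
    [z-y]U≈ N zero    _         = begin
      (z - y) * U (suc N) 0  ≈⟨ *-congˡ (U-0 (suc N)) ⟩
      (z - y) * 0#           ≈⟨ solve 2 (λ z y → (z :- y) :* con (+ 0) := con (+ 1) :- con (+ 1)) refl z y ⟩
      1# - 1#                ∎
    [z-y]U≈ N (suc n) (s≤s n≤N) = begin
      (z - y) * U (suc N) (suc n)
        ≈⟨ *-congˡ (U-suc≈ N n n≤N) ⟩
      (z - y) * (z * U (suc N) n + y ^ n)
        ≈⟨ solve 4 (λ z y u Y → (z :- y) :* (z :* u :+ Y) := z :* ((z :- y) :* u) :+ (z :- y) :* Y) refl z y _ _ ⟩
      z * ((z - y) * U (suc N) n) + (z - y) * y ^ n
        ≈⟨ +-congʳ (*-congˡ ([z-y]U≈ N n (ℕ.m≤n⇒m≤1+n n≤N))) ⟩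
      z * (z ^ n - y ^ n) + (z - y) * y ^ n
        ≈⟨ solve 4 (λ z y Z Y → z :* (Z :- Y) :+ (z :- y) :* Y := z :* Z :- y :* Y) refl z y (z ^ n) (y ^ n) ⟩
      z ^ suc n - y ^ suc n ∎

    private
      U+U : ∀ N n → n ≤ N → (z - 1#) * (U (suc N) (suc n) + U (suc N) n) + y ^ n ≈ z ^ suc n
      U+U N zero    0≤N = trans (+-congʳ (*-congˡ (trans (+-congʳ (U-suc≈ N 0 0≤N)) (+-cong (+-congʳ (*-congˡ (U-0 (suc N)))) (U-0 (suc N))))))
        (solve 1 (λ z → (z :- con (+ 1)) :* (z :* con (+ 0) :+ con (+ 1) :+ con (+ 0)) :+ con (+ 1) := z :* con (+ 1)) refl z)
      U+U N (suc n) n<N = begin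
        (z - 1#) * (U (suc N) (suc (suc n)) + U (suc N) (suc n)) + y * Y
          ≈⟨ +-congʳ (*-congˡ (+-cong (U-suc≈ N (suc n) n<N) (U-suc≈ N n (ℕ.<⇒≤ n<N)))) ⟩
        (z - 1#) * ((z * u′ + y * Y) + (z * u + Y)) + y * Y
          ≈⟨ solve 5 (λ z y u u′ Y → (z :- con (+ 1)) :* ((z :* u′ :+ y :* Y) :+ (z :* u :+ Y)) :+ y :* Y
                := z :* ((z :- con (+ 1)) :* (u′ :+ u) :+ Y) :+ (z :* y :- con (+ 1)) :* Y) refl z y u u′ Y ⟩
        z * ((z - 1#) * (u′ + u) + Y) + (z * y - 1#) * Y
          ≈⟨ +-cong (*-congˡ (U+U N n (ℕ.<⇒≤ n<N))) (trans (*-congʳ (x≈y⇒x∙y⁻¹≈ε zy≈1)) (zeroˡ Y)) ⟩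
        z * z ^ suc n + 0#
          ≈⟨ +-identityʳ _ ⟩
        z ^ suc (suc n) ∎
        where
        u = U (suc N) n
        u′ = U (suc N) (suc n)
        Y = y ^ n

    -- The cosine coefficients are those of `B` at n + 1 and at n added together and moved down by
    -- one degree, and the 2 collects the two constant terms. The closed forms of `B` then add up to
    -- the right side.
    cosine-expansion : ∀ N n → suc n ≤ N →
      X * ∑< N (λ j → cast (cosine-coefficient n j) * X ^ j) + (1# + 1#) ≈ z ^ suc n + y ^ suc n
    cosine-expansion N n n<N = begin
      X * ∑< N (λ j → cast (cosine-coefficient n j) * X ^ j) + (1# + 1#)
        ≈⟨ +-congʳ (*-congˡ (sum-+ N (cosine-coefficient n) f′ f (λ _ → ≡.refl))) ⟩
      X * (∑< N (λ j → cast (f′ j) * X ^ j) + ∑< N (λ j → cast (f j) * X ^ j)) + (1# + 1#)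
        ≈⟨ solve 4 (λ o x a b → x :* (a :+ b) :+ (o :+ o) := (o :+ x :* a) :+ (o :+ x :* b)) refl 1# X _ _ ⟩
      (1# + X * ∑< N (λ j → cast (f′ j) * X ^ j)) + (1# + X * ∑< N (λ j → cast (f j) * X ^ j))
        ≈⟨ +-cong (+-congʳ (one (suc n))) (+-congʳ (one n)) ⟨
      (cast ((suc n ℕ.+ 0) C 0) + X * ∑< N (λ j → cast (f′ j) * X ^ j))
        + (cast ((n ℕ.+ 0) C 0) + X * ∑< N (λ j → cast (f j) * X ^ j))
        ≈⟨ +-cong (sum-shift N (λ j → (suc n ℕ.+ j) C (j ℕ.+ j))) (sum-shift N (λ j → (n ℕ.+ j) C (j ℕ.+ j))) ⟨
      B (suc N) (suc n) + B (suc N) n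
        ≈⟨ +-cong (B≈ N (suc n) n<N) (B≈ N n (ℕ.<⇒≤ n<N)) ⟩
      ((z - 1#) * U (suc N) (suc n) + y ^ suc n) + ((z - 1#) * U (suc N) n + y ^ n)
        ≈⟨ solve 5 (λ z u u′ Y Y′ → ((z :- con (+ 1)) :* u′ :+ Y′) :+ ((z :- con (+ 1)) :* u :+ Y)
              := ((z :- con (+ 1)) :* (u′ :+ u) :+ Y) :+ Y′) refl z _ _ _ _ ⟩
      ((z - 1#) * (U (suc N) (suc n) + U (suc N) n) + y ^ n) + y ^ suc n
        ≈⟨ +-congʳ (U+U N n (ℕ.<⇒≤ n<N)) ⟩
      z ^ suc n + y ^ suc n ∎
      where
      f f′ : ℕ → ℕ
      f j = (n ℕ.+ suc j) C (suc j ℕ.+ suc j)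
      f′ j = (suc n ℕ.+ suc j) C (suc j ℕ.+ suc j)
      one : ∀ m → cast ((m ℕ.+ 0) C 0) ≈ 1#
      one m = trans (cast-cong (nC0≡1 (m ℕ.+ 0))) (+-identityʳ 1#)

-- Elementary and complete symmetric functions as inverse series

module SymmetricFunctions (R : CommutativeRing 0ℓ 0ℓ) where
  open Arithmetic R
  open PowerSeries R
  open MultipleSums R
  private module M = MultipleSums commutativeRing

  M<-κ : ∀ {I : Set} (fs : List (I → Carrier)) xs → M.M< (map (κ ∘_) fs) xs ≋ κ (M< fs xs)
  M<-κ []       xs       = S.refl
  M<-κ (f ∷ fs) []       = S.sym κ-0
  M<-κ (f ∷ fs) (x ∷ xs) = S.trans
    (S.+-cong (S.trans (S.*-congˡ {κ (f x)} (M<-κ fs xs)) (S.sym (κ-* (f x) (M< fs xs)))) (M<-κ (f ∷ fs) xs))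
    (S.sym (κ-+ (f x * M< fs xs) (M< (f ∷ fs) xs)))

  ∏-κ : ∀ {I : Set} (f : I → Carrier) xs → M.∏ (κ ∘ f) xs ≋ κ (∏ f xs)
  ∏-κ f []       = S.refl
  ∏-κ f (x ∷ xs) = S.trans (S.*-congˡ {κ (f x)} (∏-κ f xs)) (S.sym (κ-* (f x) (∏ f xs)))

  ∏-constant : ∀ {I : Set} (f : I → Series) xs → M.∏ f xs 0 ≈ ∏ (λ x → f x 0) xs
  ∏-constant f []       = refl
  ∏-constant f (x ∷ xs) = *-congˡ (∏-constant f xs)

  module _ {I : Set} (u : I → Carrier) where
    -- The sign is built into the arguments of `elementary`, whose series is therefore ∏ (1 - u x
    -- w), the inverse of the series of `complete`.
    elementary complete : List I → Series
    elementary xs j = M< (replicate j (λ x → - u x)) xs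
    complete   xs j = M≤ (replicate j u) xs

    -- A further position x multiplies the elementary series by L = 1 - u x w, while L times the new
    -- complete series is the old one.
    elementary-complete : ∀ xs → elementary xs ⊗ complete xs ≋ S.1#
    elementary-complete []       zero    = *-identityʳ 1#
    elementary-complete []       (suc n) = trans (+-cong (zeroʳ 1#) (⊗-zeroˡ _ (λ _ → refl) n)) (+-identityˡ 0#)
    elementary-complete (x ∷ xs) = S.trans (S.*-congʳ {h′} step-e)
      (S.trans (S.solve 3 (λ a b c → a S.:* b S.:* c S.:= b S.:* (a S.:* c)) S.refl L e h′)
        (S.trans (S.*-congˡ {e} step-h) (elementary-complete xs)))
      where
      L = S.1# S.- κ (u x) ⊗ w
      e = elementary xs
      h′ = complete (x ∷ xs)
      L⊗-suc : ∀ f n → (L ⊗ f) (suc n) ≈ f (suc n) - u x * f n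
      L⊗-suc f n = trans
        (S.solve 3 (λ a w f → (S.con (+ 1) S.:- a S.:* w) S.:* f S.:= f S.:- a S.:* (w S.:* f)) S.refl (κ (u x)) w f (suc n))
        (+-congˡ (-‿cong (trans (κ⊗ (u x) (w ⊗ f) (suc n)) (*-congˡ (w⊗-suc f n)))))
      L₀≈1 : L 0 ≈ 1#
      L₀≈1 = trans (+-congˡ (-‿cong (zeroʳ _))) (trans (+-congˡ -0#≈0#) (+-identityʳ 1#))
      step-e : elementary (x ∷ xs) ≋ L ⊗ e
      step-e zero    = sym (trans (*-congʳ L₀≈1) (*-identityʳ 1#))
      step-e (suc n) = sym (trans (L⊗-suc e n)
        (solve 3 (λ a b c → a :- b :* c := :- b :* c :+ a) refl _ _ _))
      step-h : L ⊗ h′ ≋ complete xs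
      step-h zero    = trans (*-congʳ L₀≈1) (*-identityʳ 1#)
      step-h (suc n) = trans (L⊗-suc h′ n)
        (solve 3 (λ a b c → b :* a :+ c :- b :* a := c) refl _ _ _)

-- The elementary symmetric functions of the u k

module CyclotomicSums (R : CommutativeRing 0ℓ 0ℓ) where
  open Arithmetic R
  open PowerSeries R
  open MultipleSums R
  open SymmetricFunctions R
  open import Relation.Binary.Reasoning.Setoid setoid
  private
    module M = MultipleSums commutativeRing
    module ≋ where
      open import Relation.Binary.Reasoning.Setoid S.setoid public

  module AtRoot (p′ : ℕ) (ζ : Carrier) (v : ℕ → Carrier)
    (ζ^p≈1 : ζ ^ suc p′ ≈ 1#)
    (v-inverse : ∀ j → 0 < j → j < suc p′ → (1# - ζ ^ j) * v j ≈ 1#)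
    where

    p : ℕ
    p = suc p′

    ks : List ℕ
    ks = range 1 p′

    u : ℕ → Carrier
    u k = ζ ^ k * v k * v k

    ζ^k*ζ^[p-k]≈1 : ∀ {k} → k ≤ p → ζ ^ k * ζ ^ (p ∸ k) ≈ 1#
    ζ^k*ζ^[p-k]≈1 {k} k≤p = trans (sym (^-homo-* ζ k (p ∸ k)))
      (trans (reflexive (≡.cong (ζ ^_) (ℕ.m+[n∸m]≡n k≤p))) ζ^p≈1)

    -- This is 1 / (1 - ζ^-k) = - ζ^k / (1 - ζ^k), checked after multiplication by the unit 1 -
    -- ζ^(p-k).
    v-reflect : ∀ {k} → k ∈ ks → v (p ∸ k) ≈ - (ζ ^ k * v k)
    v-reflect {k} k∈ks with 0<k , k<p ← ∈-range 1 p′ k∈ks =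
      *-cancelˡ-unit (v-inverse (p ∸ k) 0<p-k p-k<p) (begin
        (1# - s) * v (p ∸ k)       ≈⟨ v-inverse (p ∸ k) 0<p-k p-k<p ⟩
        1#                         ≈⟨ v-inverse k 0<k k<p ⟨
        (1# - r) * a               ≈⟨ solve 2 (λ r a → (con (+ 1) :- r) :* a := con (+ 1) :* a :- r :* a) refl r a ⟩
        1# * a - r * a             ≈⟨ +-congʳ (*-congʳ (ζ^k*ζ^[p-k]≈1 (ℕ.<⇒≤ k<p))) ⟨
        r * s * a - r * a          ≈⟨ solve 3 (λ r s a → r :* s :* a :- r :* a
                                       := (con (+ 1) :- s) :* (:- (r :* a))) refl r s a ⟩
        (1# - s) * - (r * a)       ∎)
      where
      r = ζ ^ k
      s = ζ ^ (p ∸ k)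
      a = v k
      0<p-k : 0 < p ∸ k
      0<p-k = ℕ.m<n⇒0<n∸m k<p
      p-k<p : p ∸ k < p
      p-k<p = ℕ.∸-monoʳ-< 0<k (ℕ.<⇒≤ k<p)

    private
      D : Series
      D = M.∏ (λ k → S.1# S.- κ ζ S.^ k S.* z) ks

      κζ^p≋1 : κ ζ S.^ p ≋ S.1#
      κζ^p≋1 = S.trans (S.sym (κ-^ ζ p)) (κ-cong ζ^p≈1)

      κ-inverse : ∀ j → 0 < j → j < p → (S.1# S.- κ ζ S.^ j) S.* κ (v j) ≋ S.1#
      κ-inverse j 0<j j<p = S.trans (S.*-congʳ {κ (v j)} (S.sym (S.trans (κ-+ 1# (- ζ ^ j))
          (S.+-congˡ {S.1#} (S.trans (κ-neg (ζ ^ j)) (S.-‿cong (κ-^ ζ j)))))))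
        (S.trans (S.sym (κ-* (1# - ζ ^ j) (v j))) (κ-cong (v-inverse j 0<j j<p)))

      -- The product formula at t = z, where the factor with exponent 0 is 1 - z = - w.
      wD≋z^p-1 : w S.* D ≋ z S.^ p S.- S.1#
      wD≋z^p-1 = S.trans
        (S.solve 2 (λ w D → w S.:* D S.:= S.:- ((S.con (+ 1) S.:- S.con (+ 1) S.:* (S.con (+ 1) S.:+ w)) S.:* D)) S.refl w D)
        (S.trans (S.-‿cong (RootsOfUnity.∏[1-ζ^k*t] commutativeRing p′ (κ ζ) (κ ∘ v) κζ^p≋1 κ-inverse z))
          (S.solve 1 (λ a → S.:- (S.con (+ 1) S.:- a) S.:= a S.:- S.con (+ 1)) S.refl (z S.^ p)))

    z^p-1-linear : (z S.^ p S.- S.1#) 1 ≈ cast p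
    z^p-1-linear = trans (+-cong (trans (z^k-coefficient p 1) (cast-cong (nC1≡n p))) -0#≈0#) (+-identityʳ _)

    z^p-1-constant : (z S.^ p S.- S.1#) 0 ≈ 0#
    z^p-1-constant = trans (+-congʳ (trans (z^k-coefficient p 0) (trans (cast-cong (nC0≡1 p)) (+-identityʳ 1#))))
      (-‿inverseʳ 1#)

    -- Comparing coefficients of w in `wD≋z^p-1` gives p = ∏ (1 - ζ^k), and every factor has the
    -- inverse `v k`.
    p-unit : cast p * ∏ v ks ≈ 1#
    p-unit = begin
      cast p * ∏ v ks
        ≈⟨ *-congʳ (trans (sym z^p-1-linear) (trans (sym (wD≋z^p-1 1)) (w⊗-suc D 0))) ⟩
      D 0 * ∏ v ks
        ≈⟨ *-congʳ (trans (∏-constant (λ k → S.1# S.- κ ζ S.^ k S.* z) ks) (∏-cong ks (λ k _ → constant k))) ⟩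
      ∏ (λ k → 1# - ζ ^ k) ks * ∏ v ks
        ≈⟨ ∏-* (λ k → 1# - ζ ^ k) v ks ⟨
      ∏ (λ k → (1# - ζ ^ k) * v k) ks
        ≈⟨ ∏-cong ks (λ k k∈ks → v-inverse k (proj₁ (∈-range 1 p′ k∈ks)) (proj₂ (∈-range 1 p′ k∈ks))) ⟩
      ∏ (λ _ → 1#) ks
        ≈⟨ trans (∏-const 1# ks) (1^n≈1 (length ks)) ⟩
      1# ∎
      where
      constant : ∀ k → 1# - (κ ζ S.^ k) 0 * (1# + 0#) ≈ 1# - ζ ^ k
      constant k = +-congˡ (-‿cong (trans (*-cong (sym (κ-^ ζ k 0)) (+-identityʳ 1#)) (*-identityʳ _)))

    P : Series
    P = M.∏ (λ k → S.1# S.+ κ (- u k) S.* X) ks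

    private
      c : Series
      c = S.cast p

      -- The factor 1 - ζ^k z divided by its value at z = 1, so that the constant coefficient is 1.
      g : ℕ → Series
      g k = κ (v k) S.* (S.1# S.- κ ζ S.^ k S.* z)

      c∏v≋1 : c S.* κ (∏ v ks) ≋ S.1#
      c∏v≋1 = S.trans (S.*-congʳ {κ (∏ v ks)} (S.sym (κ-cast p)))
        (S.trans (S.sym (κ-* (cast p) (∏ v ks))) (κ-cong p-unit))

      cw∏g≋z^p-1 : c S.* w S.* M.∏ g ks ≋ z S.^ p S.- S.1#
      cw∏g≋z^p-1 = ≋.begin
        c S.* w S.* M.∏ g ks
          ≋.≈⟨ S.*-congˡ {c S.* w} (S.trans (M.∏-* (κ ∘ v) (λ k → S.1# S.- κ ζ S.^ k S.* z) ks)
               (S.*-congʳ {D} (∏-κ v ks))) ⟩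
        c S.* w S.* (κ (∏ v ks) S.* D)
          ≋.≈⟨ S.solve 4 (λ c w V D → c S.:* w S.:* (V S.:* D) S.:= c S.:* V S.:* (w S.:* D)) S.refl c w (κ (∏ v ks)) D ⟩
        c S.* κ (∏ v ks) S.* (w S.* D)
          ≋.≈⟨ S.trans (S.*-congʳ {w S.* D} c∏v≋1) (S.*-identityˡ (w S.* D)) ⟩
        w S.* D
          ≋.≈⟨ wD≋z^p-1 ⟩
        z S.^ p S.- S.1# ≋.∎

      g*g-reflect : ∀ k → k ∈ ks → g k S.* g (p ∸ k) ≋ z S.* (S.1# S.+ κ (- u k) S.* X)
      g*g-reflect k k∈ks with 0<k , k<p ← ∈-range 1 p′ k∈ks = ≋.begin
        a S.* (S.1# S.- r S.* z) S.* (κ (v (p ∸ k)) S.* (S.1# S.- s S.* z))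
          ≋.≈⟨ S.*-congˡ {a S.* (S.1# S.- r S.* z)} (S.*-congʳ {S.1# S.- s S.* z} reflected) ⟩
        a S.* (S.1# S.- r S.* z) S.* (S.- (r S.* a) S.* (S.1# S.- s S.* z))
          -- The relations (1 - r) a = 1 and r s = 1 are unknown to the solver; the right side
          -- isolates both as explicit factors for the next step.
          ≋.≈⟨ S.solve 4 (λ r s a w → let one = S.con (+ 1); z = one S.:+ w in
                 a S.:* (one S.:- r S.:* z) S.:* (S.:- (r S.:* a) S.:* (one S.:- s S.:* z))
                 S.:= ((one S.:- r) S.:* a) S.:* ((one S.:- r) S.:* a) S.:* z S.:- r S.:* a S.:* a S.:* (w S.:* w)
                   S.:+ a S.:* a S.:* (one S.:- r S.:* z) S.:* z S.:* (r S.:* s S.:- one))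
               S.refl r s a w ⟩
        ((S.1# S.- r) S.* a) S.* ((S.1# S.- r) S.* a) S.* z S.- r S.* a S.* a S.* (w S.* w)
          S.+ a S.* a S.* (S.1# S.- r S.* z) S.* z S.* (r S.* s S.- S.1#)
          ≋.≈⟨ S.+-cong (S.+-cong (S.*-congʳ {z} (S.*-cong unit unit))
                 (S.-‿cong (S.*-cong (S.sym κu) (S.sym zX≋w²))))
               (S.*-congˡ {a S.* a S.* (S.1# S.- r S.* z) S.* z} (S.x≈y⇒x∙y⁻¹≈ε {r S.* s} {S.1#} rs≋1)) ⟩
        S.1# S.* S.1# S.* z S.- κ (u k) S.* (z S.* X) S.+ a S.* a S.* (S.1# S.- r S.* z) S.* z S.* S.0#
          ≋.≈⟨ S.solve 4 (λ z X U b → S.con (+ 1) S.:* S.con (+ 1) S.:* z S.:- U S.:* (z S.:* X) S.:+ b S.:* S.con (+ 0)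
                 S.:= z S.:* (S.con (+ 1) S.:+ S.:- U S.:* X)) S.refl z X (κ (u k)) (a S.* a S.* (S.1# S.- r S.* z) S.* z) ⟩
        z S.* (S.1# S.+ S.- κ (u k) S.* X)
          ≋.≈⟨ S.*-congˡ {z} (S.+-congˡ {S.1#} (S.*-congʳ {X} (S.sym (κ-neg (u k))))) ⟩
        z S.* (S.1# S.+ κ (- u k) S.* X) ≋.∎
        where
        r = κ ζ S.^ k
        s = κ ζ S.^ (p ∸ k)
        a = κ (v k)
        unit : (S.1# S.- r) S.* a ≋ S.1#
        unit = κ-inverse k (proj₁ (∈-range 1 p′ k∈ks)) (proj₂ (∈-range 1 p′ k∈ks))
        rs≋1 : r S.* s ≋ S.1#
        rs≋1 = S.trans (S.*-cong (S.sym (κ-^ ζ k)) (S.sym (κ-^ ζ (p ∸ k))))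
          (S.trans (S.sym (κ-* (ζ ^ k) (ζ ^ (p ∸ k))))
            (κ-cong (ζ^k*ζ^[p-k]≈1 (ℕ.<⇒≤ (proj₂ (∈-range 1 p′ k∈ks))))))
        ra : κ (ζ ^ k * v k) ≋ r S.* a
        ra = S.trans (κ-* (ζ ^ k) (v k)) (S.*-congʳ {a} (κ-^ ζ k))
        reflected : κ (v (p ∸ k)) ≋ S.- (r S.* a)
        reflected = S.trans (κ-cong (v-reflect k∈ks)) (S.trans (κ-neg (ζ ^ k * v k)) (S.-‿cong ra))
        κu : κ (u k) ≋ r S.* a S.* a
        κu = S.trans (κ-* (ζ ^ k * v k) (v k)) (S.*-congʳ {a} ra)

      -- Reversing one of two copies of the product pairs each k with p - k without cutting the
      -- range in halves. Hence the square, and with it the factor p² later on.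
      ∏g²≋z^p′P : M.∏ g ks S.* M.∏ g ks ≋ z S.^ p′ S.* P
      ∏g²≋z^p′P = ≋.begin
        M.∏ g ks S.* M.∏ g ks
          ≋.≈⟨ S.*-congˡ {M.∏ g ks} (S.trans (S.sym (M.∏-reverse g ks))
               (S.trans (S.reflexive (≡.cong (M.∏ g) (reverse-range p′))) (M.∏-map (p ∸_) g ks))) ⟩
        M.∏ g ks S.* M.∏ (λ k → g (p ∸ k)) ks
          ≋.≈⟨ S.sym (M.∏-* g (λ k → g (p ∸ k)) ks) ⟩
        M.∏ (λ k → g k S.* g (p ∸ k)) ks
          ≋.≈⟨ M.∏-cong ks g*g-reflect ⟩
        M.∏ (λ k → z S.* (S.1# S.+ κ (- u k) S.* X)) ks
          ≋.≈⟨ M.∏-* (λ _ → z) (λ k → S.1# S.+ κ (- u k) S.* X) ks ⟩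
        M.∏ (λ _ → z) ks S.* P
          ≋.≈⟨ S.*-congʳ {P} (S.trans (M.∏-const z ks) (S.reflexive (≡.cong (z S.^_) (length-range 1 p′)))) ⟩
        z S.^ p′ S.* P ≋.∎

    zⁿyⁿ≋1 : ∀ n → z S.^ n S.* y S.^ n ≋ S.1#
    zⁿyⁿ≋1 n = S.trans (S.sym (S.^-distrib-* z y n)) (S.trans (S.^-congˡ n z⊗y) (S.1^n≈1 n))

    -- The square of `cw∏g≋z^p-1`, multiplied by y^p: one side is (z^p - 1)² y^p = z^p - 2 + y^p,
    -- and on the other z X = w² collects exactly z^p, which y^p removes.
    p²XP≋ : c S.* c S.* (X S.* P) S.+ (S.1# S.+ S.1#) ≋ z S.^ p S.+ y S.^ p
    p²XP≋ = ≋.begin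
      c S.* c S.* (X S.* P) S.+ (S.1# S.+ S.1#)
        ≋.≈⟨ S.+-congʳ {S.1# S.+ S.1#} (S.sym (S.trans (S.*-congʳ {c S.* c S.* (X S.* P)} (zⁿyⁿ≋1 p)) (S.*-identityˡ _))) ⟩
      Z S.* Y S.* (c S.* c S.* (X S.* P)) S.+ (S.1# S.+ S.1#)
        ≋.≈⟨ S.+-congʳ {S.1# S.+ S.1#} (S.solve 6 (λ z Z Y c X P → z S.:* Z S.:* Y S.:* (c S.:* c S.:* (X S.:* P))
               S.:= Y S.:* (c S.:* c S.:* (z S.:* X) S.:* (Z S.:* P))) S.refl z (z S.^ p′) Y c X P) ⟩
      Y S.* (c S.* c S.* (z S.* X) S.* (z S.^ p′ S.* P)) S.+ (S.1# S.+ S.1#)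
        ≋.≈⟨ S.+-congʳ {S.1# S.+ S.1#} (S.*-congˡ {Y} (S.*-cong (S.*-congˡ {c S.* c} zX≋w²) (S.sym ∏g²≋z^p′P))) ⟩
      Y S.* (c S.* c S.* (w S.* w) S.* (M.∏ g ks S.* M.∏ g ks)) S.+ (S.1# S.+ S.1#)
        ≋.≈⟨ S.+-congʳ {S.1# S.+ S.1#} (S.*-congˡ {Y} (S.trans
               (S.solve 3 (λ c w G → c S.:* c S.:* (w S.:* w) S.:* (G S.:* G) S.:= (c S.:* w S.:* G) S.:* (c S.:* w S.:* G))
                 S.refl c w (M.∏ g ks))
               (S.*-cong cw∏g≋z^p-1 cw∏g≋z^p-1))) ⟩
      Y S.* ((Z S.- S.1#) S.* (Z S.- S.1#)) S.+ (S.1# S.+ S.1#)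
        ≋.≈⟨ S.solve 2 (λ Z Y → Y S.:* ((Z S.:- S.con (+ 1)) S.:* (Z S.:- S.con (+ 1))) S.:+ S.con (+ 2)
               S.:= Z S.:+ Y S.:+ (Z S.:* Y S.:- S.con (+ 1)) S.:* (Z S.:- S.con (+ 2))) S.refl Z Y ⟩
      Z S.+ Y S.+ (Z S.* Y S.- S.1#) S.* (Z S.- (S.1# S.+ S.1#))
        ≋.≈⟨ S.+-congˡ {Z S.+ Y} (S.trans (S.*-congʳ {Z S.- (S.1# S.+ S.1#)} (S.x≈y⇒x∙y⁻¹≈ε {Z S.* Y} {S.1#} (zⁿyⁿ≋1 p)))
             (S.zeroˡ (Z S.- (S.1# S.+ S.1#)))) ⟩
      Z S.+ Y S.+ S.0#
        ≋.≈⟨ S.+-identityʳ (Z S.+ Y) ⟩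
      Z S.+ Y ≋.∎
      where
      Z = z S.^ p
      Y = y S.^ p

    ε : ℕ → Carrier
    ε = elementary u ks

    P-expansion : ∀ N → p ≤ N → P ≋ S.∑< N (λ j → κ (ε j) S.* X S.^ j)
    P-expansion N p≤N = S.trans
      (M.∏-expansion N (λ k → κ (- u k)) X ks (≡.subst (_< N) (≡.sym (length-range 1 p′)) p≤N))
      (S.∑-cong N (λ j _ → S.*-congʳ {X S.^ j} (S.trans
        (S.reflexive (≡.cong (λ fs → M.M< fs ks) (≡.sym (map-replicate (κ ∘_) j (λ k → - u k)))))
        (M<-κ (replicate j (λ k → - u k)) ks))))

    p²ε≈ : ∀ j → cast p * cast p * ε j ≈ cast (cosine-coefficient p′ j)
    p²ε≈ j = X-expansion-unique N (λ j → cast p * cast p * ε j) (cast ∘ cosine-coefficient p′)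
      (X-cancel (S.+-cancelʳ (S.1# S.+ S.1#) _ _ (S.trans (S.+-congʳ {S.1# S.+ S.1#} left)
        (S.trans p²XP≋ (S.sym right))))) j (ℕ.m≤n+m (suc j) p)
      where
      -- Large enough for all terms of `P` and for the index j.
      N = p ℕ.+ suc j
      p≤N : p ≤ N
      p≤N = ℕ.m≤m+n p (suc j)
      right : X S.* S.∑< N (λ i → κ (cast (cosine-coefficient p′ i)) S.* X S.^ i) S.+ (S.1# S.+ S.1#)
              ≋ z S.^ p S.+ y S.^ p
      right = S.trans (S.+-congʳ {S.1# S.+ S.1#} (S.*-congˡ {X} (S.∑-cong N
          (λ i _ → S.*-congʳ {X S.^ i} (κ-cast (cosine-coefficient p′ i))))))
        (BinomialSums.cosine-expansion commutativeRing z y X z⊗y X≋z+y-2 N p′ p≤N)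
      left : X S.* S.∑< N (λ i → κ (cast p * cast p * ε i) S.* X S.^ i) ≋ c S.* c S.* (X S.* P)
      left = S.trans (S.*-congˡ {X} (S.trans
          (S.∑-cong N (λ i _ → S.trans (S.*-congʳ {X S.^ i} (S.trans (κ-* (cast p * cast p) (ε i))
              (S.*-congʳ {κ (ε i)} (S.trans (κ-* (cast p) (cast p)) (S.*-cong (κ-cast p) (κ-cast p))))))
            (S.*-assoc (c S.* c) (κ (ε i)) (X S.^ i))))
          (S.trans (S.∑-*ˡ N (c S.* c) (λ i → κ (ε i) S.* X S.^ i)) (S.*-congˡ {c S.* c} (S.sym (P-expansion N p≤N))))))
        (S.solve 3 (λ x c P → x S.:* (c S.:* c S.:* P) S.:= c S.:* c S.:* (x S.:* P)) S.refl X c P)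

    -- Absorption trades one of the two factors p in `p²ε≈` for j + 1 and merges two binomial
    -- coefficients into one; the spare p is a unit.
    p[1+j]ε≈ : ∀ j → cast p * (cast (suc j) * ε j) ≈ cast ((p ℕ.+ j) C suc (j ℕ.+ j))
    p[1+j]ε≈ j = *-cancelˡ-unit p-unit (begin
      cast p * (cast p * (cast (suc j) * ε j))
        ≈⟨ solve 3 (λ c j e → c :* (c :* (j :* e)) := j :* (c :* c :* e)) refl (cast p) (cast (suc j)) (ε j) ⟩
      cast (suc j) * (cast p * cast p * ε j)
        ≈⟨ *-congˡ (p²ε≈ j) ⟩
      cast (suc j) * cast (cosine-coefficient p′ j)
        ≈⟨ cast-* (suc j) (cosine-coefficient p′ j) ⟨
      cast (suc j ℕ.* cosine-coefficient p′ j)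
        ≈⟨ cast-cong (cosine-coefficient-absorption p′ j) ⟩
      cast (p ℕ.* ((p ℕ.+ j) C suc (j ℕ.+ j)))
        ≈⟨ cast-* p ((p ℕ.+ j) C suc (j ℕ.+ j)) ⟩
      cast p * cast ((p ℕ.+ j) C suc (j ℕ.+ j)) ∎)

    -- The complete symmetric functions of the u k

    module Star (F : Series) (cw≋[z^p-1]F : S.cast p S.* w ≋ (z S.^ p S.- S.1#) S.* F) where
      private
        N : ℕ
        N = suc p

        -- For j > 0 the cofactor of `F` is j z^(j-1) + (j-1) z^j, whose coefficients are the
        -- weights in the claim. Written with `y` it also makes sense at j = 0, and j enters only
        -- through z^j and linearly.
        h : ℕ → Series
        h j = F S.* (z S.^ j S.* y S.* (S.cast j S.* (S.1# S.+ z) S.- z))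

        -- The candidate for the complete symmetric function of degree j, a coefficient of w^(2j).
        T : Series
        T j = - h j (j ℕ.+ j)

        A : ℕ → Series
        A t = S.cast (suc t) S.* (S.1# S.+ z) S.- z

        -- The series behind ε i T j for i + j = t. Replacing j by (t + 1) - (i + 1) gives a meaning
        -- to i > t as well, and brings in (i + 1) ε i, which `p[1+j]ε≈` evaluates.
        K : ℕ → ℕ → Series
        K t i = F S.* (z S.^ t S.* y S.* (κ (ε i) S.* X S.^ i S.*
                  ((S.cast (suc t) S.- S.cast (suc i)) S.* (S.1# S.+ z) S.- z)))

        Q : Series
        Q = S.∑< N (λ i → κ (cast (suc i) * ε i) S.* X S.^ i)

        G : ℕ → Series
        G t = F S.* (z S.^ t S.* y S.* (A t S.* P S.- (S.1# S.+ z) S.* Q))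

        cast⊗ : ∀ k f n → (S.cast k ⊗ f) n ≈ cast k * f n
        cast⊗ k f n = trans (S.*-congʳ {f} (S.sym (κ-cast k)) n) (κ⊗ (cast k) f n)

        -- A shift by w^(2i) moves the coefficient from degree 2j to 2(i + j); as w^(2i) = X^i z^i,
        -- it also completes z^j to z^(i+j).
        εT≈ : ∀ i j → ε i * T j ≈ - K (i ℕ.+ j) i ((i ℕ.+ j) ℕ.+ (i ℕ.+ j))
        εT≈ i j = begin
          ε i * - h j (j ℕ.+ j)
            ≈⟨ trans (sym (-‿distribʳ-* (ε i) _)) (-‿cong (*-congˡ (sym (w^k-shift (i ℕ.+ i) (h j) (j ℕ.+ j))))) ⟩
          - (ε i * (w S.^ (i ℕ.+ i) ⊗ h j) (i ℕ.+ i ℕ.+ (j ℕ.+ j)))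
            ≈⟨ -‿cong (sym (κ⊗ (ε i) (w S.^ (i ℕ.+ i) ⊗ h j) (i ℕ.+ i ℕ.+ (j ℕ.+ j)))) ⟩
          - (κ (ε i) ⊗ (w S.^ (i ℕ.+ i) ⊗ h j)) (i ℕ.+ i ℕ.+ (j ℕ.+ j))
            ≈⟨ -‿cong (S.sym shifted (i ℕ.+ i ℕ.+ (j ℕ.+ j))) ⟩
          - K (i ℕ.+ j) i (i ℕ.+ i ℕ.+ (j ℕ.+ j))
            ≡⟨ ≡.cong (λ n → - K (i ℕ.+ j) i n) (interchange i j) ⟩
          - K (i ℕ.+ j) i ((i ℕ.+ j) ℕ.+ (i ℕ.+ j)) ∎
          where
          interchange : ∀ i j → i ℕ.+ i ℕ.+ (j ℕ.+ j) ≡ (i ℕ.+ j) ℕ.+ (i ℕ.+ j)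
          interchange = ℕ.solve-∀
          J = S.cast j
          difference : S.cast (suc (i ℕ.+ j)) S.- S.cast (suc i) ≋ J
          difference = S.trans (S.+-congʳ {S.- S.cast (suc i)} (S.+-congˡ {S.1#} (S.cast-+ i j)))
            (S.solve 2 (λ I J → (S.con (+ 1) S.:+ (I S.:+ J)) S.:- (S.con (+ 1) S.:+ I) S.:= J) S.refl (S.cast i) J)
          shifted : K (i ℕ.+ j) i ≋ κ (ε i) S.* (w S.^ (i ℕ.+ i) S.* h j)
          shifted = S.trans
            (S.*-congˡ {F} (S.*-cong (S.*-congʳ {y} (S.^-homo-* z i j))
              (S.*-congˡ {κ (ε i) S.* X S.^ i} (S.+-congʳ {S.- z} (S.*-congʳ {S.1# S.+ z} difference)))))
            (S.trans (S.solve 7 (λ F zi zj y e x B → F S.:* (zi S.:* zj S.:* y S.:* (e S.:* x S.:* B))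
                       S.:= e S.:* ((x S.:* zi) S.:* (F S.:* (zj S.:* y S.:* B))))
                      S.refl F (z S.^ i) (z S.^ j) y (κ (ε i)) (X S.^ i) (J S.* (S.1# S.+ z) S.- z))
              (S.*-congˡ {κ (ε i)} (S.*-congʳ {h j} (X^i⊗z^i≋w^2i i))))

        -- X^i has order 2i > 2t. Hence the convolution, a sum over i ≤ t, may run over all i, where
        -- it has the closed form `G`.
        K-low : ∀ t i → t < i → K t i (t ℕ.+ t) ≈ 0#
        K-low t i t<i = trans
          (S.solve 6 (λ F zt y e x B → F S.:* (zt S.:* y S.:* (e S.:* x S.:* B))
             S.:= x S.:* (F S.:* (zt S.:* y S.:* (e S.:* B))))
             S.refl F (z S.^ t) y (κ (ε i)) (X S.^ i)
             ((S.cast (suc t) S.- S.cast (suc i)) S.* (S.1# S.+ z) S.- z) (t ℕ.+ t))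
          (X^i-low i _ (t ℕ.+ t) (ℕ.+-mono-< t<i t<i))

        ∑K≋G : ∀ t → S.∑< N (K t) ≋ G t
        ∑K≋G t = S.trans
          (S.∑-cong N (λ i _ → S.trans
            (S.solve 8 (λ F zt y e x a i z → F S.:* (zt S.:* y S.:* (e S.:* x S.:* ((a S.:- i) S.:* (S.con (+ 1) S.:+ z) S.:- z)))
               S.:= F S.:* (zt S.:* y) S.:* (a S.:* (S.con (+ 1) S.:+ z) S.:- z) S.:* (e S.:* x)
                 S.:+ (S.:- (F S.:* (zt S.:* y) S.:* (S.con (+ 1) S.:+ z))) S.:* ((i S.:* e) S.:* x))
               S.refl F (z S.^ t) y (κ (ε i)) (X S.^ i) (S.cast (suc t)) (S.cast (suc i)) z)
            (S.+-congˡ {α S.* (κ (ε i) S.* X S.^ i)} (S.*-congˡ {β} (S.*-congʳ {X S.^ i} (S.sym (S.trans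
              (κ-* (cast (suc i)) (ε i)) (S.*-congʳ {κ (ε i)} (κ-cast (suc i))))))))))
          (S.trans (S.∑-+ N (λ i → α S.* (κ (ε i) S.* X S.^ i)) (λ i → β S.* (κ (cast (suc i) * ε i) S.* X S.^ i)))
            (S.trans (S.+-cong (S.∑-*ˡ N α (λ i → κ (ε i) S.* X S.^ i)) (S.∑-*ˡ N β (λ i → κ (cast (suc i) * ε i) S.* X S.^ i)))
              (S.trans (S.+-congʳ {β S.* Q} (S.*-congˡ {α} (S.sym (P-expansion N (ℕ.n≤1+n p)))))
                (S.solve 7 (λ F zt y A P z Q → F S.:* (zt S.:* y) S.:* A S.:* P
                     S.:+ (S.:- (F S.:* (zt S.:* y) S.:* z)) S.:* Q
                     S.:= F S.:* (zt S.:* y S.:* (A S.:* P S.:- z S.:* Q)))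
                  S.refl F (z S.^ t) y (A t) P (S.1# S.+ z) Q))))
          where
          α = F S.* (z S.^ t S.* y) S.* A t
          β = S.- (F S.* (z S.^ t S.* y) S.* (S.1# S.+ z))

        U : Series
        U = BinomialSums.U commutativeRing z y X z⊗y X≋z+y-2 N p

        -- So p Q stands for (z^p - y^p) / (z - y).
        cQ≋U : c S.* Q ≋ U
        cQ≋U = S.trans (S.sym (S.∑-*ˡ N c (λ i → κ (cast (suc i) * ε i) S.* X S.^ i)))
          (S.∑-cong N (λ i _ → S.trans (S.sym (S.*-assoc c (κ (cast (suc i) * ε i)) (X S.^ i)))
            (S.*-congʳ {X S.^ i} (S.trans (S.*-congʳ {κ (cast (suc i) * ε i)} (S.sym (κ-cast p)))
              (S.trans (S.sym (κ-* (cast p) (cast (suc i) * ε i)))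
                (S.trans (κ-cong (p[1+j]ε≈ i)) (κ-cast ((p ℕ.+ i) C suc (i ℕ.+ i)))))))))

        Z Y : Series
        Z = z S.^ p
        Y = y S.^ p

        c²w²P≋ : c S.* c S.* (w S.* w S.* P) ≋ z S.* (Z S.+ Y S.- (S.1# S.+ S.1#))
        c²w²P≋ = S.trans (S.*-congˡ {c S.* c} (S.*-congʳ {P} (S.sym zX≋w²)))
          (S.trans (S.solve 4 (λ c z X P → c S.:* c S.:* (z S.:* X S.:* P)
                      S.:= z S.:* (c S.:* c S.:* (X S.:* P) S.:+ S.con (+ 2) S.:- S.con (+ 2))) S.refl c z X P)
            (S.*-congˡ {z} (S.+-congʳ {S.- (S.1# S.+ S.1#)} p²XP≋)))

        -- (1 + z) w = z² - 1 = z (z - y), so the factor required by `[z-y]U≈` is present.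
        [1+z]wcQ≋ : (S.1# S.+ z) S.* w S.* (c S.* Q) ≋ z S.* (Z S.- Y)
        [1+z]wcQ≋ = S.trans (S.*-congˡ {(S.1# S.+ z) S.* w} cQ≋U)
          (S.trans (S.solve 3 (λ w y U → let z = S.con (+ 1) S.:+ w in (S.con (+ 1) S.:+ z) S.:* w S.:* U
                      S.:= z S.:* ((z S.:- y) S.:* U) S.:+ (z S.:* y S.:- S.con (+ 1)) S.:* U) S.refl w y U)
            (S.trans (S.+-cong (S.*-congˡ {z} (BinomialSums.[z-y]U≈ commutativeRing z y X z⊗y X≋z+y-2 p p (ℕ.n≤1+n p)))
                       (S.trans (S.*-congʳ {U} (S.x≈y⇒x∙y⁻¹≈ε {z S.* y} {S.1#} z⊗y)) (S.zeroˡ U)))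
              (S.+-identityʳ (z S.* (Z S.- Y)))))

        Y[Z-1]≋ : Y S.* (Z S.- S.1#) ≋ S.1# S.- Y
        Y[Z-1]≋ = S.trans (S.solve 2 (λ Z Y → Y S.:* (Z S.:- S.con (+ 1)) S.:= Z S.:* Y S.:- Y) S.refl Z Y)
          (S.+-congʳ {S.- Y} (zⁿyⁿ≋1 p))

        Y[Z+1]≋ : Y S.* (Z S.+ S.1#) ≋ S.1# S.+ Y
        Y[Z+1]≋ = S.trans (S.solve 2 (λ Z Y → Y S.:* (Z S.:+ S.con (+ 1)) S.:= Z S.:* Y S.:+ Y) S.refl Z Y)
          (S.+-congʳ {Y} (zⁿyⁿ≋1 p))

        -- Z + Y - 2 = Y (Z - 1)², and in the companion below Z - Y = Y (Z - 1) (Z + 1): one factor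
        -- Z - 1 clears the denominator of `F`.
        F[Z+Y-2]≋ : F S.* (Z S.+ Y S.- (S.1# S.+ S.1#)) ≋ c S.* w S.* (S.1# S.- Y)
        F[Z+Y-2]≋ = S.trans
          (S.solve 3 (λ F Z Y → F S.:* (Z S.:+ Y S.:- S.con (+ 2))
             S.:= (Z S.:- S.con (+ 1)) S.:* F S.:* (Y S.:* (Z S.:- S.con (+ 1)))
               S.:- F S.:* ((Z S.:- S.con (+ 2)) S.:* (Z S.:* Y S.:- S.con (+ 1)))) S.refl F Z Y)
          (S.trans (S.+-cong (S.*-cong (S.sym cw≋[z^p-1]F) Y[Z-1]≋)
              (S.-‿cong (S.*-congˡ {F} (S.trans (S.*-congˡ {Z S.- (S.1# S.+ S.1#)} (S.x≈y⇒x∙y⁻¹≈ε {Z S.* Y} {S.1#} (zⁿyⁿ≋1 p)))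
                (S.zeroʳ (Z S.- (S.1# S.+ S.1#)))))))
            (S.solve 2 (λ a F → a S.:- F S.:* S.con (+ 0) S.:= a) S.refl (c S.* w S.* (S.1# S.- Y)) F))

        F[Z-Y]≋ : F S.* (Z S.- Y) ≋ c S.* w S.* (S.1# S.+ Y)
        F[Z-Y]≋ = S.trans
          (S.solve 3 (λ F Z Y → F S.:* (Z S.:- Y)
             S.:= (Z S.:- S.con (+ 1)) S.:* F S.:* (Y S.:* (Z S.:+ S.con (+ 1)))
               S.:- F S.:* (Z S.:* (Z S.:* Y S.:- S.con (+ 1)))) S.refl F Z Y)
          (S.trans (S.+-cong (S.*-cong (S.sym cw≋[z^p-1]F) Y[Z+1]≋)
              (S.-‿cong (S.*-congˡ {F} (S.trans (S.*-congˡ {Z} (S.x≈y⇒x∙y⁻¹≈ε {Z S.* Y} {S.1#} (zⁿyⁿ≋1 p)))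
                (S.zeroʳ Z)))))
            (S.solve 2 (λ a F → a S.:- F S.:* S.con (+ 0) S.:= a) S.refl (c S.* w S.* (S.1# S.+ Y)) F))

        cw-cancel : ∀ {f g} → c S.* w S.* f ≋ c S.* w S.* g → f ≋ g
        cw-cancel {f} {g} cwf≋cwg = w-cancel (S.*-cancelˡ-unit {c} {κ (∏ v ks)} c∏v≋1
          (S.trans (S.sym (S.*-assoc c w f)) (S.trans cwf≋cwg (S.*-assoc c w g))))

        -- Multiplication by (c w)² turns `P` and `Q` into combinations of powers of z and y; `F`
        -- then absorbs their factor z^p - 1 and returns one c w, which is cancelled.
        cwG≋ : ∀ t → c S.* w S.* G t ≋ z S.^ t S.* (A t S.* (S.1# S.- Y) S.- c S.* w S.* (S.1# S.+ Y))
        cwG≋ t = cw-cancel (≋.begin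
          c S.* w S.* (c S.* w S.* G t)
            ≋.≈⟨ S.solve 9 (λ c w F zt y A P b Q → c S.:* w S.:* (c S.:* w S.:* (F S.:* (zt S.:* y S.:* (A S.:* P S.:- b S.:* Q))))
                 S.:= F S.:* (zt S.:* y S.:* (A S.:* (c S.:* c S.:* (w S.:* w S.:* P)) S.:- c S.:* w S.:* (b S.:* w S.:* (c S.:* Q)))))
                 S.refl c w F zt y (A t) P (S.1# S.+ z) Q ⟩
          F S.* (zt S.* y S.* (A t S.* (c S.* c S.* (w S.* w S.* P)) S.- c S.* w S.* ((S.1# S.+ z) S.* w S.* (c S.* Q))))
            ≋.≈⟨ S.*-congˡ {F} (S.*-congˡ {zt S.* y} (S.+-cong (S.*-congˡ {A t} c²w²P≋) (S.-‿cong (S.*-congˡ {c S.* w} [1+z]wcQ≋)))) ⟩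
          F S.* (zt S.* y S.* (A t S.* (z S.* (Z S.+ Y S.- (S.1# S.+ S.1#))) S.- c S.* w S.* (z S.* (Z S.- Y))))
            ≋.≈⟨ S.solve 8 (λ F zt y A z r cw s → F S.:* (zt S.:* y S.:* (A S.:* (z S.:* r) S.:- cw S.:* (z S.:* s)))
                 S.:= (z S.:* y) S.:* (zt S.:* (A S.:* (F S.:* r) S.:- cw S.:* (F S.:* s))))
                 S.refl F zt y (A t) z (Z S.+ Y S.- (S.1# S.+ S.1#)) (c S.* w) (Z S.- Y) ⟩
          (z S.* y) S.* (zt S.* (A t S.* (F S.* (Z S.+ Y S.- (S.1# S.+ S.1#))) S.- c S.* w S.* (F S.* (Z S.- Y))))
            ≋.≈⟨ S.*-cong z⊗y (S.*-congˡ {zt} (S.+-cong (S.*-congˡ {A t} F[Z+Y-2]≋) (S.-‿cong (S.*-congˡ {c S.* w} F[Z-Y]≋)))) ⟩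
          S.1# S.* (zt S.* (A t S.* (c S.* w S.* (S.1# S.- Y)) S.- c S.* w S.* (c S.* w S.* (S.1# S.+ Y))))
            ≋.≈⟨ S.solve 5 (λ zt A cw r s → S.con (+ 1) S.:* (zt S.:* (A S.:* (cw S.:* r) S.:- cw S.:* (cw S.:* s)))
                 S.:= cw S.:* (zt S.:* (A S.:* r S.:- cw S.:* s)))
                 S.refl zt (A t) (c S.* w) (S.1# S.- Y) (S.1# S.+ Y) ⟩
          c S.* w S.* (zt S.* (A t S.* (S.1# S.- Y) S.- c S.* w S.* (S.1# S.+ Y))) ≋.∎)
          where zt = z S.^ t

        -- With p = m + t + 1 the products z^t y^p and z^(t+1) y^p are y^(m+1) and y^m. The
        -- multiplier of y^m is written m + (2t + 1) to fit `y^m-θ′` in degree 2t + 1.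
        cwG-expanded : ∀ t m → p ≡ m ℕ.+ suc t → c S.* w S.* G t ≋
          S.cast (suc t ℕ.+ p) S.* z S.^ t S.+ (S.cast t S.* z S.^ suc t S.- S.cast p S.* z S.^ suc t)
            S.+ (S.cast m S.* y S.^ suc m S.- S.cast (m ℕ.+ suc (t ℕ.+ t)) S.* y S.^ m)
        cwG-expanded t m p≡m+1+t = S.trans (cwG≋ t) (S.trans
          (S.solve 5 (λ a′ w zt Y c → let one = S.con (+ 1); a = one S.:+ a′; z = one S.:+ w in
              zt S.:* ((a S.:* (one S.:+ z) S.:- z) S.:* (one S.:- Y) S.:- c S.:* w S.:* (one S.:+ Y))
              S.:= (a S.:+ c) S.:* zt S.:+ (a′ S.:* (z S.:* zt) S.:- c S.:* (z S.:* zt))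
                S.:+ ((c S.:- a) S.:* (zt S.:* Y) S.:- (a′ S.:+ c) S.:* (z S.:* (zt S.:* Y))))
            S.refl (S.cast t) w (z S.^ t) Y c)
          (S.+-cong (S.+-congʳ {S.cast t S.* z S.^ suc t S.- S.cast p S.* z S.^ suc t}
              (S.*-congʳ {z S.^ t} (S.sym (S.cast-+ (suc t) p))))
            (S.+-cong (S.*-cong c-a≋m zᵗY≋) (S.-‿cong (S.*-cong t+c≋ (S.trans (S.*-congˡ {z} zᵗY≋) zyᵐ⁺¹≋))))))
          where
          c≋ : c ≋ S.cast m S.+ S.cast (suc t)
          c≋ = S.trans (S.cast-cong p≡m+1+t) (S.cast-+ m (suc t))
          c-a≋m : c S.- S.cast (suc t) ≋ S.cast m
          c-a≋m = S.trans (S.+-congʳ {S.- S.cast (suc t)} c≋)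
            (S.solve 2 (λ a m → m S.:+ a S.:- a S.:= m) S.refl (S.cast (suc t)) (S.cast m))
          t+c≋ : S.cast t S.+ c ≋ S.cast (m ℕ.+ suc (t ℕ.+ t))
          t+c≋ = S.trans (S.sym (S.cast-+ t p)) (S.cast-cong (≡.trans (≡.cong (t ℕ.+_) p≡m+1+t) (rearrange t m)))
            where
            rearrange : ∀ t m → t ℕ.+ (m ℕ.+ suc t) ≡ m ℕ.+ suc (t ℕ.+ t)
            rearrange = ℕ.solve-∀
          zᵗY≋ : z S.^ t S.* Y ≋ y S.^ suc m
          zᵗY≋ = S.trans (S.*-congˡ {z S.^ t} (S.trans
              (S.reflexive (≡.cong (y S.^_) (≡.trans p≡m+1+t (≡.trans (ℕ.+-suc m t) (ℕ.+-comm (suc m) t)))))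
              (S.^-homo-* y t (suc m))))
            (S.trans (S.sym (S.*-assoc (z S.^ t) (y S.^ t) (y S.^ suc m)))
              (S.trans (S.*-congʳ {y S.^ suc m} (zⁿyⁿ≋1 t)) (S.*-identityˡ (y S.^ suc m))))
          zyᵐ⁺¹≋ : z S.* y S.^ suc m ≋ y S.^ m
          zyᵐ⁺¹≋ = S.trans (S.sym (S.*-assoc z y (y S.^ m)))
            (S.trans (S.*-congʳ {y S.^ m} z⊗y) (S.*-identityˡ (y S.^ m)))

        -- The factor w raises the degree to 2t + 1. For t > 0 this lies beyond the polynomials z^t
        -- and z^(t+1), and the two y-terms cancel by `y^m-θ′`.
        G-coefficient : ∀ t → 0 < t → t < p → G t (t ℕ.+ t) ≈ 0#
        G-coefficient t 0<t t<p = *-cancelˡ-unit p-unit (begin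
          cast p * G t (t ℕ.+ t)
            ≈⟨ cast⊗ p (G t) (t ℕ.+ t) ⟨
          (c ⊗ G t) (t ℕ.+ t)
            ≈⟨ w⊗-suc (c ⊗ G t) (t ℕ.+ t) ⟨
          (w ⊗ (c ⊗ G t)) n
            ≈⟨ S.solve 3 (λ w c G → w S.:* (c S.:* G) S.:= c S.:* w S.:* G) S.refl w c (G t) n ⟩
          (c ⊗ w ⊗ G t) n
            ≈⟨ cwG-expanded t m p≡ n ⟩
          (S.cast (suc t ℕ.+ p) ⊗ z S.^ t) n + ((S.cast t ⊗ z S.^ suc t) n - (S.cast p ⊗ z S.^ suc t) n)
            + ((S.cast m ⊗ y S.^ suc m) n - (S.cast (m ℕ.+ n) ⊗ y S.^ m) n)
            ≈⟨ +-cong (+-cong (cast⊗ (suc t ℕ.+ p) (z S.^ t) n)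
                 (+-cong (cast⊗ t (z S.^ suc t) n) (-‿cong (cast⊗ p (z S.^ suc t) n))))
                 (+-cong (cast⊗ m (y S.^ suc m) n) (-‿cong (trans (cast⊗ (m ℕ.+ n) (y S.^ m) n)
                   (trans (*-congʳ (cast-+ m n)) (y^m-θ′ m n))))) ⟩
          cast (suc t ℕ.+ p) * (z S.^ t) n + (cast t * (z S.^ suc t) n - cast p * (z S.^ suc t) n)
            + (cast m * (y S.^ suc m) n - cast m * (y S.^ suc m) n)
            ≈⟨ +-cong (+-cong (*-congˡ (zᵏ-high t t<n)) (+-cong (*-congˡ (zᵏ-high (suc t) (s<s t<t+t)))
                 (-‿cong (*-congˡ (zᵏ-high (suc t) (s<s t<t+t)))))) (-‿inverseʳ _) ⟩
          cast (suc t ℕ.+ p) * 0# + (cast t * 0# - cast p * 0#) + 0#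
            ≈⟨ solve 3 (λ a b c → a :* con (+ 0) :+ (b :* con (+ 0) :- c :* con (+ 0)) :+ con (+ 0) := c :* con (+ 0)) refl _ _ _ ⟩
          cast p * 0# ∎)
          where
          n = suc (t ℕ.+ t)
          m = p ∸ suc t
          p≡ : p ≡ m ℕ.+ suc t
          p≡ = ≡.sym (ℕ.m∸n+n≡m t<p)
          t<t+t : t < t ℕ.+ t
          t<t+t = ℕ.m<m+n t 0<t
          t<n : t < n
          t<n = s≤s (ℕ.m≤m+n t t)
          zᵏ-high : ∀ k → k < n → (z S.^ k) n ≈ 0#
          zᵏ-high k k<n = trans (z^k-coefficient k n) (cast-cong (k>n⇒nCk≡0 k<n))

        F₀≈1 : F 0 ≈ 1#
        F₀≈1 = *-cancelˡ-unit p-unit (begin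
          cast p * F 0                                        ≈⟨ *-congʳ z^p-1-linear ⟨
          (Z S.- S.1#) 1 * F 0                                ≈⟨ +-identityˡ _ ⟨
          0# + (Z S.- S.1#) 1 * F 0                           ≈⟨ +-congʳ (trans (*-congʳ z^p-1-constant) (zeroˡ (F 1))) ⟨
          ((Z S.- S.1#) ⊗ F) 1                                ≈⟨ cw≋[z^p-1]F 1 ⟨
          (c ⊗ w) 1                                           ≈⟨ cast⊗ p w 1 ⟩
          cast p * 1#                                         ∎)

        -- Degree 0 is computed directly: there z^(t+1) does reach degree 2t + 1, and the product is
        -- 1 instead of 0.
        εT-product : ∀ t → t < p → (ε ⊗ T) t ≈ S.1# t
        εT-product zero    _   = begin
          1# * - (F 0 * (1# * 1# * (0# * (1# + (1# + 0#)) - (1# + 0#))))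
            ≈⟨ solve 1 (λ f → con (+ 1) :* :- (f :* (con (+ 1) :* con (+ 1)
                 :* (con (+ 0) :* (con (+ 1) :+ (con (+ 1) :+ con (+ 0))) :- (con (+ 1) :+ con (+ 0))))) := f) refl (F 0) ⟩
          F 0  ≈⟨ F₀≈1 ⟩
          1#   ∎
        εT-product t@(suc _) t<p = begin
          (ε ⊗ T) t                                   ≈⟨ ⊗-∑ ε T t ⟩
          ∑< (suc t) (λ i → ε i * T (t ∸ i))          ≈⟨ ∑-cong (suc t) (λ i i≤t → summand i (ℕ.s≤s⁻¹ i≤t)) ⟩
          ∑< (suc t) (λ i → - 1# * K t i (t ℕ.+ t))   ≈⟨ ∑-*ˡ (suc t) (- 1#) (λ i → K t i (t ℕ.+ t)) ⟩
          - 1# * ∑< (suc t) (λ i → K t i (t ℕ.+ t))   ≈⟨ *-congˡ (∑-truncate (s≤s (ℕ.<⇒≤ t<p)) (λ i t<i → K-low t i t<i)) ⟨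
          - 1# * ∑< N (λ i → K t i (t ℕ.+ t))         ≈⟨ *-congˡ (∑-coefficient N (K t) (t ℕ.+ t)) ⟨
          - 1# * S.∑< N (K t) (t ℕ.+ t)               ≈⟨ *-congˡ (trans (∑K≋G t (t ℕ.+ t)) (G-coefficient t z<s t<p)) ⟩
          - 1# * 0#                                   ≈⟨ zeroʳ _ ⟩
          0#                                          ∎
          where
          summand : ∀ i → i ≤ t → ε i * T (t ∸ i) ≈ - 1# * K t i (t ℕ.+ t)
          summand i i≤t = trans (εT≈ i (t ∸ i)) (trans
            (reflexive (≡.cong (λ s → - K s i (s ℕ.+ s)) (ℕ.m+[n∸m]≡n i≤t)))
            (solve 1 (λ k → :- k := :- con (+ 1) :* k) refl _))

        -- Uniqueness of the inverse of ε. `T` is known to be one only in degrees below p, hence the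
        -- bounded congruence.
        complete≈T : ∀ t → t < p → complete u ks t ≈ T t
        complete≈T t t<p = begin
          η t                  ≈⟨ S.*-identityʳ η t ⟨
          (η ⊗ S.1#) t         ≈⟨ ⊗-cong-≤ t (λ _ _ → refl) (λ i i≤t → εT-product i (ℕ.≤-<-trans i≤t t<p)) ⟨
          (η ⊗ (ε ⊗ T)) t      ≈⟨ S.solve 3 (λ H e T → H S.:* (e S.:* T) S.:= e S.:* H S.:* T) S.refl η ε T t ⟩
          (ε ⊗ η ⊗ T) t        ≈⟨ S.*-congʳ {T} (elementary-complete u ks) t ⟩
          (S.1# ⊗ T) t         ≈⟨ S.*-identityˡ T t ⟩
          T t                  ∎
          where
          η = complete u ks

      complete≈ : ∀ t → suc t < p → complete u ks (suc t) ≈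
        - ∑< (suc (suc t)) (λ i → cast (suc t ℕ.* (t C i) ℕ.+ t ℕ.* (suc t C i)) * F (suc t ℕ.+ suc t ∸ i))
      complete≈ t t<p = trans (complete≈T (suc t) t<p) (-‿cong (begin
        h (suc t) n                                    ≈⟨ h≋ n ⟩
        (W ⊗ F) n                                      ≈⟨ ⊗-∑-supported (suc (suc t)) W F n (s≤s (ℕ.m≤m+n (suc t) (suc t))) W-high ⟩
        ∑< (suc (suc t)) (λ i → W i * F (n ∸ i))       ≈⟨ ∑-cong (suc (suc t)) (λ i _ → *-congʳ {F (n ∸ i)} (W≈ i)) ⟩
        ∑< (suc (suc t)) (λ i → cast (suc t ℕ.* (t C i) ℕ.+ t ℕ.* (suc t C i)) * F (n ∸ i)) ∎))
        where
        n = suc t ℕ.+ suc t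
        W : Series
        W = S.cast (suc t) S.* z S.^ t S.+ S.cast t S.* z S.^ suc t
        h≋ : h (suc t) ≋ W S.* F
        h≋ = S.trans
          (S.solve 5 (λ F z zt y t → let a = S.con (+ 1) S.:+ t in
             F S.:* (z S.:* zt S.:* y S.:* (a S.:* (S.con (+ 1) S.:+ z) S.:- z))
             S.:= (z S.:* y) S.:* ((a S.:* zt S.:+ t S.:* (z S.:* zt)) S.:* F)) S.refl F z (z S.^ t) y (S.cast t))
          (S.trans (S.*-congʳ {W S.* F} z⊗y) (S.*-identityˡ (W S.* F)))
        W≈ : ∀ i → W i ≈ cast (suc t ℕ.* (t C i) ℕ.+ t ℕ.* (suc t C i))
        W≈ i = trans
          (+-cong (trans (cast⊗ (suc t) (z S.^ t) i) (trans (*-congˡ (z^k-coefficient t i)) (sym (cast-* (suc t) (t C i)))))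
            (trans (cast⊗ t (z S.^ suc t) i) (trans (*-congˡ (z^k-coefficient (suc t) i)) (sym (cast-* t (suc t C i))))))
          (sym (cast-+ (suc t ℕ.* (t C i)) (t ℕ.* (suc t C i))))
        W-high : ∀ i → suc (suc t) ≤ i → W i ≈ 0#
        W-high i t<i = trans (W≈ i) (cast-cong (≡.cong₂ (λ a b → suc t ℕ.* a ℕ.+ t ℕ.* b)
          (k>n⇒nCk≡0 {t} {i} (ℕ.<-trans (ℕ.n<1+n t) t<i)) (k>n⇒nCk≡0 {suc t} {i} t<i)
          ⟨ ≡.trans ⟩ ≡.cong₂ ℕ._+_ (ℕ.*-zeroʳ (suc t)) (ℕ.*-zeroʳ t)))

    -- Reflection k ↦ p - k of the multiple sums

    δ : Carrier
    δ = 1# - ζ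

    -- The value of `term s k` at q = ζ, since 1 / [k]q = (1 - q) / (1 - q^k).
    τ : ℕ → ℕ → Carrier
    τ s k = ζ ^ (ℕ.pred s ℕ.* k) * (δ * v k) ^ s

    τ₂≈ : ∀ k → τ 2 k ≈ δ * δ * u k
    τ₂≈ k = trans (*-congʳ (reflexive (≡.cong (ζ ^_) (ℕ.*-identityˡ k))))
      (solve 3 (λ r d a → r :* (d :* a :* (d :* a :* con (+ 1))) := d :* d :* (r :* a :* a)) refl (ζ ^ k) δ (v k))

    τ₃≈ : ∀ k → τ 3 k ≈ δ * δ * δ * (ζ ^ k * v k * u k)
    τ₃≈ k = trans (*-congʳ (trans (^-homo-* ζ k (1 ℕ.* k)) (*-congˡ (reflexive (≡.cong (ζ ^_) (ℕ.*-identityˡ k))))))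
      (solve 3 (λ r d a → r :* r :* (d :* a :* (d :* a :* (d :* a :* con (+ 1))))
         := d :* d :* d :* (r :* a :* (r :* a :* a))) refl (ζ ^ k) δ (v k))

    u-reflect : ∀ k → k ∈ ks → u (p ∸ k) ≈ u k
    u-reflect k k∈ks = begin
      s * v (p ∸ k) * v (p ∸ k)   ≈⟨ *-cong (*-congˡ (v-reflect k∈ks)) (v-reflect k∈ks) ⟩
      s * - (r * a) * - (r * a)   ≈⟨ solve 3 (λ r s a → s :* :- (r :* a) :* :- (r :* a) := (r :* s) :* (r :* a :* a)) refl r s a ⟩
      (r * s) * (r * a * a)       ≈⟨ trans (*-congʳ (ζ^k*ζ^[p-k]≈1 (ℕ.<⇒≤ (proj₂ (∈-range 1 p′ k∈ks))))) (*-identityˡ _) ⟩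
      u k                         ∎
      where
      r = ζ ^ k
      s = ζ ^ (p ∸ k)
      a = v k

    τ₂-reflect : ∀ k → k ∈ ks → τ 2 (p ∸ k) ≈ τ 2 k
    τ₂-reflect k k∈ks = trans (τ₂≈ (p ∸ k)) (trans (*-congˡ (u-reflect k k∈ks)) (sym (τ₂≈ k)))

    -- Reflection turns q^(2k) / (1 - q^k)³ into - q^k / (1 - q^k)³, so the cubes cancel down to a square.
    τ₃-reflect : ∀ k → k ∈ ks → τ 3 (p ∸ k) + τ 3 k ≈ - δ * τ 2 k
    τ₃-reflect k k∈ks = begin
      τ 3 (p ∸ k) + τ 3 k
        ≈⟨ +-cong (trans (τ₃≈ (p ∸ k)) (*-congˡ (*-cong (*-congˡ (v-reflect k∈ks)) (u-reflect k k∈ks)))) (τ₃≈ k) ⟩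
      δ * δ * δ * (s * - (r * a) * U) + δ * δ * δ * (r * a * U)
        ≈⟨ solve 5 (λ d r s a U → d :* d :* d :* (s :* :- (r :* a) :* U) :+ d :* d :* d :* (r :* a :* U)
             := :- (d :* d :* d :* a :* U) :* (r :* s :- r)) refl δ r s a U ⟩
      - (δ * δ * δ * a * U) * (r * s - r)
        ≈⟨ *-congˡ (+-congʳ (ζ^k*ζ^[p-k]≈1 (ℕ.<⇒≤ (proj₂ (∈-range 1 p′ k∈ks))))) ⟩
      - (δ * δ * δ * a * U) * (1# - r)
        ≈⟨ solve 4 (λ d r a U → :- (d :* d :* d :* a :* U) :* (con (+ 1) :- r)
             := :- d :* (d :* d :* U) :* ((con (+ 1) :- r) :* a)) refl δ r a U ⟩
      - δ * (δ * δ * U) * ((1# - r) * a)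
        ≈⟨ trans (*-congˡ (v-inverse k (proj₁ (∈-range 1 p′ k∈ks)) (proj₂ (∈-range 1 p′ k∈ks)))) (*-identityʳ _) ⟩
      - δ * (δ * δ * U)
        ≈⟨ *-congˡ (τ₂≈ k) ⟨
      - δ * τ 2 k ∎
      where
      r = ζ ^ k
      s = ζ ^ (p ∸ k)
      a = v k
      U = u k

    2ᵃ32ᵇ : ℕ → ℕ → List ℕ
    2ᵃ32ᵇ a b = replicate a 2 ++ 3 ∷ replicate b 2

    -- M stands for M< and M≤.
    module Reflection (M : List (ℕ → Carrier) → List ℕ → Carrier)
      (M-cong : ∀ {fs gs} xs → Pointwise (_≗[ xs ]_) fs gs → M fs xs ≈ M gs xs)
      (M-reverse : ∀ fs xs → M (reverse fs) (reverse xs) ≈ M fs xs)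
      (M-map : ∀ (φ : ℕ → ℕ) fs xs → M fs (map φ xs) ≈ M (map (_∘ φ) fs) xs)
      (M-additive : ∀ fs g h gs xs →
        M (fs ++ g ∷ gs) xs + M (fs ++ h ∷ gs) xs ≈ M (fs ++ (λ x → g x + h x) ∷ gs) xs)
      (M-scale : ∀ fs c g gs xs → M (fs ++ (λ x → c * g x) ∷ gs) xs ≈ c * M (fs ++ g ∷ gs) xs)
      (M-homogeneous : ∀ n c f xs → M (replicate n (λ x → c * f x)) xs ≈ c ^ n * M (replicate n f) xs)
      where
      private
        fs : (ℕ → Carrier) → (ℕ → Carrier) → ℕ → ℕ → List (ℕ → Carrier)
        fs f g a b = replicate a f ++ g ∷ replicate b f

        reverse-fs : ∀ f g a b → reverse (fs f g a b) ≡ fs f g b a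
        reverse-fs f g a b = ≡.trans (reverse-++ (replicate a f) (g ∷ replicate b f))
          (≡.trans (≡.cong₂ _++_ (≡.trans (unfold-reverse g (replicate b f)) (≡.cong (_∷ʳ g) (reverse-replicate b f)))
                                 (reverse-replicate a f))
            (∷ʳ-++ (replicate b f) g (replicate a f)))

        map-fs : ∀ {A : Set} (φ : A → ℕ → Carrier) (x y : A) a b →
                 map φ (replicate a x ++ y ∷ replicate b x) ≡ fs (φ x) (φ y) a b
        map-fs φ x y a b = ≡.trans (map-++ φ (replicate a x) (y ∷ replicate b x))
          (≡.cong₂ _++_ (map-replicate φ a x) (≡.cong (φ y ∷_) (map-replicate φ b x)))

        fs-cong : ∀ {f f′ g g′} a b → f ≗[ ks ] f′ → g ≗[ ks ] g′ → M (fs f g a b) ks ≈ M (fs f′ g′ a b) ks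
        fs-cong a b f≗f′ g≗g′ = M-cong ks (++⁺ (replicate⁺ f≗f′ a) (g≗g′ ∷ replicate⁺ f≗f′ b))

        -- Reversing factors and positions together exchanges the two blocks of 2's and sends k to p
        -- - k. Only the factor of weight 3 notices, `τ 2` being invariant.
        fs-reflect : ∀ a b → M (fs (τ 2) (τ 3) a b) ks ≈ M (fs (τ 2) (τ 3 ∘ (p ∸_)) b a) ks
        fs-reflect a b = begin
          M (fs (τ 2) (τ 3) a b) ks
            ≈⟨ M-reverse (fs (τ 2) (τ 3) a b) ks ⟨
          M (reverse (fs (τ 2) (τ 3) a b)) (reverse ks)
            ≡⟨ ≡.cong₂ M (reverse-fs (τ 2) (τ 3) a b) (reverse-range p′) ⟩
          M (fs (τ 2) (τ 3) b a) (map (p ∸_) ks)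
            ≈⟨ M-map (p ∸_) (fs (τ 2) (τ 3) b a) ks ⟩
          M (map (_∘ (p ∸_)) (fs (τ 2) (τ 3) b a)) ks
            ≡⟨ ≡.cong (λ gs → M gs ks) (map-fs (_∘ (p ∸_)) (τ 2) (τ 3) b a) ⟩
          M (fs (τ 2 ∘ (p ∸_)) (τ 3 ∘ (p ∸_)) b a) ks
            ≈⟨ fs-cong b a τ₂-reflect (λ _ _ → refl) ⟩
          M (fs (τ 2) (τ 3 ∘ (p ∸_)) b a) ks ∎

        replicate-fs : ∀ f a b → fs f f b a ≡ replicate (a ℕ.+ b ℕ.+ 1) f
        replicate-fs f a b = ≡.trans (++-replicate b (suc a)) (≡.cong (λ n → replicate n f) (rearrange a b))
          where
          ++-replicate : ∀ m n → replicate m f ++ replicate n f ≡ replicate (m ℕ.+ n) f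
          ++-replicate zero    n = ≡.refl
          ++-replicate (suc m) n = ≡.cong (f ∷_) (++-replicate m n)
          rearrange : ∀ a b → b ℕ.+ suc a ≡ a ℕ.+ b ℕ.+ 1
          rearrange = ℕ.solve-∀

      -- The exponent 2t + 1 counts one δ from merging the weight-3 slots and δ² from each of the t
      -- factors of weight 2 that result.
      symmetric-sum : ∀ a b → let t = a ℕ.+ b ℕ.+ 1 in
        M (map τ (2ᵃ32ᵇ a b)) ks + M (map τ (2ᵃ32ᵇ b a)) ks ≈ - (δ ^ (2 ℕ.* t ℕ.+ 1)) * M (replicate t u) ks
      symmetric-sum a b = begin
        M (map τ (2ᵃ32ᵇ a b)) ks + M (map τ (2ᵃ32ᵇ b a)) ks
          ≡⟨ ≡.cong₂ (λ gs hs → M gs ks + M hs ks) (map-fs τ 2 3 a b) (map-fs τ 2 3 b a) ⟩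
        M (fs (τ 2) (τ 3) a b) ks + M (fs (τ 2) (τ 3) b a) ks
          ≈⟨ +-congʳ (fs-reflect a b) ⟩
        M (fs (τ 2) (τ 3 ∘ (p ∸_)) b a) ks + M (fs (τ 2) (τ 3) b a) ks
          ≈⟨ M-additive (replicate b (τ 2)) (τ 3 ∘ (p ∸_)) (τ 3) (replicate a (τ 2)) ks ⟩
        M (fs (τ 2) (λ k → τ 3 (p ∸ k) + τ 3 k) b a) ks
          ≈⟨ fs-cong b a (λ _ _ → refl) τ₃-reflect ⟩
        M (fs (τ 2) (λ k → - δ * τ 2 k) b a) ks
          ≈⟨ M-scale (replicate b (τ 2)) (- δ) (τ 2) (replicate a (τ 2)) ks ⟩
        - δ * M (fs (τ 2) (τ 2) b a) ks
          ≈⟨ *-congˡ (fs-cong b a (λ k _ → τ₂≈ k) (λ k _ → τ₂≈ k)) ⟩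
        - δ * M (fs (λ k → δ * δ * u k) (λ k → δ * δ * u k) b a) ks
          ≡⟨ ≡.cong (λ gs → - δ * M gs ks) (replicate-fs (λ k → δ * δ * u k) a b) ⟩
        - δ * M (replicate t (λ k → δ * δ * u k)) ks
          ≈⟨ *-congˡ (M-homogeneous t (δ * δ) u ks) ⟩
        - δ * ((δ * δ) ^ t * M (replicate t u) ks)
          ≈⟨ solve 3 (λ d D m → :- d :* (D :* m) := :- (D :* (d :* con (+ 1))) :* m) refl δ ((δ * δ) ^ t) _ ⟩
        - ((δ * δ) ^ t * δ ^ 1) * M (replicate t u) ks
          ≈⟨ *-congʳ (-‿cong (*-congʳ (trans (^-congˡ t (*-congˡ (sym (*-identityʳ δ)))) (^-assocʳ δ 2 t)))) ⟩
        - (δ ^ (2 ℕ.* t) * δ ^ 1) * M (replicate t u) ks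
          ≈⟨ *-congʳ (-‿cong (^-homo-* δ (2 ℕ.* t) 1)) ⟨
        - (δ ^ (2 ℕ.* t ℕ.+ 1)) * M (replicate t u) ks ∎
        where
        t = a ℕ.+ b ℕ.+ 1

    module H-reflection = Reflection M< M<-cong M<-reverse M<-map M<-additive M<-scale M<-homogeneous
    module S-reflection = Reflection M≤ M≤-cong M≤-reverse M≤-map M≤-additive M≤-scale M≤-homogeneous

    -- The denominator p (t + 1) is multiplied out, as the ring need not allow division. The sign
    -- (-1)^t turns the signed `ε t` into the plain elementary function.
    H-symmetric : ∀ a b → let t = a ℕ.+ b ℕ.+ 1 in
      cast (p ℕ.* suc t) * (M< (map τ (2ᵃ32ᵇ a b)) ks + M< (map τ (2ᵃ32ᵇ b a)) ks)
        ≈ - ((- 1#) ^ t * cast ((p ℕ.+ t) C suc (t ℕ.+ t))) * δ ^ (2 ℕ.* t ℕ.+ 1)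
    H-symmetric a b = begin
      cast (p ℕ.* suc t) * (M< (map τ (2ᵃ32ᵇ a b)) ks + M< (map τ (2ᵃ32ᵇ b a)) ks)
        ≈⟨ *-cong (cast-* p (suc t)) (H-reflection.symmetric-sum a b) ⟩
      cast p * cast (suc t) * (- (δ ^ (2 ℕ.* t ℕ.+ 1)) * M< (replicate t u) ks)
        ≈⟨ *-congˡ (*-congˡ (trans (M<-cong ks (replicate⁺ (λ k _ → double-negation (u k)) t))
             (M<-homogeneous t (- 1#) (λ k → - u k) ks))) ⟩
      cast p * cast (suc t) * (- (δ ^ (2 ℕ.* t ℕ.+ 1)) * ((- 1#) ^ t * ε t))
        ≈⟨ solve 5 (λ c t d s e → c :* t :* (:- d :* (s :* e)) := :- (s :* (c :* (t :* e))) :* d) refl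
             (cast p) (cast (suc t)) (δ ^ (2 ℕ.* t ℕ.+ 1)) ((- 1#) ^ t) (ε t) ⟩
      - ((- 1#) ^ t * (cast p * (cast (suc t) * ε t))) * δ ^ (2 ℕ.* t ℕ.+ 1)
        ≈⟨ *-congʳ (-‿cong (*-congˡ (p[1+j]ε≈ t))) ⟩
      - ((- 1#) ^ t * cast ((p ℕ.+ t) C suc (t ℕ.+ t))) * δ ^ (2 ℕ.* t ℕ.+ 1) ∎
      where
      t = a ℕ.+ b ℕ.+ 1
      double-negation : ∀ x → x ≈ - 1# * - x
      double-negation x = solve 1 (λ x → x := :- con (+ 1) :* :- x) refl x

    S-symmetric : ∀ (F : Series) → S.cast p S.* w ≋ (z S.^ p S.- S.1#) S.* F → ∀ a b → let t = a ℕ.+ b ℕ.+ 1 in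
      t < p → M≤ (map τ (2ᵃ32ᵇ a b)) ks + M≤ (map τ (2ᵃ32ᵇ b a)) ks
        ≈ δ ^ (2 ℕ.* t ℕ.+ 1) *
          ∑< (suc t) (λ i → cast (t ℕ.* ((t ∸ 1) C i) ℕ.+ (t ∸ 1) ℕ.* (t C i)) * F (2 ℕ.* t ∸ i))
    S-symmetric F cw≋ a b t<p = trans (S-reflection.symmetric-sum a b)
      (trans (*-congˡ (expand (a ℕ.+ b ℕ.+ 1) (≡.subst (0 <_) (ℕ.+-comm 1 (a ℕ.+ b)) z<s) t<p))
        (solve 2 (λ d m → :- d :* :- m := d :* m) refl _ _))
      where
      -- a + b + 1 does not reduce to a successor, so a general t > 0 is matched instead.
      expand : ∀ t → 0 < t → t < p → M≤ (replicate t u) ks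
        ≈ - ∑< (suc t) (λ i → cast (t ℕ.* ((t ∸ 1) C i) ℕ.+ (t ∸ 1) ℕ.* (t C i)) * F (2 ℕ.* t ∸ i))
      expand (suc t) _ t<p = trans (Star.complete≈ F cw≋ t t<p)
        (-‿cong (∑-cong (suc (suc t)) (λ i _ → *-congˡ {cast (suc t ℕ.* (t C i) ℕ.+ t ℕ.* (suc t C i))}
          (reflexive (≡.cong (λ n → F (suc t ℕ.+ n ∸ i)) (≡.sym (ℕ.+-identityʳ (suc t))))))))

-- Quotient of a commutative ring by a principal ideal

module Quotient (A : CommutativeRing 0ℓ 0ℓ) (m : CommutativeRing.Carrier A) where
  open Arithmetic A

  infix 4 _∼_
  infixr 4 _,_
  -- The carrier stays and only equality is coarsened. The cofactor is data, because the final
  -- congruence has to exhibit it.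
  record _∼_ (x y : Carrier) : Set where
    constructor _,_
    field
      quotient : Carrier
      equality : x - y ≈ quotient * m

  ≈⇒∼ : ∀ {x y} → x ≈ y → x ∼ y
  ≈⇒∼ x≈y = 0# , trans (x≈y⇒x∙y⁻¹≈ε x≈y) (sym (zeroˡ m))

  m∼0 : m ∼ 0#
  m∼0 = 1# , solve 1 (λ m → m :- con (+ 0) := con (+ 1) :* m) refl m

  ∼-sym : ∀ {x y} → x ∼ y → y ∼ x
  ∼-sym {x} {y} (h , eq) = - h ,
    trans (solve 2 (λ x y → y :- x := :- (x :- y)) refl x y) (trans (-‿cong eq) (-‿distribˡ-* h m))

  ∼-trans : ∀ {x y z} → x ∼ y → y ∼ z → x ∼ z
  ∼-trans {x} {y} {z} (h , eq) (k , eq′) = h + k ,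
    trans (solve 3 (λ x y z → x :- z := (x :- y) :+ (y :- z)) refl x y z)
      (trans (+-cong eq eq′) (sym (distribʳ m h k)))

  ∼-+ : ∀ {x x′ y y′} → x ∼ x′ → y ∼ y′ → x + y ∼ x′ + y′
  ∼-+ {x} {x′} {y} {y′} (h , eq) (k , eq′) = h + k ,
    trans (solve 4 (λ x x′ y y′ → (x :+ y) :- (x′ :+ y′) := (x :- x′) :+ (y :- y′)) refl x x′ y y′)
      (trans (+-cong eq eq′) (sym (distribʳ m h k)))

  ∼-* : ∀ {x x′ y y′} → x ∼ x′ → y ∼ y′ → x * y ∼ x′ * y′
  ∼-* {x} {x′} {y} {y′} (h , eq) (k , eq′) = h * y + x′ * k ,
    trans (solve 4 (λ x x′ y y′ → x :* y :- x′ :* y′ := (x :- x′) :* y :+ x′ :* (y :- y′)) refl x x′ y y′)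
      (trans (+-cong (*-congʳ eq) (*-congˡ eq′))
        (solve 5 (λ h y x k m → h :* m :* y :+ x :* (k :* m) := (h :* y :+ x :* k) :* m) refl h y x′ k m))

  ∼-neg : ∀ {x y} → x ∼ y → - x ∼ - y
  ∼-neg {x} {y} (h , eq) = - h ,
    trans (solve 2 (λ x y → :- x :- :- y := :- (x :- y)) refl x y) (trans (-‿cong eq) (-‿distribˡ-* h m))

  quotientRing : CommutativeRing 0ℓ 0ℓ
  quotientRing = record
    { Carrier = Carrier
    ; _≈_     = _∼_
    ; _+_     = _+_
    ; _*_     = _*_
    ; -_      = -_
    ; 0#      = 0#
    ; 1#      = 1#
    ; isCommutativeRing = record
      { isRing = record
        { +-isAbelianGroup = record
          { isGroup = record
            { isMonoid = record
              { isSemigroup = record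
                { isMagma = record
                  { isEquivalence = record { refl = ≈⇒∼ refl ; sym = ∼-sym ; trans = ∼-trans }
                  ; ∙-cong        = ∼-+
                  }
                ; assoc = λ x y z → ≈⇒∼ (+-assoc x y z)
                }
              ; identity = (λ x → ≈⇒∼ (+-identityˡ x)) , λ x → ≈⇒∼ (+-identityʳ x)
              }
            ; inverse = (λ x → ≈⇒∼ (-‿inverseˡ x)) , λ x → ≈⇒∼ (-‿inverseʳ x)
            ; ⁻¹-cong = ∼-neg
            }
          ; comm = λ x y → ≈⇒∼ (+-comm x y)
          }
        ; *-cong     = ∼-*
        ; *-assoc    = λ x y z → ≈⇒∼ (*-assoc x y z)
        ; *-identity = (λ x → ≈⇒∼ (*-identityˡ x)) , λ x → ≈⇒∼ (*-identityʳ x)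
        ; distrib    = (λ x y z → ≈⇒∼ (distribˡ x y z)) , λ x y z → ≈⇒∼ (distribʳ x y z)
        }
      ; *-comm = λ x y → ≈⇒∼ (*-comm x y)
      }
    }

-- Inverses of 1 - ζ^j at a root of 1 + x + ⋯ + x^(p-1)

module GeometricSums (R : CommutativeRing 0ℓ 0ℓ) where
  open Arithmetic R
  open import Relation.Binary.Reasoning.Setoid setoid

  geometric : Carrier → ℕ → Carrier
  geometric x zero    = 0#
  geometric x (suc n) = 1# + x * geometric x n

  [1-x]geometric : ∀ x n → (1# - x) * geometric x n ≈ 1# - x ^ n
  [1-x]geometric x zero    = trans (zeroʳ _) (sym (-‿inverseʳ 1#))
  [1-x]geometric x (suc n) = begin
    (1# - x) * (1# + x * geometric x n)
      ≈⟨ solve 2 (λ x g → (con (+ 1) :- x) :* (con (+ 1) :+ x :* g)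
           := (con (+ 1) :- x) :+ x :* ((con (+ 1) :- x) :* g)) refl x (geometric x n) ⟩
    (1# - x) + x * ((1# - x) * geometric x n)
      ≈⟨ +-congˡ (*-congˡ ([1-x]geometric x n)) ⟩
    (1# - x) + x * (1# - x ^ n)
      ≈⟨ solve 2 (λ x y → (con (+ 1) :- x) :+ x :* (con (+ 1) :- y) := con (+ 1) :- x :* y) refl x (x ^ n) ⟩
    1# - x ^ suc n ∎

  geometric-inverse : ∀ x n v → (1# - x ^ n) * v ≈ 1# → geometric x n * ((1# - x) * v) ≈ 1#
  geometric-inverse x n v eq = trans
    (solve 3 (λ g d v → g :* (d :* v) := d :* g :* v) refl (geometric x n) (1# - x) v)
    (trans (*-congʳ ([1-x]geometric x n)) eq)

  geometric-tail : ∀ x n → geometric x (suc n) ≈ geometric x n + x ^ n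
  geometric-tail x zero    = solve 1 (λ x → con (+ 1) :+ x :* con (+ 0) := con (+ 0) :+ con (+ 1)) refl x
  geometric-tail x (suc n) = trans (+-congˡ (*-congˡ (geometric-tail x n)))
    (solve 3 (λ x g y → con (+ 1) :+ x :* (g :+ y) := con (+ 1) :+ x :* g :+ x :* y) refl x _ _)

  -- Where `geometric x n` vanishes, 1 - x times this sum is n; dividing by n then inverts 1 - x.
  ∑geometric : Carrier → ℕ → Carrier
  ∑geometric x zero    = 0#
  ∑geometric x (suc n) = ∑geometric x n + geometric x n

  [1-x]∑geometric : ∀ x n → (1# - x) * ∑geometric x n ≈ cast n - geometric x n
  [1-x]∑geometric x zero    = trans (zeroʳ _) (sym (-‿inverseʳ 0#))
  [1-x]∑geometric x (suc n) = begin
    (1# - x) * (∑geometric x n + geometric x n)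
      ≈⟨ distribˡ _ _ _ ⟩
    (1# - x) * ∑geometric x n + (1# - x) * geometric x n
      ≈⟨ +-cong ([1-x]∑geometric x n) ([1-x]geometric x n) ⟩
    (cast n - geometric x n) + (1# - x ^ n)
      ≈⟨ solve 3 (λ c g y → (c :- g) :+ (con (+ 1) :- y) := con (+ 1) :+ c :- (g :+ y)) refl _ _ _ ⟩
    1# + cast n - (geometric x n + x ^ n)
      ≈⟨ +-congˡ (-‿cong (geometric-tail x n)) ⟨
    1# + cast n - geometric x (suc n) ∎

  module PrimeRoot (p : ℕ) (p-prime : Prime p) (ζ ϖ : Carrier)
    (Φ≈0 : geometric ζ p ≈ 0#) (ϖ-inverse : cast p * ϖ ≈ 1#) where

    ζ^p≈1 : ζ ^ p ≈ 1#
    ζ^p≈1 = begin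
      ζ ^ p                              ≈⟨ solve 1 (λ y → y := con (+ 1) :- (con (+ 1) :- y)) refl (ζ ^ p) ⟩
      1# - (1# - ζ ^ p)                  ≈⟨ +-congˡ (-‿cong ([1-x]geometric ζ p)) ⟨
      1# - (1# - ζ) * geometric ζ p      ≈⟨ +-congˡ (-‿cong (trans (*-congˡ Φ≈0) (zeroʳ _))) ⟩
      1# - 0#                            ≈⟨ trans (+-congˡ -0#≈0#) (+-identityʳ 1#) ⟩
      1#                                 ∎

    private
      v₁ : Carrier
      v₁ = ∑geometric ζ p * ϖ

      v₁-inverse : (1# - ζ) * v₁ ≈ 1#
      v₁-inverse = begin
        (1# - ζ) * (∑geometric ζ p * ϖ)  ≈⟨ *-assoc _ _ _ ⟨
        (1# - ζ) * ∑geometric ζ p * ϖ    ≈⟨ *-congʳ ([1-x]∑geometric ζ p) ⟩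
        (cast p - geometric ζ p) * ϖ     ≈⟨ *-congʳ (+-congˡ (trans (-‿cong Φ≈0) -0#≈0#)) ⟩
        (cast p + 0#) * ϖ                ≈⟨ trans (*-congʳ (+-identityʳ _)) ϖ-inverse ⟩
        1#                               ∎

      ζ^[kp]≈1 : ∀ k → ζ ^ (k ℕ.* p) ≈ 1#
      ζ^[kp]≈1 k = trans (reflexive (≡.cong (ζ ^_) (ℕ.*-comm k p)))
        (trans (sym (^-assocʳ ζ p k)) (trans (^-congˡ k ζ^p≈1) (1^n≈1 k)))

      -- 1 - ζ^j divides 1 - ζ^(jx), and Bézout makes the latter associate to 1 - ζ.
      invertible : ∀ j → .{{NonZero j}} → j < p → ∃ λ v → (1# - ζ ^ j) * v ≈ 1#
      invertible j j<p with coprime-Bézout (prime⇒coprime p-prime j<p)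
      ... | Bézout.-+ y x 1+yp≡xj = geometric (ζ ^ j) x * v₁ , (begin
        (1# - ζ ^ j) * (geometric (ζ ^ j) x * v₁)  ≈⟨ *-assoc _ _ _ ⟨
        (1# - ζ ^ j) * geometric (ζ ^ j) x * v₁    ≈⟨ *-congʳ ([1-x]geometric (ζ ^ j) x) ⟩
        (1# - (ζ ^ j) ^ x) * v₁                    ≈⟨ *-congʳ (+-congˡ (-‿cong [ζ^j]^x≈ζ)) ⟩
        (1# - ζ) * v₁                              ≈⟨ v₁-inverse ⟩
        1#                                         ∎)
        where
        [ζ^j]^x≈ζ : (ζ ^ j) ^ x ≈ ζ
        [ζ^j]^x≈ζ = trans (^-assocʳ ζ j x) (trans
          (reflexive (≡.cong (ζ ^_) (≡.trans (ℕ.*-comm j x) (≡.sym 1+yp≡xj))))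
          (trans (*-congˡ (ζ^[kp]≈1 y)) (*-identityʳ ζ)))
      -- Here ζ^(jx) is the inverse of ζ, and the factor - ζ comes from - ζ (1 - ζ^-1) = 1 - ζ.
      ... | Bézout.+- y x 1+xj≡yp = - ζ * geometric (ζ ^ j) x * v₁ , (begin
        (1# - ζ ^ j) * (- ζ * geometric (ζ ^ j) x * v₁)
          ≈⟨ solve 4 (λ a z g v → a :* (:- z :* g :* v) := :- z :* (a :* g) :* v) refl _ ζ _ v₁ ⟩
        - ζ * ((1# - ζ ^ j) * geometric (ζ ^ j) x) * v₁
          ≈⟨ *-congʳ (*-congˡ ([1-x]geometric (ζ ^ j) x)) ⟩
        - ζ * (1# - (ζ ^ j) ^ x) * v₁
          ≈⟨ *-congʳ (solve 2 (λ z y → :- z :* (con (+ 1) :- y) := z :* y :- z) refl ζ _) ⟩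
        (ζ * (ζ ^ j) ^ x - ζ) * v₁
          ≈⟨ *-congʳ (+-congʳ ζ[ζ^j]^x≈1) ⟩
        (1# - ζ) * v₁
          ≈⟨ v₁-inverse ⟩
        1# ∎)
        where
        ζ[ζ^j]^x≈1 : ζ * (ζ ^ j) ^ x ≈ 1#
        ζ[ζ^j]^x≈1 = trans (*-congˡ (^-assocʳ ζ j x)) (trans
          (reflexive (≡.cong (ζ ^_) (≡.trans (≡.cong suc (ℕ.*-comm j x)) 1+xj≡yp))) (ζ^[kp]≈1 y))

    -- Made total with the default `0#`, so that it can be passed as plain data together with ζ.
    v : ℕ → Carrier
    v zero      = 0#
    v j@(suc _) with j ℕ.<? p
    ... | yes j<p = proj₁ (invertible j j<p)
    ... | no  _   = 0#

    v-inverse : ∀ j → 0 < j → j < p → (1# - ζ ^ j) * v j ≈ 1#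
    v-inverse j@(suc _) _ j<p with j ℕ.<? p
    ... | yes j<p′ = proj₂ (invertible j j<p′)
    ... | no  j≮p  = contradiction j<p j≮p

-- Power series under a ring homomorphism

module SeriesMap (A B : CommutativeRing 0ℓ 0ℓ) (φ : CommutativeRing.Carrier A → CommutativeRing.Carrier B)
  (φ-isRingHomomorphism : IsRingHomomorphism (CommutativeRing.rawRing A) (CommutativeRing.rawRing B) φ) where
  private
    module A = Arithmetic A
    module B = Arithmetic B
    module PA = PowerSeries A
    module PB = PowerSeries B
  open IsRingHomomorphism φ-isRingHomomorphism

  cast-homo : ∀ n → φ (A.cast n) B.≈ B.cast n
  cast-homo zero    = 0#-homo
  cast-homo (suc n) = B.trans (+-homo A.1# (A.cast n)) (B.+-cong 1#-homo (cast-homo n))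

  ⊗-homo : ∀ f g n → φ ((f PA.⊗ g) n) B.≈ ((φ ∘ f) PB.⊗ (φ ∘ g)) n
  ⊗-homo f g zero    = *-homo (f 0) (g 0)
  ⊗-homo f g (suc n) = B.trans (+-homo _ _) (B.+-cong (*-homo (f 0) (g (suc n))) (⊗-homo (f ∘ suc) g n))

  z^k-homo : ∀ k n → φ ((PA.z PA.S.^ k) n) B.≈ (PB.z PB.S.^ k) n
  z^k-homo k n = B.trans (⟦⟧-cong (PA.z^k-coefficient k n))
    (B.trans (cast-homo (k C n)) (B.sym (PB.z^k-coefficient k n)))

  κ-homo : ∀ a n → φ (PA.κ a n) B.≈ PB.κ (φ a) n
  κ-homo a zero    = B.refl
  κ-homo a (suc n) = 0#-homo

  w-homo : ∀ n → φ (PA.w n) B.≈ PB.w n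
  w-homo zero    = 0#-homo
  w-homo (suc n) = B.trans (κ-homo A.1# n) (PB.κ-cong 1#-homo n)

  -- The equation defining the numbers K n holds over ℚ, whereas the sums live in the quotient ring;
  -- this carries it over.
  cw≋[z^p-1]F-homo : ∀ p F → PA.S.cast p PA.⊗ PA.w PA.≋ (PA.z PA.S.^ p PA.S.- PA.S.1#) PA.⊗ F →
    PB.S.cast p PB.⊗ PB.w PB.≋ (PB.z PB.S.^ p PB.S.- PB.S.1#) PB.⊗ (φ ∘ F)
  cw≋[z^p-1]F-homo p F eq n = B.trans (B.sym left) (B.trans (⟦⟧-cong (eq n)) right)
    where
    left : φ ((PA.S.cast p PA.⊗ PA.w) n) B.≈ (PB.S.cast p PB.⊗ PB.w) n
    left = B.trans (⊗-homo (PA.S.cast p) PA.w n) (PB.⊗-cong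
      (λ i → B.trans (⟦⟧-cong (A.sym (PA.κ-cast p i))) (B.trans (κ-homo (A.cast p) i)
        (B.trans (PB.κ-cong (cast-homo p) i) (PB.κ-cast p i)))) w-homo n)
    right : φ (((PA.z PA.S.^ p PA.S.- PA.S.1#) PA.⊗ F) n) B.≈ ((PB.z PB.S.^ p PB.S.- PB.S.1#) PB.⊗ (φ ∘ F)) n
    right = B.trans (⊗-homo (PA.z PA.S.^ p PA.S.- PA.S.1#) F n) (PB.⊗-cong {g = φ ∘ F}
      (λ i → B.trans (+-homo _ _) (B.+-cong (z^k-homo p i) (B.trans (-‿homo _)
        (B.-‿cong (B.trans (κ-homo A.1# i) (PB.κ-cong 1#-homo i)))))) (λ _ → B.refl) n)

-- ℚ[q] as a ring of power series, and the series of the K n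

/1-isRingHomomorphism : IsRingHomomorphism ℤ.+-*-rawRing ℚ.+-*-rawRing (_/ 1)
/1-isRingHomomorphism = record
  { isSemiringHomomorphism = record
    { isNearSemiringHomomorphism = record
      { +-isMonoidHomomorphism = record
        { isMagmaHomomorphism = record
          { isRelHomomorphism = record { cong = ≡.cong (_/ 1) }
          ; homo = λ i j → ℚ.toℚᵘ-injective (begin
              ℚ.toℚᵘ ((i ℤ.+ j) / 1)                ≈⟨ ℚ.toℚᵘ-fromℚᵘ (mkℚᵘ (i ℤ.+ j) 0) ⟩
              mkℚᵘ (i ℤ.+ j) 0                      ≡⟨ ≡.cong (λ k → mkℚᵘ k 0) (≡.sym (≡.cong₂ ℤ._+_ (ℤ.*-identityʳ i) (ℤ.*-identityʳ j))) ⟩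
              mkℚᵘ i 0 ℚᵘ.+ mkℚᵘ j 0                ≈⟨ ℚᵘ.+-cong (ℚ.toℚᵘ-fromℚᵘ (mkℚᵘ i 0)) (ℚ.toℚᵘ-fromℚᵘ (mkℚᵘ j 0)) ⟨
              ℚ.toℚᵘ (i / 1) ℚᵘ.+ ℚ.toℚᵘ (j / 1)    ≈⟨ ℚ.toℚᵘ-homo-+ (i / 1) (j / 1) ⟨
              ℚ.toℚᵘ (i / 1 ℚ.+ j / 1)              ∎)
          }
        ; ε-homo = ≡.refl
        }
      ; *-homo = λ i j → ℚ.toℚᵘ-injective (begin
          ℚ.toℚᵘ ((i ℤ.* j) / 1)                ≈⟨ ℚ.toℚᵘ-fromℚᵘ (mkℚᵘ (i ℤ.* j) 0) ⟩
          mkℚᵘ i 0 ℚᵘ.* mkℚᵘ j 0                ≈⟨ ℚᵘ.*-cong (ℚ.toℚᵘ-fromℚᵘ (mkℚᵘ i 0)) (ℚ.toℚᵘ-fromℚᵘ (mkℚᵘ j 0)) ⟨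
          ℚ.toℚᵘ (i / 1) ℚᵘ.* ℚ.toℚᵘ (j / 1)    ≈⟨ ℚ.toℚᵘ-homo-* (i / 1) (j / 1) ⟨
          ℚ.toℚᵘ ((i / 1) ℚ.* (j / 1))             ∎)
      }
    ; 1#-homo = ≡.refl
    }
  ; -‿homo = λ { (+ zero) → ≡.refl ; (+ suc _) → ≡.refl ; -[1+ n ] → ≡.sym (Arithmetic.-‿involutive ℚ.+-*-commutativeRing _) }
  }
  where open import Relation.Binary.Reasoning.Setoid ℚᵘ.≃-setoid

open ℚ[q] using (Poly; coeff; var; _⊕_; _⊛_; [_]q)

module ℚS = PowerSeries ℚ.+-*-commutativeRing

coeff-⊛ : ∀ f g → coeff (f ⊛ g) ℚS.≋ coeff f ℚS.⊗ coeff g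
coeff-⊛ []      g n       = ≡.sym (ℚS.⊗-zeroˡ (coeff g) (λ _ → ≡.refl) n)
coeff-⊛ (a ∷ f) g zero    = ≡.trans (coeff-∷⊛ a f g 0) (ℚ.+-identityʳ _)
coeff-⊛ (a ∷ f) g (suc n) = ≡.trans (coeff-∷⊛ a f g (suc n)) (≡.cong (a ℚ.* coeff g (suc n) ℚ.+_) (coeff-⊛ f g n))

coeff-neg : ∀ f n → coeff (map ℚ.-_ f) n ≡ ℚ.- coeff f n
coeff-neg []      n       = ≡.refl
coeff-neg (a ∷ f) zero    = ≡.refl
coeff-neg (a ∷ f) (suc n) = coeff-neg f n

coeff-const : ∀ a → coeff (a ∷ []) ℚS.≋ ℚS.κ a
coeff-const a zero    = ≡.refl
coeff-const a (suc n) = ≡.refl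

coeff-var : coeff var ℚS.≋ ℚS.w
coeff-var zero          = ≡.refl
coeff-var (suc zero)    = ≡.refl
coeff-var (suc (suc n)) = ≡.refl

-- Equality of polynomials is by definition equality of coefficients, so this embedding is injective
-- and hands the ring laws of power series down to ℚ[q].
coeff-isRingMonomorphism : IsRingMonomorphism ℚ[q].rawRing (CommutativeRing.rawRing ℚS.commutativeRing) coeff
coeff-isRingMonomorphism = record
  { isRingHomomorphism = record
    { isSemiringHomomorphism = record
      { isNearSemiringHomomorphism = record
        { +-isMonoidHomomorphism = record
          { isMagmaHomomorphism = record
            { isRelHomomorphism = record { cong = λ f≈g → f≈g }
            ; homo = coeff-⊕
            }
          ; ε-homo = λ _ → ≡.refl
          }
        ; *-homo = coeff-⊛
        }
      ; 1#-homo = coeff-const 1ℚ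
      }
    ; -‿homo = coeff-neg
    }
  ; injective = λ f≈g → f≈g
  }

ℚ[q]-commutativeRing : CommutativeRing 0ℓ 0ℓ
ℚ[q]-commutativeRing = record
  { isCommutativeRing = RingMonomorphism.isCommutativeRing coeff-isRingMonomorphism
      (CommutativeRing.isCommutativeRing ℚS.commutativeRing) }

module ℚ[q]ₚ = Arithmetic ℚ[q]-commutativeRing

∷≈ : ∀ a f → ℚ[q]._≈_ (a ∷ f) ((a ∷ []) ⊕ var ⊛ f)
∷≈ a f n = ≡.sym (≡.trans (coeff-⊕ (a ∷ []) (var ⊛ f) n)
  (≡.trans (≡.cong (coeff (a ∷ []) n ℚ.+_) (≡.trans (coeff-⊛ var f n) (ℚS.⊗-cong coeff-var (λ _ → ≡.refl) n))) (lemma n)))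
  where
  lemma : ∀ n → coeff (a ∷ []) n ℚ.+ (ℚS.w ℚS.⊗ coeff f) n ≡ coeff (a ∷ f) n
  lemma zero    = ≡.trans (≡.cong (a ℚ.+_) (ℚ.*-zeroˡ (coeff f 0))) (ℚ.+-identityʳ a)
  lemma (suc n) = ≡.trans (ℚ.+-identityˡ _) (ℚS.w⊗-suc (coeff f) n)

coeff-^ : ∀ f n → coeff (f ℚ[q].^ n) ℚS.≋ coeff f ℚS.S.^ n
coeff-^ f zero    = coeff-const 1ℚ
coeff-^ f (suc n) = ℚS.S.trans (coeff-⊛ f (f ℚ[q].^ n)) (ℚS.S.*-congˡ {coeff f} (coeff-^ f n))

cast-ℚ : ∀ n → Arithmetic.cast ℚ.+-*-commutativeRing n ≡ + n / 1
cast-ℚ zero    = ≡.refl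
cast-ℚ (suc n) = ≡.trans (≡.cong (1ℚ ℚ.+_) (cast-ℚ n)) (≡.sym (IsRingHomomorphism.+-homo /1-isRingHomomorphism (+ 1) (+ n)))

sign : ℕ → ℚ
sign n = (-1ℤ ℤ.^ n) / 1

IsK⇒ : ∀ p K → IsK p K →
  ℚS.S.cast p ℚS.⊗ ℚS.w ℚS.≋ (ℚS.z ℚS.S.^ p ℚS.S.- ℚS.S.1#) ℚS.⊗ (λ n → sign (suc n) ℚ.* K n)
IsK⇒ p K isK n = begin
  (ℚS.S.cast p ℚS.⊗ ℚS.w) n
    ≡⟨ ℚS.⊗-cong left (λ i → ≡.sym (coeff-var i)) n ⟩
  (coeff ((+ p / 1) ∷ []) ℚS.⊗ coeff var) n
    ≡⟨ coeff-⊛ ((+ p / 1) ∷ []) var n ⟨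
  coeff (((+ p / 1) ∷ []) ⊛ var) n
    ≡⟨ isK n ⟩
  convolve (coeff (((1ℚ ∷ []) ⊕ var) ℚ[q].^ p ⊕ (ℚ.- 1ℚ ∷ []))) (λ n → sign (suc n) ℚ.* K n) n
    ≡⟨ ℚS.⊗-∑ (coeff (((1ℚ ∷ []) ⊕ var) ℚ[q].^ p ⊕ (ℚ.- 1ℚ ∷ []))) (λ n → sign (suc n) ℚ.* K n) n ⟨
  (coeff (((1ℚ ∷ []) ⊕ var) ℚ[q].^ p ⊕ (ℚ.- 1ℚ ∷ [])) ℚS.⊗ (λ n → sign (suc n) ℚ.* K n)) n
    ≡⟨ ℚS.⊗-cong right (λ _ → ≡.refl) n ⟩
  ((ℚS.z ℚS.S.^ p ℚS.S.- ℚS.S.1#) ℚS.⊗ (λ n → sign (suc n) ℚ.* K n)) n ∎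
  where
  open ≡.≡-Reasoning
  left : ℚS.S.cast p ℚS.≋ coeff ((+ p / 1) ∷ [])
  left i = ≡.trans (≡.sym (ℚS.κ-cast p i)) (≡.trans
    (ℚS.κ-cong (cast-ℚ p) i) (≡.sym (coeff-const (+ p / 1) i)))
  coeff-z : coeff ((1ℚ ∷ []) ⊕ var) ℚS.≋ ℚS.z
  coeff-z i = ≡.trans (coeff-⊕ (1ℚ ∷ []) var i) (≡.cong₂ ℚ._+_ (coeff-const 1ℚ i) (coeff-var i))
  right : coeff (((1ℚ ∷ []) ⊕ var) ℚ[q].^ p ⊕ (ℚ.- 1ℚ ∷ [])) ℚS.≋ ℚS.z ℚS.S.^ p ℚS.S.- ℚS.S.1#
  right i = ≡.trans (coeff-⊕ (((1ℚ ∷ []) ⊕ var) ℚ[q].^ p) (ℚ.- 1ℚ ∷ []) i) (≡.cong₂ ℚ._+_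
    (≡.trans (coeff-^ ((1ℚ ∷ []) ⊕ var) p i) (ℚS.S.^-congˡ p coeff-z i))
    (≡.trans (coeff-const (ℚ.- 1ℚ) i) (ℚS.κ-neg 1ℚ i)))

open ℚ⟨q⟩

-- Fractions and signs over an abstract ring

module FractionArithmetic (R : CommutativeRing 0ℓ 0ℓ) where
  open Arithmetic R
  open import Relation.Binary.Reasoning.Setoid setoid

  fraction-+ : ∀ a d b e r s → a ≈ r * d → b ≈ s * e → a * e + b * d ≈ (r + s) * (d * e)
  fraction-+ a d b e r s a≈rd b≈se = trans (+-cong (*-congʳ a≈rd) (*-congʳ b≈se))
    (solve 4 (λ r s d e → r :* d :* e :+ s :* e :* d := (r :+ s) :* (d :* e)) refl r s d e)

  fraction-* : ∀ a d b e r s → a ≈ r * d → b ≈ s * e → a * b ≈ r * s * (d * e)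
  fraction-* a d b e r s a≈rd b≈se = trans (*-cong a≈rd b≈se)
    (solve 4 (λ r s d e → r :* d :* (s :* e) := r :* s :* (d :* e)) refl r s d e)

  fraction-neg : ∀ a d r → a ≈ r * d → - a ≈ - r * d
  fraction-neg a d r a≈rd = trans (-‿cong a≈rd) (-‿distribˡ-* r d)

  unit-* : ∀ d e u v → d * u ≈ 1# → e * v ≈ 1# → d * e * (u * v) ≈ 1#
  unit-* d e u v du≈1 ev≈1 = trans
    (solve 4 (λ d e u v → d :* e :* (u :* v) := d :* u :* (e :* v)) refl d e u v)
    (trans (*-cong du≈1 ev≈1) (*-identityʳ 1#))

  module Cleared (a₁ b₁ a₂ b₂ : Carrier) (a₁b₁≈1 : a₁ * b₁ ≈ 1#) (a₂b₂≈1 : a₂ * b₂ ≈ 1#) where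
    private
      b = b₁ * b₂
      restore : ∀ d → d ≈ b * (a₁ * (a₂ * d))
      restore d = begin
        d                                ≈⟨ *-identityˡ d ⟨
        1# * d                           ≈⟨ *-congʳ (unit-* a₁ a₂ b₁ b₂ a₁b₁≈1 a₂b₂≈1) ⟨
        a₁ * a₂ * (b₁ * b₂) * d          ≈⟨ solve 4 (λ a₁ a₂ b d → a₁ :* a₂ :* b :* d := b :* (a₁ :* (a₂ :* d))) refl a₁ a₂ b d ⟩
        b * (a₁ * (a₂ * d))              ∎

    same-fraction : ∀ n d h m d′ h′ → n ≈ h * m → d′ ≈ a₁ * (a₂ * d) → h′ ≈ a₂ * (a₁ * h) → n * d′ ≈ h′ * m * d
    same-fraction n d h m d′ h′ n≈hm d′≈ h′≈ = trans (*-cong n≈hm d′≈) (trans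
      (solve 5 (λ h m a₁ a₂ d → h :* m :* (a₁ :* (a₂ :* d)) := a₂ :* (a₁ :* h) :* m :* d) refl h m a₁ a₂ d)
      (*-congʳ (*-congʳ (sym h′≈))))

    nonzero : ∀ d d′ → d′ ≈ a₁ * (a₂ * d) → d′ ≈ 0# → d ≈ 0#
    nonzero d d′ d′≈ d′≈0 = trans (restore d) (trans (*-congˡ (trans (sym d′≈) d′≈0)) (zeroʳ b))

    -- A common divisor x of d′ and m divides d = b d′, hence also u d - k m = 1; the cofactor
    -- spells this out.
    coprime : ∀ d d′ m u k x c e → d′ ≈ a₁ * (a₂ * d) → d * u - 1# ≈ k * m → c * x ≈ d′ → e * x ≈ m →
              (u * b * c - k * e) * x ≈ 1#
    coprime d d′ m u k x c e d′≈ du-1≈km cx≈d′ ex≈m = begin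
      (u * b * c - k * e) * x
        ≈⟨ solve 6 (λ u b c k e x → (u :* b :* c :- k :* e) :* x := u :* (b :* (c :* x)) :- k :* (e :* x)) refl u b c k e x ⟩
      u * (b * (c * x)) - k * (e * x)
        ≈⟨ +-cong (*-congˡ (trans (*-congˡ (trans cx≈d′ d′≈)) (sym (restore d)))) (-‿cong (*-congˡ ex≈m)) ⟩
      u * d - k * m
        ≈⟨ +-congˡ (-‿cong du-1≈km) ⟨
      u * d - (d * u - 1#)
        ≈⟨ solve 2 (λ u d → u :* d :- (d :* u :- con (+ 1)) := con (+ 1)) refl u d ⟩
      1# ∎

  -- Meant for N = p (t + 1), s = (-1)^t and s′ = (-1)^(t-1), with m the binomial coefficient and d
  -- the power of 1 - q.
  cancel-multiple : ∀ {N N′ l s s′ m d c} → N * N′ ≈ 1# → N * l ≈ - (s * m) * d → N * c ≈ s′ * m → s ≈ - s′ →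
                    l ≈ c * d
  cancel-multiple {N} {N′} {l} {s} {s′} {m} {d} {c} NN′≈1 Nl≈ Nc≈ s≈-s′ = *-cancelˡ-unit NN′≈1 (begin
    N * l               ≈⟨ Nl≈ ⟩
    - (s * m) * d       ≈⟨ *-congʳ (-‿cong (*-congʳ s≈-s′)) ⟩
    - (- s′ * m) * d    ≈⟨ solve 3 (λ s m d → :- (:- s :* m) :* d := s :* m :* d) refl s′ m d ⟩
    s′ * m * d          ≈⟨ *-congʳ Nc≈ ⟨
    N * c * d           ≈⟨ *-assoc N c d ⟩
    N * (c * d)         ∎)

  negate-sum : ∀ d n (g f : ℕ → Carrier) s → s ≈ ∑< n f → (∀ i → i < n → f i ≈ - g i) → d * ∑< n g ≈ - (d * s)
  negate-sum d n g f s s≈∑f f≈-g = begin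
    d * ∑< n g                     ≈⟨ solve 2 (λ d g → d :* g := :- (d :* (:- con (+ 1) :* g))) refl d (∑< n g) ⟩
    - (d * (- 1# * ∑< n g))        ≈⟨ -‿cong (*-congˡ (∑-*ˡ n (- 1#) g)) ⟨
    - (d * ∑< n (λ i → - 1# * g i)) ≈⟨ -‿cong (*-congˡ (∑-cong n (λ i i<n → trans (f≈-g i i<n)
                                        (solve 1 (λ g → :- g := :- con (+ 1) :* g) refl (g i))))) ⟨
    - (d * ∑< n f)                 ≈⟨ -‿cong (*-congˡ s≈∑f) ⟨
    - (d * s)                      ∎

  move-sign : ∀ c s k → c * s * k ≈ - (c * (- 1# * s * k))
  move-sign c s k = solve 3 (λ c s k → c :* s :* k := :- (c :* (:- con (+ 1) :* s :* k))) refl c s k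

  sign-step : ∀ n → (- 1#) ^ suc n ≈ - (- 1#) ^ n
  sign-step n = solve 1 (λ s → :- con (+ 1) :* s := :- s) refl _

  numerator-vanishes : ∀ n d r → n ≈ r * d → r ≈ 0# → n ≈ 0#
  numerator-vanishes n d r n≈rd r≈0 = trans n≈rd (trans (*-congʳ r≈0) (zeroˡ d))

  sign-square : ∀ n → (- 1#) ^ n * (- 1#) ^ n ≈ 1#
  sign-square n = trans (sym (^-distrib-* (- 1#) (- 1#) n))
    (trans (^-congˡ n (solve 0 (:- con (+ 1) :* :- con (+ 1) := con (+ 1)) refl)) (1^n≈1 n))

  -- Reconciles the sign attached to K at 2t - i in its generating series with the (-1)^i of the
  -- claim.
  sign-parity : ∀ i d t → i ℕ.+ d ≡ 2 ℕ.* t → (- 1#) ^ d ≈ (- 1#) ^ i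
  sign-parity i d t i+d≡2t = begin
    s d                        ≈⟨ *-identityˡ _ ⟨
    1# * s d                   ≈⟨ *-congʳ (sign-square i) ⟨
    s i * s i * s d            ≈⟨ *-assoc _ _ _ ⟩
    s i * (s i * s d)          ≈⟨ *-congˡ (^-homo-* (- 1#) i d) ⟨
    s i * s (i ℕ.+ d)          ≡⟨ ≡.cong (λ n → s i * s n) (≡.trans i+d≡2t (≡.cong (t ℕ.+_) (ℕ.+-identityʳ t))) ⟩
    s i * s (t ℕ.+ t)          ≈⟨ *-congˡ (trans (^-homo-* (- 1#) t t) (sign-square t)) ⟩
    s i * 1#                   ≈⟨ *-identityʳ _ ⟩
    s i                        ∎
    where
    s : ℕ → Carrier
    s = (- 1#) ^_

-- Clearing denominators: from ℚ[q] to ℤ[q]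

module ℤ/1 = IsRingHomomorphism /1-isRingHomomorphism

ℤ[q]→ℚ[q]-⊕ : ∀ f g → ℤ[q]→ℚ[q] (f ℤ[q].⊕ g) ≡ ℤ[q]→ℚ[q] f ⊕ ℤ[q]→ℚ[q] g
ℤ[q]→ℚ[q]-⊕ []      g       = ≡.refl
ℤ[q]→ℚ[q]-⊕ (a ∷ f) []      = ≡.refl
ℤ[q]→ℚ[q]-⊕ (a ∷ f) (b ∷ g) = ≡.cong₂ _∷_ (ℤ/1.+-homo a b) (ℤ[q]→ℚ[q]-⊕ f g)

ℤ[q]→ℚ[q]-scale : ∀ a f → ℤ[q]→ℚ[q] (map (a ℤ.*_) f) ≡ map ((a / 1) ℚ.*_) (ℤ[q]→ℚ[q] f)
ℤ[q]→ℚ[q]-scale a []      = ≡.refl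
ℤ[q]→ℚ[q]-scale a (b ∷ f) = ≡.cong₂ _∷_ (ℤ/1.*-homo a b) (ℤ[q]→ℚ[q]-scale a f)

ℤ[q]→ℚ[q]-⊛ : ∀ f g → ℤ[q]→ℚ[q] (f ℤ[q].⊛ g) ≡ ℤ[q]→ℚ[q] f ⊛ ℤ[q]→ℚ[q] g
ℤ[q]→ℚ[q]-⊛ []      g = ≡.refl
ℤ[q]→ℚ[q]-⊛ (a ∷ f) g = ≡.trans (ℤ[q]→ℚ[q]-⊕ (map (a ℤ.*_) g) (+ 0 ∷ f ℤ[q].⊛ g))
  (≡.cong₂ (λ h k → h ⊕ (0ℚ ∷ k)) (ℤ[q]→ℚ[q]-scale a g) (ℤ[q]→ℚ[q]-⊛ f g))

↧*≡↥ : ∀ c → (ℚ.↧ c / 1) ℚ.* c ≡ ℚ.↥ c / 1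
↧*≡↥ c@record{} = ℚ.toℚᵘ-injective (begin
  ℚ.toℚᵘ ((ℚ.↧ c / 1) ℚ.* c)              ≈⟨ ℚ.toℚᵘ-homo-* (ℚ.↧ c / 1) c ⟩
  ℚ.toℚᵘ (ℚ.↧ c / 1) ℚᵘ.* ℚ.toℚᵘ c        ≈⟨ ℚᵘ.*-congʳ {ℚ.toℚᵘ c} (ℚ.toℚᵘ-fromℚᵘ (mkℚᵘ (ℚ.↧ c) 0)) ⟩
  mkℚᵘ (ℚ.↧ c) 0 ℚᵘ.* ℚ.toℚᵘ c            ≈⟨ *≡* (≡.trans (ℤ.*-identityʳ _) (≡.trans (ℤ.*-comm (ℚ.↧ c) (ℚ.↥ c))
                                               (≡.cong (ℚ.↥ c ℤ.*_) (≡.sym (ℤ.*-identityˡ (ℚ.↧ c)))))) ⟩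
  mkℚᵘ (ℚ.↥ c) 0                          ≈⟨ ℚ.toℚᵘ-fromℚᵘ (mkℚᵘ (ℚ.↥ c) 0) ⟨
  ℚ.toℚᵘ (ℚ.↥ c / 1)                      ∎)
  where open import Relation.Binary.Reasoning.Setoid ℚᵘ.≃-setoid

clear-denominators : ∀ (f : Poly) → ∃₂ λ n f′ → ℤ[q]→ℚ[q] f′ ≡ map ((+ suc n / 1) ℚ.*_) f
clear-denominators []      = 0 , [] , ≡.refl
clear-denominators (c@(mkℚ _ d-1 _) ∷ f) with n , f′ , eq ← clear-denominators f =
  -- The successor of this number is d (n + 1), the multiplier of the tail times the denominator of
  -- the head.
  n ℕ.+ d-1 ℕ.* suc n , (+ suc n ℤ.* ℚ.↥ c) ∷ map (+ d ℤ.*_) f′ , ≡.cong₂ _∷_ head (≡.trans (ℤ[q]→ℚ[q]-scale (+ d) f′)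
    (≡.trans (≡.cong (map ((+ d / 1) ℚ.*_)) eq) (tail f)))
  where
  open ≡.≡-Reasoning
  d = suc d-1
  N/1 : + (d ℕ.* suc n) / 1 ≡ (+ d / 1) ℚ.* (+ suc n / 1)
  N/1 = ≡.trans (≡.cong (_/ 1) (ℤ.pos-* d (suc n))) (ℤ/1.*-homo (+ d) (+ suc n))
  head : (+ suc n ℤ.* ℚ.↥ c) / 1 ≡ (+ (d ℕ.* suc n) / 1) ℚ.* c
  head = begin
    (+ suc n ℤ.* ℚ.↥ c) / 1                   ≡⟨ ℤ/1.*-homo (+ suc n) (ℚ.↥ c) ⟩
    (+ suc n / 1) ℚ.* (ℚ.↥ c / 1)             ≡⟨ ≡.cong ((+ suc n / 1) ℚ.*_) (↧*≡↥ c) ⟨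
    (+ suc n / 1) ℚ.* ((+ d / 1) ℚ.* c)       ≡⟨ ℚ.*-assoc (+ suc n / 1) (+ d / 1) c ⟨
    (+ suc n / 1) ℚ.* (+ d / 1) ℚ.* c         ≡⟨ ≡.cong (ℚ._* c) (ℚ.*-comm (+ suc n / 1) (+ d / 1)) ⟩
    (+ d / 1) ℚ.* (+ suc n / 1) ℚ.* c         ≡⟨ ≡.cong (ℚ._* c) N/1 ⟨
    (+ (d ℕ.* suc n) / 1) ℚ.* c               ∎
  tail : ∀ f → map ((+ d / 1) ℚ.*_) (map ((+ suc n / 1) ℚ.*_) f) ≡ map ((+ (d ℕ.* suc n) / 1) ℚ.*_) f
  tail []      = ≡.refl
  tail (b ∷ f) = ≡.cong₂ _∷_ (≡.trans (≡.sym (ℚ.*-assoc (+ d / 1) (+ suc n / 1) b)) (≡.cong (ℚ._* b) (≡.sym N/1))) (tail f)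

map≈ : ∀ a f → ℚ[q]._≈_ (map (a ℚ.*_) f) ((a ∷ []) ⊛ f)
map≈ a f n = ≡.trans (coeff-map a f n) (≡.sym (≡.trans (coeff-⊛ (a ∷ []) f n)
  (≡.trans (ℚS.⊗-cong (coeff-const a) (λ _ → ≡.refl) n) (ℚS.κ⊗ a (coeff f) n))))

const-isRingHomomorphism : IsRingHomomorphism ℚ.+-*-rawRing ℚ[q].rawRing (_∷ [])
const-isRingHomomorphism = record
  { isSemiringHomomorphism = record
    { isNearSemiringHomomorphism = record
      { +-isMonoidHomomorphism = record
        { isMagmaHomomorphism = record
          { isRelHomomorphism = record { cong = λ { ≡.refl _ → ≡.refl } }
          ; homo = λ _ _ _ → ≡.refl
          }
        ; ε-homo = λ { zero → ≡.refl ; (suc _) → ≡.refl }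
        }
      ; *-homo = λ a b → λ { zero → ≡.sym (ℚ.+-identityʳ (a ℚ.* b)) ; (suc _) → ≡.refl }
      }
    ; 1#-homo = λ _ → ≡.refl
    }
  ; -‿homo = λ _ _ → ≡.refl
  }
module Const = IsRingHomomorphism const-isRingHomomorphism

/-*-cancel : ∀ i n .{{_ : NonZero n}} → (+ n / 1) ℚ.* (i / n) ≡ i / 1
/-*-cancel i n@(suc n-1) = ℚ.toℚᵘ-injective (begin
  ℚ.toℚᵘ ((+ n / 1) ℚ.* (i / n))               ≈⟨ ℚ.toℚᵘ-homo-* (+ n / 1) (i / n) ⟩
  ℚ.toℚᵘ (+ n / 1) ℚᵘ.* ℚ.toℚᵘ (i / n)         ≈⟨ ℚᵘ.*-cong (ℚ.toℚᵘ-fromℚᵘ (mkℚᵘ (+ n) 0)) (ℚ.toℚᵘ-fromℚᵘ (mkℚᵘ i n-1)) ⟩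
  mkℚᵘ (+ n) 0 ℚᵘ.* mkℚᵘ i n-1                 ≈⟨ *≡* (≡.trans (ℤ.*-identityʳ _) (≡.trans (ℤ.*-comm (+ n) i)
                                                    (≡.cong (i ℤ.*_) (≡.sym (ℤ.*-identityˡ (+ n)))))) ⟩
  mkℚᵘ i 0                                     ≈⟨ ℚ.toℚᵘ-fromℚᵘ (mkℚᵘ i 0) ⟨
  ℚ.toℚᵘ (i / 1)                               ∎)
  where open import Relation.Binary.Reasoning.Setoid ℚᵘ.≃-setoid

const-inverse : ∀ n → ℚ[q]._≈_ (((+ suc n / 1) ∷ []) ⊛ ((+ 1 / suc n) ∷ [])) (1ℚ ∷ [])
const-inverse n = ℚ[q]ₚ.trans {((+ suc n / 1) ∷ []) ⊛ ((+ 1 / suc n) ∷ [])} {((+ suc n / 1) ℚ.* (+ 1 / suc n)) ∷ []} {1ℚ ∷ []}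
  (ℚ[q]ₚ.sym {((+ suc n / 1) ℚ.* (+ 1 / suc n)) ∷ []} {((+ suc n / 1) ∷ []) ⊛ ((+ 1 / suc n) ∷ [])}
    (Const.*-homo (+ suc n / 1) (+ 1 / suc n)))
  (Const.⟦⟧-cong (/-*-cancel (+ 1) (suc n)))

module _ (p : ℕ) where
  private
    module Q = Quotient ℚ[q]-commutativeRing [ p ]q
    open Q using (_,_)

  -- A Bézout certificate for the denominator gives coprimality to [ p ]q without using irreducibility.
  ≡-mod-intro : ∀ A B u → num (A -ᶠ B) Q.∼ [] → den (A -ᶠ B) ⊛ u Q.∼ (1ℚ ∷ []) → A ≡ B mod[ p ]q
  ≡-mod-intro A B u (h , n-0≈hm) (k , du-1≈km)
    with n₁ , h₀ , h₀≡ ← clear-denominators h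
       | n₂ , d₀ , d₀≡ ← clear-denominators (den (A -ᶠ B)) =
    h′ ℤ[q].⊛ ℤ[q].[ p ]q , d′ , d′≉0
    , ≡.subst (λ f → ℚ[q]._≈_ (n ⊛ ℤ[q]→ℚ[q] d′) (f ⊛ d)) (≡.sym f≡)
        (L.same-fraction n d h [ p ]q (ℤ[q]→ℚ[q] d′) (ℤ[q]→ℚ[q] h′) n≈hm d′≈ h′≈)
    , (λ {x} → λ { (c , cx≈d′) (e , ex≈m) →
        (u ⊛ (b n₁ ⊛ b n₂) ⊛ c ⊕ map ℚ.-_ (k ⊛ e)) ,
          L.coprime d (ℤ[q]→ℚ[q] d′) [ p ]q u k x c e d′≈ du-1≈km cx≈d′ ex≈m })
    , (h′ , λ _ → ≡.refl)
    where
    n d : Poly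
    n = num (A -ᶠ B)
    d = den (A -ᶠ B)
    a b : ℕ → Poly
    a n = (+ suc n / 1) ∷ []
    b n = (+ 1 / suc n) ∷ []
    h′ d′ : ℤ[q].Poly
    -- Cofactor and denominator are cleared by different multipliers; each also receives the
    -- other's, which keeps the fraction unchanged.
    h′ = (+ suc n₂ ∷ []) ℤ[q].⊛ h₀
    d′ = (+ suc n₁ ∷ []) ℤ[q].⊛ d₀
    module L = FractionArithmetic.Cleared ℚ[q]-commutativeRing (a n₁) (b n₁) (a n₂) (b n₂) (const-inverse n₁) (const-inverse n₂)
    cleared : ∀ m k f₀ f → ℤ[q]→ℚ[q] f₀ ≡ map ((+ suc k / 1) ℚ.*_) f →
              ℚ[q]._≈_ (ℤ[q]→ℚ[q] ((+ suc m ∷ []) ℤ[q].⊛ f₀)) (a m ⊛ (a k ⊛ f))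
    cleared m k f₀ f f₀≡ = ≡.subst (λ g → ℚ[q]._≈_ g (a m ⊛ (a k ⊛ f))) (≡.sym (ℤ[q]→ℚ[q]-⊛ (+ suc m ∷ []) f₀))
      (ℚ[q]ₚ.*-congˡ {a m} {ℤ[q]→ℚ[q] f₀} {a k ⊛ f}
        (≡.subst (λ g → ℚ[q]._≈_ g (a k ⊛ f)) (≡.sym f₀≡) (map≈ (+ suc k / 1) f)))
    h′≈ : ℚ[q]._≈_ (ℤ[q]→ℚ[q] h′) (a n₂ ⊛ (a n₁ ⊛ h))
    h′≈ = cleared n₂ n₁ h₀ h h₀≡
    d′≈ : ℚ[q]._≈_ (ℤ[q]→ℚ[q] d′) (a n₁ ⊛ (a n₂ ⊛ d))
    d′≈ = cleared n₁ n₂ d₀ d d₀≡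
    d′≉0 : ℤ[q]→ℚ[q] d′ ℚ[q].≉ []
    d′≉0 d′≈0 = den≉0 (A -ᶠ B) (L.nonzero d (ℤ[q]→ℚ[q] d′) d′≈ d′≈0)
    n≈hm : ℚ[q]._≈_ n (h ⊛ [ p ]q)
    n≈hm i = ≡.trans (≡.sym (≡.trans (coeff-⊕ n [] i) (ℚ.+-identityʳ (coeff n i)))) (n-0≈hm i)
    f≡ : ℤ[q]→ℚ[q] (h′ ℤ[q].⊛ ℤ[q].[ p ]q) ≡ ℤ[q]→ℚ[q] h′ ⊛ [ p ]q
    f≡ = ≡.trans (ℤ[q]→ℚ[q]-⊛ h′ ℤ[q].[ p ]q) (≡.cong (ℤ[q]→ℚ[q] h′ ⊛_) (map-replicate (_/ 1) p (+ 1)))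

-- Evaluating rational functions modulo [p]q

module Evaluation (p′ : ℕ) (p-prime : Prime (suc p′)) where
  p : ℕ
  p = suc p′

  module Q = Quotient ℚ[q]-commutativeRing [ p ]q

  R : CommutativeRing 0ℓ 0ℓ
  R = Q.quotientRing

  module R = Arithmetic R
  open FractionArithmetic R
  open MultipleSums R using (M<; M≤)
  open GeometricSums R

  φ : ℚ → Poly
  φ = _∷ []

  φ-isRingHomomorphism : IsRingHomomorphism ℚ.+-*-rawRing (CommutativeRing.rawRing R) φ
  φ-isRingHomomorphism = record
    { isSemiringHomomorphism = record
      { isNearSemiringHomomorphism = record
        { +-isMonoidHomomorphism = record
          { isMagmaHomomorphism = record
            { isRelHomomorphism = record { cong = λ { ≡.refl → R.refl } }
            ; homo = λ a b → Q.≈⇒∼ (Const.+-homo a b)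
            }
          ; ε-homo = Q.≈⇒∼ Const.0#-homo
          }
        ; *-homo = λ a b → Q.≈⇒∼ (Const.*-homo a b)
        }
      ; 1#-homo = R.refl
      }
    ; -‿homo = λ a → Q.≈⇒∼ (Const.-‿homo a)
    }
  module φ = IsRingHomomorphism φ-isRingHomomorphism
  module Φ = SeriesMap ℚ.+-*-commutativeRing R φ φ-isRingHomomorphism

  geometric≈[_]q : ∀ n → geometric var n R.≈ [ n ]q
  geometric≈[ zero ]q  = R.refl
  geometric≈[ suc n ]q = R.trans (R.+-congˡ {1ℚ ∷ []} (R.*-congˡ {var} (geometric≈[ n ]q)))
    (R.sym (Q.≈⇒∼ (∷≈ 1ℚ [ n ]q)))

  cast≈ : ∀ n → R.cast n R.≈ φ (+ n / 1)
  cast≈ n = R.trans (R.sym (Φ.cast-homo n)) (φ.⟦⟧-cong (cast-ℚ n))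

  cast*φ : ∀ i n .{{_ : NonZero n}} → R.cast n R.* φ (i / n) R.≈ φ (i / 1)
  cast*φ i n = R.trans (R.*-congʳ {φ (i / n)} (cast≈ n))
    (R.trans (R.sym (φ.*-homo (+ n / 1) (i / n))) (φ.⟦⟧-cong (/-*-cancel i n)))

  private module Root = PrimeRoot p p-prime var (φ (+ 1 / p)) (R.trans (geometric≈[ p ]q) Q.m∼0) (cast*φ (+ 1) p)
  private module Cyclotomic = CyclotomicSums.AtRoot R p′ var Root.v Root.ζ^p≈1 Root.v-inverse
  open Cyclotomic using (τ; δ; ks; 2ᵃ32ᵇ)

  infix 4 _↦_
  -- Evaluation at q = ζ is a relation because it is defined only for denominators that are units
  -- modulo `[ p ]q`. The stored inverse later certifies coprimality.
  record _↦_ (A : ℚ⟨q⟩) (r : Poly) : Set where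
    constructor eval
    field
      inverse     : Poly
      den-inverse : den A R.* inverse R.≈ R.1#
      num≈        : num A R.≈ r R.* den A
  open _↦_

  ↦-+ : ∀ {A B r s} → A ↦ r → B ↦ s → A +ᶠ B ↦ r R.+ s
  ↦-+ {A} {B} {r} {s} (eval u du≈1 a≈) (eval v ev≈1 b≈) = eval (u R.* v)
    (unit-* (den A) (den B) u v du≈1 ev≈1) (fraction-+ (num A) (den A) (num B) (den B) r s a≈ b≈)

  ↦-* : ∀ {A B r s} → A ↦ r → B ↦ s → A *ᶠ B ↦ r R.* s
  ↦-* {A} {B} {r} {s} (eval u du≈1 a≈) (eval v ev≈1 b≈) = eval (u R.* v)
    (unit-* (den A) (den B) u v du≈1 ev≈1) (fraction-* (num A) (den A) (num B) (den B) r s a≈ b≈)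

  ↦-neg : ∀ {A r} → A ↦ r → -ᶠ A ↦ R.- r
  ↦-neg {A} {r} (eval u du≈1 a≈) = eval u du≈1 (fraction-neg (num A) (den A) r a≈)

  ↦-poly : ∀ f → poly f ↦ f
  ↦-poly f = eval R.1# (R.*-identityʳ R.1#) (R.sym (R.*-identityʳ f))

  ↦-^ : ∀ {A r} → A ↦ r → ∀ n → A ^ᶠ n ↦ r R.^ n
  ↦-^ A↦r zero    = ↦-poly (1ℚ ∷ [])
  ↦-^ A↦r (suc n) = ↦-* A↦r (↦-^ A↦r n)

  ↦⇒≡mod : ∀ {A B r s} → A ↦ r → B ↦ s → r R.≈ s → A ≡ B mod[ p ]q
  ↦⇒≡mod {A} {B} {r} {s} A↦r B↦s r≈s = ≡-mod-intro p A B (inverse D)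
    (numerator-vanishes (num (A -ᶠ B)) (den (A -ᶠ B)) (r R.- s) (num≈ D) (R.x≈y⇒x∙y⁻¹≈ε r≈s)) (den-inverse D)
    where
    D : A -ᶠ B ↦ r R.- s
    D = ↦-+ A↦r (↦-neg B↦s)

  1/[k]q↦ : ∀ k .{{_ : NonZero k}} → k < p → 1/[ k ]q ↦ δ R.* Root.v k
  1/[k]q↦ k@(suc _) k<p = eval (δ R.* Root.v k) unit
    (R.trans (R.sym unit) (R.*-comm [ k ]q (δ R.* Root.v k)))
    where
    unit : [ k ]q R.* (δ R.* Root.v k) R.≈ R.1#
    unit = R.trans (R.*-congʳ {δ R.* Root.v k} (R.sym (geometric≈[ k ]q)))
      (geometric-inverse var k (Root.v k) (Root.v-inverse k z<s k<p))

  term↦ : ∀ s k .{{_ : NonZero k}} → k < p → term s k ↦ τ s k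
  term↦ s k k<p = ↦-* (↦-^ (↦-poly var) (ℕ.pred s ℕ.* k)) (↦-^ (1/[k]q↦ k k<p) s)

  -- A strict sum that has used position m + i + 1 goes on from m + i + 2 with l - i - 1 positions
  -- left. The weak version below goes on from m + i + 1 itself with l - i.
  ∑↦M< : ∀ t fs l m (f : ℕ → ℚ⟨q⟩) →
    (∀ i → i < l → f i ↦ t (suc (m ℕ.+ i)) R.* M< fs (range (suc (suc (m ℕ.+ i))) (l ∸ suc i))) →
    ∑ᶠ< l f ↦ M< (t ∷ fs) (range (suc m) l)
  ∑↦M< t fs zero    m f f↦ = ↦-poly []
  ∑↦M< t fs (suc l) m f f↦ = ↦-+
    (≡.subst (λ k → f 0 ↦ t (suc k) R.* M< fs (range (suc (suc k)) l)) (ℕ.+-identityʳ m) (f↦ 0 z<s))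
    (∑↦M< t fs l (suc m) (f ∘ suc) λ i i<l →
      ≡.subst (λ k → f (suc i) ↦ t (suc k) R.* M< fs (range (suc (suc k)) (l ∸ suc i))) (ℕ.+-suc m i) (f↦ (suc i) (s<s i<l)))

  ∑↦M≤ : ∀ t fs l m (f : ℕ → ℚ⟨q⟩) →
    (∀ i → i < l → f i ↦ t (suc (m ℕ.+ i)) R.* M≤ fs (range (suc (m ℕ.+ i)) (l ∸ i))) →
    ∑ᶠ< l f ↦ M≤ (t ∷ fs) (range (suc m) l)
  ∑↦M≤ t fs zero    m f f↦ = ↦-poly []
  ∑↦M≤ t fs (suc l) m f f↦ = ↦-+
    (≡.subst (λ k → f 0 ↦ t (suc k) R.* M≤ fs (range (suc k) (suc l))) (ℕ.+-identityʳ m) (f↦ 0 z<s))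
    (∑↦M≤ t fs l (suc m) (f ∘ suc) λ i i<l →
      ≡.subst (λ k → f (suc i) ↦ t (suc k) R.* M≤ fs (range (suc k) (l ∸ i))) (ℕ.+-suc m i) (f↦ (suc i) (s<s i<l)))

  private
    index≤ : ∀ {m n i} → m ≤ n → i < n ∸ m → suc (m ℕ.+ i) ≤ n
    index≤ {m} {n} {i} m≤n i<n∸m = ≡.subst (_≤ n) (ℕ.+-suc m i)
      (≡.subst (m ℕ.+ suc i ≤_) (ℕ.m+[n∸m]≡n m≤n) (ℕ.+-monoʳ-≤ m i<n∸m))

  H↦M< : ∀ ss m n → m ≤ n → n < p → H-above m n ss ↦ M< (map τ ss) (range (suc m) (n ∸ m))
  H↦M< []       m n m≤n n<p = ↦-poly (1ℚ ∷ [])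
  H↦M< (s ∷ ss) m n m≤n n<p = ∑↦M< (τ s) (map τ ss) (n ∸ m) m _ λ i i<n∸m →
    ↦-* (term↦ s (suc (m ℕ.+ i)) (ℕ.≤-<-trans (index≤ m≤n i<n∸m) n<p))
      (≡.subst (λ l → H-above (suc (m ℕ.+ i)) n ss ↦ M< (map τ ss) (range (suc (suc (m ℕ.+ i))) l))
        (≡.trans (≡.cong (n ∸_) (≡.sym (ℕ.+-suc m i))) (≡.sym (ℕ.∸-+-assoc n m (suc i))))
        (H↦M< ss (suc (m ℕ.+ i)) n (index≤ m≤n i<n∸m) n<p))

  S↦M≤ : ∀ ss m n → m ≤ n → n < p → S-above m n ss ↦ M≤ (map τ ss) (range (suc m) (n ∸ m))
  S↦M≤ []       m n m≤n n<p = ↦-poly (1ℚ ∷ [])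
  S↦M≤ (s ∷ ss) m n m≤n n<p = ∑↦M≤ (τ s) (map τ ss) (n ∸ m) m _ λ i i<n∸m →
    ↦-* (term↦ s (suc (m ℕ.+ i)) (ℕ.≤-<-trans (index≤ m≤n i<n∸m) n<p))
      (≡.subst (λ l → S-above (m ℕ.+ i) n ss ↦ M≤ (map τ ss) (range (suc (m ℕ.+ i)) l))
        (≡.sym (ℕ.∸-+-assoc n m i))
        (S↦M≤ ss (m ℕ.+ i) n (ℕ.<⇒≤ (index≤ m≤n i<n∸m)) n<p))

  1-q↦ : 1ᶠ -ᶠ q ↦ δ
  1-q↦ = ↦-+ (↦-poly (1ℚ ∷ [])) (↦-neg (↦-poly var))

  φ-sign : ∀ n → φ ((-1ℤ ℤ.^ n) / 1) R.≈ (R.- R.1#) R.^ n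
  φ-sign zero    = R.refl
  φ-sign (suc n) = R.trans (φ.⟦⟧-cong (ℤ/1.*-homo -1ℤ (-1ℤ ℤ.^ n)))
    (R.trans (φ.*-homo (-1ℤ / 1) ((-1ℤ ℤ.^ n) / 1)) (R.*-congˡ {R.- R.1#} (φ-sign n)))

  φ-∑ : ∀ n f → φ (∑ℚ< n f) R.≈ R.∑< n (φ ∘ f)
  φ-∑ zero    f = φ.0#-homo
  φ-∑ (suc n) f = R.trans (φ.+-homo (f 0) (∑ℚ< n (f ∘ suc))) (R.+-congˡ {φ (f 0)} (φ-∑ n (f ∘ suc)))

  -- Both congruences

  H-congruence : ∀ a b → let t = a ℕ.+ b ℕ.+ 1 in .{{_ : NonZero (p ℕ.* suc t)}} →
    H (p ∸ 1) (2ᵃ32ᵇ a b) +ᶠ H (p ∸ 1) (2ᵃ32ᵇ b a)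
      ≡ const ((-1ℤ ℤ.^ (t ∸ 1) ℤ.* + ((p ℕ.+ t) C (2 ℕ.* t ℕ.+ 1))) / (p ℕ.* suc t))
          *ᶠ (1ᶠ -ᶠ q) ^ᶠ (2 ℕ.* t ℕ.+ 1)
      mod[ p ]q
  H-congruence a b = ↦⇒≡mod
    (↦-+ (H↦M< (2ᵃ32ᵇ a b) 0 p′ z≤n (ℕ.n<1+n p′)) (H↦M< (2ᵃ32ᵇ b a) 0 p′ z≤n (ℕ.n<1+n p′)))
    (↦-* (↦-poly (φ c)) (↦-^ 1-q↦ (2 ℕ.* t ℕ.+ 1)))
    (cancel-multiple {R.cast (p ℕ.* suc t)} {φ (+ 1 / (p ℕ.* suc t))} {_} {(R.- R.1#) R.^ t} {(R.- R.1#) R.^ (t ∸ 1)}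
      {R.cast ((p ℕ.+ t) C suc (t ℕ.+ t))} {δ R.^ (2 ℕ.* t ℕ.+ 1)} {φ c}
      (cast*φ (+ 1) (p ℕ.* suc t)) (Cyclotomic.H-symmetric a b) c≈ sign-suc)
    where
    t = a ℕ.+ b ℕ.+ 1
    i = -1ℤ ℤ.^ (t ∸ 1) ℤ.* + ((p ℕ.+ t) C (2 ℕ.* t ℕ.+ 1))
    c = i / (p ℕ.* suc t)
    c≈ : R.cast (p ℕ.* suc t) R.* φ c R.≈ (R.- R.1#) R.^ (t ∸ 1) R.* R.cast ((p ℕ.+ t) C suc (t ℕ.+ t))
    c≈ = R.trans (cast*φ i (p ℕ.* suc t)) (R.trans
      (φ.⟦⟧-cong (ℤ/1.*-homo (-1ℤ ℤ.^ (t ∸ 1)) (+ ((p ℕ.+ t) C (2 ℕ.* t ℕ.+ 1)))))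
      (R.trans (φ.*-homo ((-1ℤ ℤ.^ (t ∸ 1)) / 1) (+ ((p ℕ.+ t) C (2 ℕ.* t ℕ.+ 1)) / 1))
        (R.*-cong (φ-sign (t ∸ 1)) (R.trans (R.sym (cast≈ ((p ℕ.+ t) C (2 ℕ.* t ℕ.+ 1))))
          (R.cast-cong (≡.cong ((p ℕ.+ t) C_) (≡.trans (ℕ.+-comm (2 ℕ.* t) 1)
            (≡.cong (λ n → suc (t ℕ.+ n)) (ℕ.+-identityʳ t)))))))))
    sign-suc : (R.- R.1#) R.^ t R.≈ R.- ((R.- R.1#) R.^ (t ∸ 1))
    sign-suc = ≡.subst (λ t → (R.- R.1#) R.^ t R.≈ R.- ((R.- R.1#) R.^ (t ∸ 1))) (ℕ.+-comm 1 (a ℕ.+ b))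
      (sign-step (a ℕ.+ b))

  S-congruence : ∀ a b K → IsK p K → let t = a ℕ.+ b ℕ.+ 1 in t < p →
    S (p ∸ 1) (2ᵃ32ᵇ a b) +ᶠ S (p ∸ 1) (2ᵃ32ᵇ b a)
      ≡ -ᶠ ((1ᶠ -ᶠ q) ^ᶠ (2 ℕ.* t ℕ.+ 1)
          *ᶠ const (∑ℚ< (suc t) λ i →
               (+ (t ℕ.* ((t ∸ 1) C i) ℕ.+ (t ∸ 1) ℕ.* (t C i)) ℤ.* -1ℤ ℤ.^ i) / 1 ℚ.* K (2 ℕ.* t ∸ i)))
      mod[ p ]q
  S-congruence a b K isK t<p = ↦⇒≡mod
    (↦-+ (S↦M≤ (2ᵃ32ᵇ a b) 0 p′ z≤n (ℕ.n<1+n p′)) (S↦M≤ (2ᵃ32ᵇ b a) 0 p′ z≤n (ℕ.n<1+n p′)))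
    (↦-neg (↦-* (↦-^ 1-q↦ (2 ℕ.* t ℕ.+ 1)) (↦-poly (φ (∑ℚ< (suc t) f)))))
    (R.trans (Cyclotomic.S-symmetric F (Φ.cw≋[z^p-1]F-homo p _ (IsK⇒ p K isK)) a b t<p)
      (negate-sum (δ R.^ (2 ℕ.* t ℕ.+ 1)) (suc t) g (φ ∘ f) (φ (∑ℚ< (suc t) f)) (φ-∑ (suc t) f) f≈))
    where
    t = a ℕ.+ b ℕ.+ 1
    N : ℕ → ℕ
    N i = t ℕ.* ((t ∸ 1) C i) ℕ.+ (t ∸ 1) ℕ.* (t C i)
    f : ℕ → ℚ
    f i = (+ N i ℤ.* -1ℤ ℤ.^ i) / 1 ℚ.* K (2 ℕ.* t ∸ i)
    F g : ℕ → Poly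
    F n = φ (sign (suc n) ℚ.* K n)
    g i = R.cast (N i) R.* F (2 ℕ.* t ∸ i)
    f≈ : ∀ i → i < suc t → φ (f i) R.≈ R.- g i
    f≈ i i≤t = R.trans
      (R.trans (φ.*-homo ((+ N i ℤ.* -1ℤ ℤ.^ i) / 1) (K d))
        (R.*-congʳ {φ (K d)} (R.trans (φ.⟦⟧-cong (ℤ/1.*-homo (+ N i) (-1ℤ ℤ.^ i)))
          (R.trans (φ.*-homo (+ N i / 1) ((-1ℤ ℤ.^ i) / 1))
            (R.*-cong (R.sym (cast≈ (N i))) (R.trans (φ-sign i) (R.sym (sign-parity i d t (ℕ.m+[n∸m]≡n i≤2t)))))))))
      (R.trans (move-sign (R.cast (N i)) ((R.- R.1#) R.^ d) (φ (K d)))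
        (R.-‿cong (R.*-congˡ {R.cast (N i)} (R.sym (R.trans (φ.*-homo (sign (suc d)) (K d))
          (R.*-congʳ {φ (K d)} (φ-sign (suc d))))))))
      where
      d = 2 ℕ.* t ∸ i
      i≤2t : i ≤ 2 ℕ.* t
      i≤2t = ℕ.≤-trans (ℕ.s≤s⁻¹ i≤t) (ℕ.m≤m+n t (1 ℕ.* t))

open import Data.Nat.Base using (_+_; _*_; _>_)
open import Data.Nat.Properties using (m*n≢0)

theorem6p1 :
    ∀ (a b p : ℕ) (p-prime : Prime p) (K : ℕ → ℚ) → IsK p K →
    let t = a + b + 1
        a3b = replicate a 2 ++ 3 ∷ replicate b 2
        b3a = replicate b 2 ++ 3 ∷ replicate a 2
        instance
          p≢0 = prime⇒nonZero p-prime
          p[t+1]≢0 = m*n≢0 p (suc t)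
    in
    p > 2 * t + 1 →
    (H (p ∸ 1) a3b +ᶠ H (p ∸ 1) b3a
      ≡ const ((-1ℤ ℤ.^ (t ∸ 1) ℤ.* + ((p + t) C (2 * t + 1))) / (p * suc t))
          *ᶠ (1ᶠ -ᶠ q) ^ᶠ (2 * t + 1)
      mod[ p ]q)
    ×
    (S (p ∸ 1) a3b +ᶠ S (p ∸ 1) b3a
      ≡ -ᶠ ((1ᶠ -ᶠ q) ^ᶠ (2 * t + 1)
          *ᶠ const (∑ℚ< (suc t) λ i →
               (+ (t * ((t ∸ 1) C i) + (t ∸ 1) * (t C i)) ℤ.* -1ℤ ℤ.^ i) / 1 ℚ.* K (2 * t ∸ i)))
      mod[ p ]q)
theorem6p1 a b (suc p′) p-prime K isK p>2t+1 =
  H-congruence a b {{m*n≢0 (suc p′) (suc (a + b + 1))}} ,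
  S-congruence a b K isK
    (ℕ.≤-<-trans (ℕ.≤-trans (ℕ.m≤m+n (a + b + 1) _) (ℕ.m≤m+n (2 * (a + b + 1)) 1)) p>2t+1)
  where open Evaluation p′ p-prime
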